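{- For $\mathcal D$-almost all $s$ let $\mathfrak L_s$ be a (possibly infinite) algebraic extension of $\mathfrak F_s$ with $\mathfrak L_s\subseteq\mathfrak F_s^{alg}$, and let $\mathfrak L=\prod_s\mathfrak L_s/\mathcal D$. Then: (i) if $[\mathfrak L_s:\mathfrak F_s]=n_s<\infty$ for $\mathcal D$-almost all $s$ and only finitely many positive integers $k$ satisfy $\{s: k\mid n_s\}\in\mathcal D$, then $\mathfrak L_{alg}$ is a finite extension of $\mathbb F$ and $\mathfrak L_{sep}$ is a finite separable extension of $\mathbb F$; (ii) if $\mathfrak L_s/\mathfrak F_s$ is separable for $\mathcal D$-almost all $s$, then $\mathfrak L_{alg}$ is separable over $\mathbb F$ and $\mathfrak L_{alg}=\mathfrak L_{sep}$; (iii) if there is no prime $p$ with $\{s:\operatorname{char}\mathbb F_s=p\}\in\mathcal D$, then $\mathfrak L_{alg}$ is separable over $\mathbb F$ and $\mathfrak L_{alg}=\mathfrak L_{sep}$.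
   Context: Let $S$ be an infinite set, $\mathcal D$ a nonprincipal ultrafilter on $S$; ultraproducts $\prod_sA_s/\mathcal D$ consist of tuples modulo agreement on a set in $\mathcal D$, classes written $\mathrm{ulim}_sa_s$, componentwise operations; "for $\mathcal D$-almost all $s$" means on a set in $\mathcal D$. For each $s$ let $\mathbb F_s$ be a field, $\mathfrak F_s=\mathbb F_s(t)$; $\mathfrak K=\prod_s\mathbb F_s/\mathcal D$, $\mathbb F=\mathfrak K(t)$, viewed inside $\mathcal U(\mathbb F)=\prod_s\mathfrak F_s/\mathcal D$ via $\sum_i(\mathrm{ulim}_sa_{i,s})t^i\mapsto\mathrm{ulim}_s\sum_ia_{i,s}t^i$. Fix algebraic closures $\mathfrak F_s^{alg}$; $\mathbb F^{alg}$ is the set of elements of $\prod_s\mathfrak F_s^{alg}/\mathcal D$ algebraic over $\mathbb F$, and $\mathbb F^{sep}\subseteq\mathbb F^{alg}$ the separable closure. For $\mathfrak L=\prod_s\mathfrak L_s/\mathcal D$ with $\mathfrak F_s\subseteq\mathfrak L_s\subseteq\mathfrak F_s^{alg}$, the algebraic part is $\mathfrak L_{alg}=\mathfrak L\cap\mathbb F^{alg}$ and the separable part is $\mathfrak L_{sep}=\mathfrak L\cap\mathbb F^{sep}$. -}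

module Defs where

open import Algebra.Bundles using (CommutativeRing)
import Algebra.Definitions.RawMonoid as RawMonoidDefs
open import Algebra.Morphism.Structures using (IsRingHomomorphism)
open import Data.Fin.Base using (Fin)
open import Data.List.Base using (List; []; _∷_; foldr; length; map; _∷ʳ_)
open import Data.List.Membership.Propositional using () renaming (_∈_ to _∈ₗ_)
open import Data.List.Relation.Unary.All using (All)
open import Data.List.Relation.Unary.Any using (Any)
open import Data.Nat.Base as ℕ using (ℕ)
open import Data.Nat.Divisibility using (_∣_)
open import Data.Product using (_×_; _,_; proj₁; proj₂; Σ-syntax; ∃; ∃-syntax)
open import Data.Sum.Base using (_⊎_)
open import Function.Bundles using (_⇔_; _⤖_)
open import Level using (Level; _⊔_; suc)
open import Relation.Binary.Definitions using (_Respects_)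
open import Relation.Binary.PropositionalEquality.Core using (_≡_)
open import Relation.Nullary.Negation using (¬_)
open import Relation.Unary
  using (Pred; _∈_; _⊆_; _∩_; ∁; ｛_｝; Universal; Empty)

private
  variable
    a p ℓ : Level

Infinite : Set a → Set a
Infinite S = ¬ (∃[ n ] (Fin n ⤖ S))

FinitelyMany : {A : Set a} → Pred A p → Set (a ⊔ p)
FinitelyMany {A = A} P = Σ[ xs ∈ List A ] (∀ x → x ∈ P → x ∈ₗ xs)

-- A classical field: the stdlib's `HeytingField` carries in addition an
-- apartness relation, which under excluded middle is just `_≉_`.

record Field ℓ : Set (suc ℓ) where
  field
    commutativeRing : CommutativeRing ℓ ℓ

  open CommutativeRing commutativeRing public

  field
    1≉0     : 1# ≉ 0#
    inverse : ∀ x → x ≉ 0# → ∃[ y ] (x * y ≈ 1#)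

------------------------------------------------------------------------
-- Polynomials and subfields

module _ (R : CommutativeRing ℓ ℓ) where
  open CommutativeRing R

  -- The list a₀ ∷ a₁ ∷ … ∷ aₙ ∷ [] stands for a₀ + a₁X + … + aₙXⁿ; the
  -- leading entries are allowed to vanish.

  Poly : Set ℓ
  Poly = List Carrier

module Polynomials (R : CommutativeRing ℓ ℓ) where
  open CommutativeRing R

  coeff : Poly R → ℕ → Carrier
  coeff []      _         = 0#
  coeff (a ∷ p) ℕ.zero    = a
  coeff (a ∷ p) (ℕ.suc i) = coeff p i

  infix 4 _≋_
  _≋_ : Poly R → Poly R → Set ℓ
  p ≋ q = ∀ i → coeff p i ≈ coeff q i

  NonZero : Poly R → Set ℓ
  NonZero = Any (_≉ 0#)

  infixl 6 _+ᵖ_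
  infixl 7 _*ᵖ_

  _+ᵖ_ : Poly R → Poly R → Poly R
  []      +ᵖ q       = q
  (a ∷ p) +ᵖ []      = a ∷ p
  (a ∷ p) +ᵖ (b ∷ q) = (a + b) ∷ (p +ᵖ q)

  _*ᵖ_ : Poly R → Poly R → Poly R
  []      *ᵖ q = []
  (a ∷ p) *ᵖ q = map (a *_) q +ᵖ (0# ∷ (p *ᵖ q))

  -- (a + X p)′ = p + X p′

  derivative : Poly R → Poly R
  derivative []      = []
  derivative (a ∷ p) = p +ᵖ (0# ∷ derivative p)

  eval : Poly R → Carrier → Carrier
  eval p x = foldr (λ a r → a + x * r) 0# p

  Characteristic : ℕ → Set ℓ
  Characteristic n = ∀ m → (m · 1# ≈ 0#) ⇔ (n ∣ m)
    where open RawMonoidDefs +-rawMonoid using () renaming (_×_ to _·_)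

-- All fields of interest are subsets of a fixed ambient ring R, which
-- below is either a field or an ultraproduct of fields.

module Subfields (R : CommutativeRing ℓ ℓ) where
  open CommutativeRing R
  open Polynomials R
  open RawMonoidDefs +-rawMonoid using (sum)

  record IsSubfield (k : Pred Carrier ℓ) : Set ℓ where
    field
      respects  : k Respects _≈_
      0∈        : 0# ∈ k
      1∈        : 1# ∈ k
      1≉0       : 1# ≉ 0#
      +-closed  : ∀ {x y} → x ∈ k → y ∈ k → (x + y) ∈ k
      -‿closed  : ∀ {x} → x ∈ k → (- x) ∈ k
      *-closed  : ∀ {x y} → x ∈ k → y ∈ k → (x * y) ∈ k
      inverse   : ∀ {x} → x ∈ k → x ≉ 0# → ∃[ y ] (y ∈ k × x * y ≈ 1#)

  -- The arguments are always (small field) (large field), so that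
  -- `IsExtension k E` reads "E/k is a field extension inside R".

  record IsExtension (k E : Pred Carrier ℓ) : Set ℓ where
    field
      base     : IsSubfield k
      top      : IsSubfield E
      base⊆top : k ⊆ E

  Annihilates : Pred Carrier ℓ → Poly R → Carrier → Set ℓ
  Annihilates k p x = All k p × eval p x ≈ 0#

  AlgebraicOver : Pred Carrier ℓ → Pred Carrier ℓ
  AlgebraicOver k x = ∃[ p ] (NonZero p × Annihilates k p x)

  -- The monic polynomial with lower coefficients c is c ∷ʳ 1#, of degree
  -- `length c`; a list of length at most n has degree less than n.

  IsMinimalPolynomial : Pred Carrier ℓ → Carrier → Poly R → Set ℓ
  IsMinimalPolynomial k x p =
    Annihilates k p x ×
    ∃[ c ] (p ≡ c ∷ʳ 1# ×
            (∀ q → Annihilates k q x → length q ℕ.≤ length c → ¬ NonZero q))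

  -- p is coprime to its derivative in k[X].

  SeparablePolynomial : Pred Carrier ℓ → Poly R → Set ℓ
  SeparablePolynomial k p =
    ∃[ u ] ∃[ v ] (All k u × All k v ×
                   u *ᵖ p +ᵖ v *ᵖ derivative p ≋ (1# ∷ []))

  SeparableOver : Pred Carrier ℓ → Pred Carrier ℓ
  SeparableOver k x = ∃[ p ] (IsMinimalPolynomial k x p × SeparablePolynomial k p)

  IsAlgebraicExtension : Pred Carrier ℓ → Pred Carrier ℓ → Set ℓ
  IsAlgebraicExtension k E = IsExtension k E × E ⊆ AlgebraicOver k

  IsSeparableExtension : Pred Carrier ℓ → Pred Carrier ℓ → Set ℓ
  IsSeparableExtension k E = IsExtension k E × E ⊆ SeparableOver k

  record IsBasis (k E : Pred Carrier ℓ) {n} (b : Fin n → Carrier) : Set ℓ where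
    field
      members     : ∀ i → b i ∈ E
      spanning    : ∀ {x} → x ∈ E →
                    Σ[ c ∈ (Fin n → Carrier) ]
                      ((∀ i → c i ∈ k) × x ≈ sum (λ i → c i * b i))
      independent : ∀ (c : Fin n → Carrier) → (∀ i → c i ∈ k) →
                    sum (λ i → c i * b i) ≈ 0# → ∀ i → c i ≈ 0#

  -- [E : k] = n

  HasDegree : Pred Carrier ℓ → Pred Carrier ℓ → ℕ → Set ℓ
  HasDegree k E n = IsExtension k E × Σ[ b ∈ (Fin n → Carrier) ] IsBasis k E b

  IsFiniteExtension : Pred Carrier ℓ → Pred Carrier ℓ → Set ℓ
  IsFiniteExtension k E = ∃[ n ] HasDegree k E n

------------------------------------------------------------------------
-- Rational function fields and algebraic closures

module _ {R R′ : CommutativeRing ℓ ℓ} where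
  private
    module R  = CommutativeRing R
    module R′ = CommutativeRing R′

  RingHomomorphism : (R.Carrier → R′.Carrier) → Set ℓ
  RingHomomorphism = IsRingHomomorphism R.rawRing R′.rawRing

  Image : (R.Carrier → R′.Carrier) → Pred R.Carrier ℓ → Pred R′.Carrier ℓ
  Image f A y = ∃[ x ] (x ∈ A × f x R′.≈ y)

  Range : (R.Carrier → R′.Carrier) → Pred R′.Carrier ℓ
  Range f y = ∃[ x ] (f x R′.≈ y)

-- The field k(t) of rational functions: t is transcendental over k and
-- every element is a quotient P(t)/Q(t). This determines k(t) up to
-- unique isomorphism over k and t.

record RationalFunctionField (k : Field ℓ) : Set (suc ℓ) where
  private
    module k = Field k
  field
    k⟨t⟩ : Field ℓ
  open Field k⟨t⟩ public
  open Polynomials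
  field
    embed     : k.Carrier → Carrier
    embed-hom : RingHomomorphism {R = k.commutativeRing} {commutativeRing} embed
    t         : Carrier

  evalₜ : Poly k.commutativeRing → Carrier
  evalₜ P = eval commutativeRing (map embed P) t

  field
    transcendental : ∀ P → NonZero k.commutativeRing P → evalₜ P ≉ 0#
    generated      : ∀ x → ∃[ P ] ∃[ Q ] (NonZero k.commutativeRing Q ×
                                          x * evalₜ Q ≈ evalₜ P)

record AlgebraicClosure (k : Field ℓ) : Set (suc ℓ) where
  private
    module k = Field k
  field
    closure : Field ℓ
  open Field closure public
  open Polynomials commutativeRing
  open Subfields commutativeRing
  field
    embed     : k.Carrier → Carrier
    embed-hom : RingHomomorphism {R = k.commutativeRing} {commutativeRing} embed

  -- k viewed inside its algebraic closure

  baseField : Pred Carrier ℓ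
  baseField = Range {R = k.commutativeRing} {commutativeRing} embed

  field
    algebraic : ∀ x → AlgebraicOver baseField x
    -- every polynomial a + X p with p ≠ 0, i.e. every nonconstant one
    closed    : ∀ a p → NonZero p → ∃[ x ] (eval (a ∷ p) x ≈ 0#)

------------------------------------------------------------------------
-- Ultraproducts

-- Subsets of S are predicates, and A ∈ Large means A ∈ 𝒟.

record Ultrafilter (S : Set ℓ) : Set (suc ℓ) where
  field
    Large    : Pred (Pred S ℓ) ℓ
    whole    : ∀ {A} → Universal A → A ∈ Large
    proper   : ∀ {A} → Empty A → ¬ (A ∈ Large)
    upward   : ∀ {A B} → A ⊆ B → A ∈ Large → B ∈ Large
    ∩-closed : ∀ {A B} → A ∈ Large → B ∈ Large → (A ∩ B) ∈ Large
    ultra    : ∀ A → A ∈ Large ⊎ ∁ A ∈ Large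

  NonPrincipal : Set ℓ
  NonPrincipal = ∀ s → ¬ (｛ s ｝ ∈ Large)

  -- "for 𝒟-almost all s"

  AlmostAll : (S → Set ℓ) → Set ℓ
  AlmostAll A = A ∈ Large

  syntax AlmostAll (λ s → A) = ∀ᴰ[ s ] A

module _ {S : Set ℓ} (D : Ultrafilter S) where
  open Ultrafilter D

  Ultraproduct : (S → CommutativeRing ℓ ℓ) → CommutativeRing ℓ ℓ
  Ultraproduct R = record
    { Carrier = ∀ s → Carrier (R s)
    ; _≈_     = λ x y → ∀ᴰ[ s ] (R s ⊢ x s ≈ y s)
    ; _+_     = λ x y s → _+_ (R s) (x s) (y s)
    ; _*_     = λ x y s → _*_ (R s) (x s) (y s)
    ; -_      = λ x s → -_ (R s) (x s)
    ; 0#      = λ s → 0# (R s)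
    ; 1#      = λ s → 1# (R s)
    ; isCommutativeRing = record
      { isRing = record
        { +-isAbelianGroup = record
          { isGroup = record
            { isMonoid = record
              { isSemigroup = record
                { isMagma = record
                  { isEquivalence = record
                    { refl  = whole λ s → refl (R s)
                    ; sym   = upward λ {s} → sym (R s)
                    ; trans = λ e f → both e f λ s → trans (R s)
                    }
                  ; ∙-cong = λ e f → both e f λ s → +-cong (R s)
                  }
                ; assoc = λ x y z → whole λ s → +-assoc (R s) (x s) (y s) (z s)
                }
              ; identity = (λ x → whole λ s → +-identityˡ (R s) (x s))
                         , (λ x → whole λ s → +-identityʳ (R s) (x s))
              }
            ; inverse = (λ x → whole λ s → -‿inverseˡ (R s) (x s))
                      , (λ x → whole λ s → -‿inverseʳ (R s) (x s))
            ; ⁻¹-cong = upward λ {s} → -‿cong (R s)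
            }
          ; comm = λ x y → whole λ s → +-comm (R s) (x s) (y s)
          }
        ; *-cong     = λ e f → both e f λ s → *-cong (R s)
        ; *-assoc    = λ x y z → whole λ s → *-assoc (R s) (x s) (y s) (z s)
        ; *-identity = (λ x → whole λ s → *-identityˡ (R s) (x s))
                     , (λ x → whole λ s → *-identityʳ (R s) (x s))
        ; distrib    = (λ x y z → whole λ s → distribˡ (R s) (x s) (y s) (z s))
                     , (λ x y z → whole λ s → distribʳ (R s) (x s) (y s) (z s))
        }
      ; *-comm = λ x y → whole λ s → *-comm (R s) (x s) (y s)
      }
    }
    where
    open CommutativeRing

    _⊢_≈_ : (A : CommutativeRing ℓ ℓ) → Carrier A → Carrier A → Set ℓ
    A ⊢ x ≈ y = _≈_ A x y

    both : {A B C : Pred S ℓ} → A ∈ Large → B ∈ Large →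
           (∀ s → A s → B s → C s) → C ∈ Large
    both e f g = upward (λ {s} ab → g s (proj₁ ab) (proj₂ ab)) (∩-closed e f)

  -- ∏ₛ Aₛ / 𝒟 as a subset of ∏ₛ Rₛ / 𝒟, for subsets Aₛ of Rₛ

  InternalSubset : (R : S → CommutativeRing ℓ ℓ) →
                   (∀ s → Pred (CommutativeRing.Carrier (R s)) ℓ) →
                   Pred (CommutativeRing.Carrier (Ultraproduct R)) ℓ
  InternalSubset R A x = ∀ᴰ[ s ] (x s ∈ A s)

  module Functions
    (𝔽 : S → Field ℓ)
    (𝔉 : ∀ s → RationalFunctionField (𝔽 s))
    (𝔉ᵃˡᵍ : ∀ s → AlgebraicClosure (RationalFunctionField.k⟨t⟩ (𝔉 s)))
    where

    private
      module 𝔽 s = Field (𝔽 s)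
      module 𝔉 s = RationalFunctionField (𝔉 s)
      module 𝔉ᵃˡᵍ s = AlgebraicClosure (𝔉ᵃˡᵍ s)

    𝔎 : CommutativeRing ℓ ℓ
    𝔎 = Ultraproduct 𝔽.commutativeRing

    -- 𝒰(𝔽) = ∏ₛ 𝔉ₛ / 𝒟

    𝒰 : CommutativeRing ℓ ℓ
    𝒰 = Ultraproduct 𝔉.commutativeRing

    𝒰ᵃˡᵍ : CommutativeRing ℓ ℓ
    𝒰ᵃˡᵍ = Ultraproduct 𝔉ᵃˡᵍ.commutativeRing

    private
      module 𝒰 = CommutativeRing 𝒰
      module 𝒰ᵃˡᵍ = CommutativeRing 𝒰ᵃˡᵍ

    -- Σᵢ (ulimₛ aᵢ,ₛ) tⁱ ↦ ulimₛ (Σᵢ aᵢ,ₛ tⁱ)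

    polynomialEmbedding : Poly 𝔎 → 𝒰.Carrier
    polynomialEmbedding P s = 𝔉.evalₜ s (map (λ a → a s) P)

    -- The image of 𝔎(t) under the extension of this embedding to fractions

    𝔎⟨t⟩ : Pred 𝒰.Carrier ℓ
    𝔎⟨t⟩ x = ∃[ P ] ∃[ Q ] (Polynomials.NonZero 𝔎 Q ×
                            x 𝒰.* polynomialEmbedding Q 𝒰.≈ polynomialEmbedding P)

    𝒰-embed : 𝒰.Carrier → 𝒰ᵃˡᵍ.Carrier
    𝒰-embed x s = 𝔉ᵃˡᵍ.embed s (x s)

    -- 𝔎(t), and its algebraic and separable closures, inside ∏ₛ 𝔉ₛᵃˡᵍ / 𝒟

    𝐅 : Pred 𝒰ᵃˡᵍ.Carrier ℓ
    𝐅 = Image {R = 𝒰} {𝒰ᵃˡᵍ} 𝒰-embed 𝔎⟨t⟩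

    open Subfields 𝒰ᵃˡᵍ

    𝐅ᵃˡᵍ : Pred 𝒰ᵃˡᵍ.Carrier ℓ
    𝐅ᵃˡᵍ = AlgebraicOver 𝐅

    𝐅ˢᵉᵖ : Pred 𝒰ᵃˡᵍ.Carrier ℓ
    𝐅ˢᵉᵖ = SeparableOver 𝐅

    module Parts (𝔏ₛ : ∀ s → Pred (𝔉ᵃˡᵍ.Carrier s) ℓ) where

      𝔏 : Pred 𝒰ᵃˡᵍ.Carrier ℓ
      𝔏 = InternalSubset 𝔉ᵃˡᵍ.commutativeRing 𝔏ₛ

      𝔏alg : Pred 𝒰ᵃˡᵍ.Carrier ℓ
      𝔏alg = 𝔏 ∩ 𝐅ᵃˡᵍ

      𝔏sep : Pred 𝒰ᵃˡᵍ.Carrier ℓ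
      𝔏sep = 𝔏 ∩ 𝐅ˢᵉᵖ

{-# OPTIONS --safe #-}

-- The heart of the matter is that 𝐅ᵃˡᵍ and 𝒰(𝔽) are linearly disjoint over 𝐅: the
-- basis e₁ … e_M of a finite extension of 𝐅 remains independent over 𝔉ₛ for almost
-- all s. Clearing denominators, the structure constants are polynomials in t of degree
-- less than some h independent of s, and by Łoś the products tⁱ eⱼ, i < N, are
-- independent over 𝔽ₛ for almost all s, for any fixed N. Suppose that the e span a space
-- of dimension r < M over 𝔉ₛ. Let Hₙ consist of the elements of the 𝔽ₛ[t]-span of the
-- e whose degree at t = ∞ is less than n - h - 1. Taking leading coefficients of
-- 𝔉ₛ-relations gives dim Hₙ₊₁/Hₙ ≤ r, and H₀ = 0 as in the proof that a function
-- without poles and with a zero vanishes. Hence dim Hₙ ≤ r n, although H_{N+h+1}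
-- contains the M N independent elements tⁱ eⱼ: a contradiction for large N.
--
-- (i) By the tower law the degree over 𝐅 of every finite extension inside 𝔏 divides nₛ
-- for almost all s, so these degrees are bounded and a maximal one exhausts 𝔏alg. That
-- 𝔏sep is a field uses, in characteristic p, that separability of K/𝐅 means K = 𝐅 Kᵖ.
-- (ii) The minimal polynomial over 𝐅 stays minimal over 𝔉ₛ, where it is separable.
-- (iii) An inseparable element forces d · 1 = 0 for the degree d of its minimal
-- polynomial, hence a prime characteristic for almost all s.

module Submission where

open import Axiom.ExcludedMiddle using (ExcludedMiddle)
open import Data.Nat.Base as ℕ using (ℕ)
open import Data.Nat.Divisibility using (_∣_)
open import Data.Nat.Primality using (Prime)
open import Data.Product using (_×_; ∃-syntax)
open import Level using (Level; Lift)
open import Relation.Nullary.Negation using (¬_)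
open import Relation.Unary using (Pred; _≐_)
open import Defs

open import Algebra.Bundles using (CommutativeRing; RawRing)
import Algebra.Definitions.RawMonoid as RawMonoidDefs
open import Algebra.Morphism.Construct.Composition using (isRingHomomorphism)
open import Algebra.Morphism.Structures using (IsRingHomomorphism)
import Algebra.Properties.CommutativeSemiring.Binomial as Binomial
import Algebra.Properties.CommutativeSemiring.Exp as CommutativeExp
import Algebra.Properties.Semiring.Mult as Mult
import Algebra.Solver.Ring
import Algebra.Solver.Ring.AlmostCommutativeRing as ACR
open import Data.Empty using (⊥-elim)
open import Data.Fin.Base as Fin using (Fin; fromℕ; inject₁; toℕ)
import Data.Fin.Properties as Finₚ
open import Data.List.Base 
  using (List; []; _∷_; _++_; length; map; _∷ʳ_; replicate; initLast; _∷ʳ′_; take; lookup; tabulate)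
open import Data.List.Membership.Propositional using () renaming (_∈_ to _∈ₗ_)
open import Data.List.Properties
  using (length-++; length-map; map-++; length-replicate; length-take; length-tabulate; map-∘; ++-identityʳ)
open import Data.List.Relation.Unary.All as All using (All; []; _∷_)
import Data.List.Relation.Unary.All.Properties as Allₚ
open import Data.List.Relation.Unary.Any as Any using (here; there)
import Data.List.Relation.Unary.Any.Properties as Anyₚ
open import Data.Maybe.Base using (Maybe; just; nothing)
open import Data.Nat.Base using (zero; suc; z≤n; s≤s)
open import Data.Nat.Combinatorics
  using (_C_; nCn≡1; nCk≡nC[n∸k]; nCk+nC[k+1]≡[n+1]C[k+1]; k>n⇒nCk≡0)
open import Data.Nat.Coprimality using (coprime-Bézout; prime⇒coprime)
open import Data.Nat.Divisibility using (divides; ∣⇒≤; m∣m*n; m%n≡0⇒n∣m)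
open import Data.Nat.DivMod using (m≡m%n+[m/n]*n; m%n<n)
open import Data.Nat.GCD using (module Bézout)
open import Data.Nat.ListAction using (product) renaming (sum to total)
open import Data.Nat.Primality using (euclidsLemma; prime⇒nonZero)
open import Data.Nat.Primality.Factorisation using (factorise; PrimeFactorisation)
import Data.Nat.Properties as ℕₚ
open import Data.Nat.Solver using (module +-*-Solver)
open import Data.Product using (_,_; proj₁; proj₂; Σ-syntax)
open import Data.Sum.Base using (inj₁; inj₂)
open import Data.Unit.Polymorphic.Base using (⊤; tt)
open import Function.Bundles using (mk⇔)
open import Level using (lift)
open import Relation.Binary.Definitions using (_Respects_)
open import Relation.Binary.PropositionalEquality as ≡ using (_≡_)
open import Relation.Nullary using (Dec; yes; no)
open import Relation.Nullary.Decidable using (decidable-stable)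
open import Relation.Unary using (_∈_; _∉_; _⊆_; _∩_)

-- The coefficient (m , n) of the solver stands for the integer m - n.

-- Łoś concerns internal sets only, and 𝐅 is not one: independence over 𝐅 does not descend directly,
-- because a relation over 𝔉ₛ may have coefficients whose degree grows with s. What does transfer is
-- independence of finitely many elements over the internal field 𝔨 of constants. The count is
-- therefore arranged so that the number of monomials depends only on the degree of the extension
-- and on h. It resembles Riemann's inequality without the geometry: the dimension present grows
-- with slope M, the dimension permitted grows with slope r, and the boundary terms are constant.
--
-- At s the vectors e are not yet known to be independent, so an element has no well-defined
-- coordinates in them and no well-defined degree. Hence the subspaces are described by the
-- existence of a suitable expression, and dimensions are bounded through the lengths of independent
-- lists. Fields are predicates on one ambient field, so that the same lemmas serve each 𝔉ₛᵃˡᵍ and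
-- their ultraproduct.

module IntegerRingSolver {ℓ : Level} (R : CommutativeRing ℓ ℓ) where
  open CommutativeRing R
  open import Algebra.Properties.Semiring.Mult semiring using (×-homo-+; ×1-homo-*)
    renaming (_×_ to _·_)
  open import Algebra.Properties.Monoid.Mult.TCOptimised +-monoid using (×ᵤ≈×)
    renaming (_×_ to _·′_)
  open import Algebra.Properties.Ring ring using (-‿distribˡ-*; -‿distribʳ-*)
  open import Algebra.Properties.AbelianGroup +-abelianGroup
    using (⁻¹-∙-comm; ⁻¹-involutive; ε⁻¹≈ε)
  open import Algebra.Properties.CommutativeSemigroup
    (CommutativeRing.+-commutativeSemigroup R) using (interchange)
  open import Relation.Binary.Reasoning.Setoid setoid

  coefficients : RawRing _ _
  coefficients = record
    { Carrier = ℕ × ℕ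
    ; _≈_     = _≡_
    ; _+_     = λ { (a , b) (c , d) → a ℕ.+ c , b ℕ.+ d }
    ; _*_     = λ { (a , b) (c , d) → a ℕ.* c ℕ.+ b ℕ.* d , a ℕ.* d ℕ.+ b ℕ.* c }
    ; -_      = λ { (a , b) → b , a }
    ; 0#      = 0 , 0
    ; 1#      = 1 , 0
    }

  almostCommutativeRing : ACR.AlmostCommutativeRing ℓ ℓ
  almostCommutativeRing = ACR.fromCommutativeRing R

  difference-+ : ∀ a b c d → (a + c) - (b + d) ≈ (a - b) + (c - d)
  difference-+ a b c d = begin
    (a + c) - (b + d)     ≈⟨ +-congˡ (⁻¹-∙-comm b d) ⟨
    (a + c) + (- b - d)   ≈⟨ interchange a c (- b) (- d) ⟩
    (a - b) + (c - d)     ∎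

  difference-* : ∀ a b c d → (a * c + b * d) - (a * d + b * c) ≈ (a - b) * (c - d)
  difference-* a b c d = begin
    (a * c + b * d) - (a * d + b * c)         ≈⟨ difference-+ _ _ _ _ ⟩
    (a * c - a * d) + (b * d - b * c)
      ≈⟨ +-cong (+-congˡ (-‿distribʳ-* a d)) (+-comm _ _) ⟩
    (a * c + a * - d) + (- (b * c) + b * d)
      ≈⟨ +-cong (sym (distribˡ a c (- d))) (+-cong (-‿distribˡ-* b c) b*d≈-b*-d) ⟩
    a * (c - d) + (- b * c + - b * - d)       ≈⟨ +-congˡ (distribˡ (- b) c (- d)) ⟨
    a * (c - d) + - b * (c - d)               ≈⟨ distribʳ (c - d) a (- b) ⟨
    (a - b) * (c - d)                         ∎
    where
    b*d≈-b*-d : b * d ≈ - b * - d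
    b*d≈-b*-d = begin
      b * d         ≈⟨ ⁻¹-involutive (b * d) ⟨
      - - (b * d)   ≈⟨ -‿cong (-‿distribʳ-* b d) ⟩
      - (b * - d)   ≈⟨ -‿distribˡ-* b (- d) ⟩
      - b * - d     ∎

  difference : ℕ × ℕ → Carrier
  difference (a , b) = a · 1# - b · 1#

  -- Evaluates (0 , 0) and (1 , 0) to 0# and 1# on the nose.
  value : ℕ × ℕ → Carrier
  value (a , zero)  = a ·′ 1#
  value (a , suc b) = difference (a , suc b)

  value≈difference : ∀ m → value m ≈ difference m
  value≈difference (a , suc b) = refl
  value≈difference (a , zero)  = begin
    a ·′ 1#         ≈⟨ ×ᵤ≈× a 1# ⟨
    a · 1#          ≈⟨ +-identityʳ _ ⟨
    a · 1# + 0#     ≈⟨ +-congˡ ε⁻¹≈ε ⟨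
    a · 1# - 0#     ∎

  morphism : coefficients ACR.-Raw-AlmostCommutative⟶ almostCommutativeRing
  morphism = record
    { ⟦_⟧    = value
    ; +-homo = λ { m@(a , b) n@(c , d) → trans (value≈difference (a ℕ.+ c , b ℕ.+ d)) (trans
        (+-cong (×-homo-+ 1# a c) (-‿cong (×-homo-+ 1# b d))) (trans
        (difference-+ _ _ _ _)
        (sym (+-cong (value≈difference m) (value≈difference n))))) }
    ; *-homo = λ { m@(a , b) n@(c , d) → trans
        (value≈difference (a ℕ.* c ℕ.+ b ℕ.* d , a ℕ.* d ℕ.+ b ℕ.* c)) (trans
        (+-cong (products a c b d) (-‿cong (products a d b c))) (trans
        (difference-* _ _ _ _)
        (sym (*-cong (value≈difference m) (value≈difference n))))) }
    ; -‿homo = λ { m@(a , b) → sym (begin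
        - value m               ≈⟨ -‿cong (value≈difference m) ⟩
        - (a · 1# - b · 1#)     ≈⟨ ⁻¹-∙-comm _ _ ⟨
        - (a · 1#) - - (b · 1#) ≈⟨ +-congˡ (⁻¹-involutive _) ⟩
        - (a · 1#) + b · 1#     ≈⟨ +-comm _ _ ⟩
        b · 1# - a · 1#         ≈⟨ value≈difference (b , a) ⟨
        value (b , a)           ∎) }
    ; 0-homo = refl
    ; 1-homo = refl
    }
    where
    products : ∀ a b c d → (a ℕ.* b ℕ.+ c ℕ.* d) · 1# ≈
                           (a · 1#) * (b · 1#) + (c · 1#) * (d · 1#)
    products a b c d = trans (×-homo-+ 1# (a ℕ.* b) (c ℕ.* d))
                             (+-cong (×1-homo-* a b) (×1-homo-* c d))

  -- Cross sums decide equality of the represented integers, so the solver proves identities valid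
  -- over the integers and detects none peculiar to the characteristic of R.
  equal? : ∀ x y → Maybe (value x ≈ value y)
  equal? (a , b) (c , d) with a ℕ.+ d ℕₚ.≟ c ℕ.+ b
  ... | no  _ = nothing
  ... | yes e = just (trans (value≈difference (a , b)) (trans (begin
    a · 1# - b · 1#                     ≈⟨ +-cancel ⟨
    (a · 1# + d · 1#) - (b · 1# + d · 1#)
      ≈⟨ +-cong (begin
           a · 1# + d · 1#    ≈⟨ ×-homo-+ 1# a d ⟨
           (a ℕ.+ d) · 1#     ≡⟨ ≡.cong (_· 1#) e ⟩
           (c ℕ.+ b) · 1#     ≈⟨ ×-homo-+ 1# c b ⟩
           c · 1# + b · 1#    ∎)
         (-‿cong (+-comm _ _)) ⟩
    (c · 1# + b · 1#) - (d · 1# + b · 1#) ≈⟨ +-cancel ⟩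
    c · 1# - d · 1#                     ∎) (sym (value≈difference (c , d)))))
    where
    +-cancel : ∀ {x y z} → (x + z) - (y + z) ≈ x - y
    +-cancel {x} {y} {z} = trans (difference-+ x y z z)
      (trans (+-congˡ (-‿inverseʳ z)) (+-identityʳ _))

  open Algebra.Solver.Ring coefficients almostCommutativeRing morphism equal? public
    using (solve; _:=_; _:+_; _:*_; _:-_; :-_; con)

-- Spans with coefficients in an additive set

module Spans {ℓ : Level} (R : CommutativeRing ℓ ℓ) where
  open CommutativeRing R
  open IntegerRingSolver R

  record IsAdditive (A : Pred Carrier ℓ) : Set ℓ where
    field
      respects : A Respects _≈_
      0∈       : 0# ∈ A
      +-closed : ∀ {x y} → x ∈ A → y ∈ A → (x + y) ∈ A

  Zero : Pred Carrier ℓ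
  Zero x = x ≈ 0#

  Zero-additive : IsAdditive Zero
  Zero-additive = record
    { respects = λ x≈y x≈0 → trans (sym x≈y) x≈0
    ; 0∈       = refl
    ; +-closed = λ x≈0 y≈0 → trans (+-cong x≈0 y≈0) (+-identityʳ 0#)
    }

  preimage-additive : ∀ {P : Pred Carrier ℓ} a → IsAdditive P → IsAdditive (λ x → (a * x) ∈ P)
  preimage-additive a PA = record
    { respects = λ x≈y → respects (*-congˡ x≈y)
    ; 0∈       = respects (sym (zeroʳ a)) 0∈
    ; +-closed = λ x∈ y∈ → respects (sym (distribˡ a _ _)) (+-closed x∈ y∈)
    }
    where open IsAdditive PA

  -- W + A v₁ + … + A vₙ; the coefficient set A need not be closed under
  -- multiplication (it may consist of the polynomials of bounded degree).

  data SpanMod (W A : Pred Carrier ℓ) : List Carrier → Pred Carrier ℓ where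
    base : ∀ {x} → x ∈ W → SpanMod W A [] x
    step : ∀ {v vs x} c → c ∈ A → ∀ y → y ∈ SpanMod W A vs → x ≈ c * v + y →
           SpanMod W A (v ∷ vs) x

  Span : Pred Carrier ℓ → List Carrier → Pred Carrier ℓ
  Span = SpanMod Zero

  spanMod-respects : ∀ {W A} → W Respects _≈_ → ∀ vs → SpanMod W A vs Respects _≈_
  spanMod-respects r []       x≈y (base x∈)          = base (r x≈y x∈)
  spanMod-respects r (v ∷ vs) x≈y (step c c∈ z z∈ e) = step c c∈ z z∈ (trans (sym x≈y) e)

  module _ {W A : Pred Carrier ℓ} (WA : IsAdditive W) (AA : IsAdditive A) where
    private
      module W = IsAdditive WA
      module A = IsAdditive AA

    spanMod-skip : ∀ {v x} vs → x ∈ SpanMod W A vs → x ∈ SpanMod W A (v ∷ vs)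
    spanMod-skip {v} {x} vs x∈ =
      step 0# A.0∈ x x∈ (solve 2 (λ v x → x := con (0 , 0) :* v :+ x) refl v x)

    spanMod-base : ∀ vs → W ⊆ SpanMod W A vs
    spanMod-base []       x∈ = base x∈
    spanMod-base (v ∷ vs) x∈ = spanMod-skip vs (spanMod-base vs x∈)

    spanMod-+ : ∀ vs {x y} → x ∈ SpanMod W A vs → y ∈ SpanMod W A vs → (x + y) ∈ SpanMod W A vs
    spanMod-+ []       (base x∈) (base y∈) = base (W.+-closed x∈ y∈)
    spanMod-+ (v ∷ vs) (step c c∈ x′ x′∈ e) (step d d∈ y′ y′∈ f) =
      step (c + d) (A.+-closed c∈ d∈) (x′ + y′) (spanMod-+ vs x′∈ y′∈)
      (trans (+-cong e f) (solve 5 (λ c d v x y →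
        c :* v :+ x :+ (d :* v :+ y) := (c :+ d) :* v :+ (x :+ y)) refl c d v x′ y′))

    spanMod-additive : ∀ vs → IsAdditive (SpanMod W A vs)
    spanMod-additive vs = record
      { respects = spanMod-respects W.respects vs
      ; 0∈       = spanMod-base vs W.0∈
      ; +-closed = spanMod-+ vs
      }

  -- Only the scaled generators have to lie in P; P itself need not be closed under scaling by A.
  -- This suits coefficients of bounded degree, which are not closed under products.
  spanMod-elim : ∀ {W A P} → IsAdditive P → W ⊆ P →
                 ∀ {vs} → All (λ v → ∀ c → c ∈ A → (c * v) ∈ P) vs → SpanMod W A vs ⊆ P
  spanMod-elim PA W⊆P []         (base x∈) = W⊆P x∈
  spanMod-elim PA W⊆P (v∈ ∷ vs∈) (step c c∈ y y∈ e) =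
    respects (sym e) (+-closed (v∈ c c∈) (spanMod-elim PA W⊆P vs∈ y∈))
    where open IsAdditive PA

  span-elim : ∀ {A P} → IsAdditive P →
              ∀ {vs} → All (λ v → ∀ c → c ∈ A → (c * v) ∈ P) vs → Span A vs ⊆ P
  span-elim PA = spanMod-elim PA λ x≈0 → respects (sym x≈0) 0∈
    where open IsAdditive PA

  spanMod-scale : ∀ {W W′ A A′ a} → (∀ {x} → x ∈ W → (a * x) ∈ W′) →
                  (∀ {c} → c ∈ A → (a * c) ∈ A′) →
                  ∀ vs {x} → x ∈ SpanMod W A vs → (a * x) ∈ SpanMod W′ A′ vs
  spanMod-scale w α []       (base x∈) = base (w x∈)
  spanMod-scale {a = a} w α (v ∷ vs) (step c c∈ y y∈ e) =
    step (a * c) (α c∈) (a * y) (spanMod-scale w α vs y∈)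
    (trans (*-congˡ e) (solve 4 (λ a c v y →
      a :* (c :* v :+ y) := a :* c :* v :+ a :* y) refl a c v y))

  span-scale : ∀ {A A′ a} → (∀ {c} → c ∈ A → (a * c) ∈ A′) →
               ∀ vs {x} → x ∈ Span A vs → (a * x) ∈ Span A′ vs
  span-scale {a = a} = spanMod-scale λ x≈0 → trans (*-congˡ x≈0) (zeroʳ a)

  span-map-* : ∀ {A} a vs {x} → x ∈ Span A vs → (a * x) ∈ Span A (map (a *_) vs)
  span-map-* a []       (base x≈0) = base (trans (*-congˡ x≈0) (zeroʳ a))
  span-map-* a (v ∷ vs) (step c c∈ y y∈ e) =
    step c c∈ (a * y) (span-map-* a vs y∈)
    (trans (*-congˡ e) (solve 4 (λ a c v y →
      a :* (c :* v :+ y) := c :* (a :* v) :+ a :* y) refl a c v y))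

  spanMod-mono : ∀ {W W′ A A′} → W ⊆ W′ → A ⊆ A′ → ∀ vs → SpanMod W A vs ⊆ SpanMod W′ A′ vs
  spanMod-mono w α []       (base x∈) = base (w x∈)
  spanMod-mono w α (v ∷ vs) (step c c∈ y y∈ e) = step c (α c∈) y (spanMod-mono w α vs y∈) e

  span-mono : ∀ {A A′} → A ⊆ A′ → ∀ vs → Span A vs ⊆ Span A′ vs
  span-mono = spanMod-mono λ x≈0 → x≈0

  span-++ : ∀ {A} us {vs x y} → x ∈ Span A us → y ∈ Span A vs → (x + y) ∈ Span A (us ++ vs)
  span-++ []       {vs} {x} {y} (base x≈0) y∈ =
    spanMod-respects (IsAdditive.respects Zero-additive) vs
      (sym (trans (+-congʳ x≈0) (+-identityˡ y))) y∈
  span-++ (u ∷ us) {y = y} (step c c∈ z z∈ e) y∈ =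
    step c c∈ (z + y) (span-++ us z∈ y∈) (trans (+-congʳ e) (+-assoc _ _ _))

  Zero-scale : ∀ a {x} → x ∈ Zero → (a * x) ∈ Zero
  Zero-scale a x≈0 = trans (*-congˡ x≈0) (zeroʳ a)

  -- All products, in one block for each f. In the tower law `es` is a basis of the lower step and
  -- `fs` a basis of the upper one.
  tensor : List Carrier → List Carrier → List Carrier
  tensor es []       = []
  tensor es (f ∷ fs) = map (_* f) es ++ tensor es fs

  length-tensor : ∀ es fs → length (tensor es fs) ≡ length fs ℕ.* length es
  length-tensor es []       = ≡.refl
  length-tensor es (f ∷ fs) = ≡.trans (length-++ (map (_* f) es))
    (≡.cong₂ ℕ._+_ (length-map (_* f) es) (length-tensor es fs))

  All-tensor : ∀ {P : Pred Carrier ℓ} {es fs} →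
               All (λ f → All (λ e → (e * f) ∈ P) es) fs → All P (tensor es fs)
  All-tensor []         = []
  All-tensor (f∈ ∷ fs∈) = Allₚ.++⁺ (Allₚ.map⁺ f∈) (All-tensor fs∈)

  span-map-*ʳ : ∀ {A} a vs {x} → x ∈ Span A vs → (x * a) ∈ Span A (map (_* a) vs)
  span-map-*ʳ a []       (base x≈0) = base (trans (*-congʳ x≈0) (zeroˡ a))
  span-map-*ʳ a (v ∷ vs) (step c c∈ y y∈ e) =
    step c c∈ (y * a) (span-map-*ʳ a vs y∈)
    (trans (*-congʳ e) (solve 4 (λ a c v y →
      (c :* v :+ y) :* a := c :* (v :* a) :+ y :* a) refl a c v y))

  -- The spanning half of the tower law. Since A and B are mere sets of coefficients, it also
  -- expands polynomials of bounded degree in powers of t.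
  span-tensor : ∀ {A B es} → A ⊆ Span B es → ∀ fs → Span A fs ⊆ Span B (tensor es fs)
  span-tensor A⊆ []       (base x≈0) = base x≈0
  span-tensor {es = es} A⊆ (f ∷ fs) (step c c∈ y y∈ e) =
    spanMod-respects (IsAdditive.respects Zero-additive) (tensor es (f ∷ fs)) (sym e)
      (span-++ (map (_* f) es) (span-map-*ʳ f es (A⊆ c∈)) (span-tensor A⊆ fs y∈))

-- Independence, Steinitz exchange and the tower law

module LinearAlgebra {ℓ : Level} (em : ExcludedMiddle ℓ) (Ω : Field ℓ) where
  open Field Ω renaming (inverse to field-inverse)
  open IntegerRingSolver commutativeRing
  open Spans commutativeRing public
  open Subfields commutativeRing
  open import Relation.Binary.Reasoning.Setoid setoid

  *-integral : ∀ {x y} → x * y ≈ 0# → x ≉ 0# → y ≈ 0#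
  *-integral {x} {y} xy≈0 x≉0 with field-inverse x x≉0
  ... | z , xz≈1 = begin
    y            ≈⟨ *-identityˡ y ⟨
    1# * y       ≈⟨ *-congʳ xz≈1 ⟨
    x * z * y    ≈⟨ solve 3 (λ x y z → x :* z :* y := z :* (x :* y)) refl x y z ⟩
    z * (x * y)  ≈⟨ Zero-scale z xy≈0 ⟩
    0#           ∎

  *-≉0 : ∀ {x y} → x ≉ 0# → y ≉ 0# → x * y ≉ 0#
  *-≉0 x≉0 y≉0 xy≈0 = y≉0 (*-integral xy≈0 x≉0)

  x-y≈0⇒x≈y : ∀ {x y} → x - y ≈ 0# → x ≈ y
  x-y≈0⇒x≈y {x} {y} e = begin
    x          ≈⟨ solve 2 (λ x y → x := x :- y :+ y) refl x y ⟩
    x - y + y  ≈⟨ +-congʳ e ⟩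
    0# + y     ≈⟨ +-identityˡ y ⟩
    y          ∎

  -- Triangular form of independence in the quotient by W: each vector avoids the span of the later
  -- ones. For a field k and a k-subspace W this is the usual notion, without families of
  -- coefficients and suited to recursion on lists.
  Independent : Pred Carrier ℓ → Pred Carrier ℓ → List Carrier → Set ℓ
  Independent W k []       = ⊤
  Independent W k (v ∷ vs) = v ∉ SpanMod W k vs × Independent W k vs

  independent-++ʳ : ∀ {W k} us {vs} → Independent W k (us ++ vs) → Independent W k vs
  independent-++ʳ []       i       = i
  independent-++ʳ (u ∷ us) (_ , i) = independent-++ʳ us i

  module Over {k : Pred Carrier ℓ} (kF : IsSubfield k) where
    open IsSubfield kF public hiding (1≉0)

    additive : IsAdditive k
    additive = record { respects = respects ; 0∈ = 0∈ ; +-closed = +-closed }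

    span-additive : ∀ vs → IsAdditive (Span k vs)
    span-additive = spanMod-additive Zero-additive additive

    span-respects : ∀ vs {x y} → x ≈ y → x ∈ Span k vs → y ∈ Span k vs
    span-respects vs = IsAdditive.respects (span-additive vs)

    span-0 : ∀ vs → 0# ∈ Span k vs
    span-0 vs = IsAdditive.0∈ (span-additive vs)

    span-+ : ∀ vs {x y} → x ∈ Span k vs → y ∈ Span k vs → (x + y) ∈ Span k vs
    span-+ vs = IsAdditive.+-closed (span-additive vs)

    span-scale-k : ∀ {a} vs {x} → a ∈ k → x ∈ Span k vs → (a * x) ∈ Span k vs
    span-scale-k vs a∈ = span-scale (*-closed a∈) vs

    -1*x≈-x : ∀ x → - 1# * x ≈ - x
    -1*x≈-x = solve 1 (λ x → (:- con (1 , 0)) :* x := :- x) refl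

    span-neg : ∀ vs {x} → x ∈ Span k vs → (- x) ∈ Span k vs
    span-neg vs {x} x∈ = span-respects vs (-1*x≈-x x)
      (span-scale-k vs (-‿closed 1∈) x∈)

    module _ {W : Pred Carrier ℓ} (WA : IsAdditive W) where

      spanMod-head : ∀ {v} vs → v ∈ SpanMod W k (v ∷ vs)
      spanMod-head {v} vs =
        step 1# 1∈ 0# (spanMod-base WA additive vs (IsAdditive.0∈ WA))
        (solve 1 (λ v → v := con (1 , 0) :* v :+ con (0 , 0)) refl v)

      spanMod-members : ∀ vs → All (SpanMod W k vs) vs
      spanMod-members []       = []
      spanMod-members (v ∷ vs) =
        spanMod-head vs ∷ All.map (spanMod-skip WA additive vs) (spanMod-members vs)

      spanMod-⊆ : (∀ {a x} → a ∈ k → x ∈ W → (a * x) ∈ W) →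
                  ∀ {us} vs → All (SpanMod W k vs) us → SpanMod W k us ⊆ SpanMod W k vs
      spanMod-⊆ scale vs us∈ = spanMod-elim (spanMod-additive WA additive vs)
        (spanMod-base WA additive vs)
        (All.map (λ u∈ c c∈ → spanMod-scale (scale c∈) (*-closed c∈) vs u∈) us∈)

    span-members : ∀ vs → All (Span k vs) vs
    span-members = spanMod-members Zero-additive

    span-⊆ : ∀ {us} vs → All (Span k vs) us → Span k us ⊆ Span k vs
    span-⊆ = spanMod-⊆ Zero-additive λ {a} _ → Zero-scale a

    span-++ˡ : ∀ us {vs} → Span k vs ⊆ Span k (us ++ vs)
    span-++ˡ []       x∈ = x∈
    span-++ˡ (u ∷ us) x∈ = spanMod-skip Zero-additive additive (us ++ _) (span-++ˡ us x∈)

    keep : ∀ {P : Set ℓ} → Dec P → Carrier → List Carrier → List Carrier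
    keep (yes _) v vs = vs
    keep (no  _) v vs = v ∷ vs

    -- A sieve from the right: a vector survives unless it lies in the span of the survivors after
    -- it.
    extract : Pred Carrier ℓ → List Carrier → List Carrier
    extract W []       = []
    extract W (v ∷ vs) = keep (em {P = v ∈ SpanMod W k (extract W vs)}) v (extract W vs)

    extract-independent : ∀ W vs → Independent W k (extract W vs)
    extract-independent W []       = tt
    extract-independent W (v ∷ vs) with em {P = v ∈ SpanMod W k (extract W vs)}
    ... | yes _  = extract-independent W vs
    ... | no  v∉ = v∉ , extract-independent W vs

    extract-spans : ∀ {W} → IsAdditive W → ∀ vs → All (SpanMod W k (extract W vs)) vs
    extract-spans     WA []       = []
    extract-spans {W} WA (v ∷ vs) with em {P = v ∈ SpanMod W k (extract W vs)}
    ... | yes v∈ = v∈ ∷ extract-spans WA vs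
    ... | no  _  = spanMod-head WA (extract W vs) ∷
                   All.map (spanMod-skip WA additive (extract W vs)) (extract-spans WA vs)

    extract-All : ∀ {W} {P : Pred Carrier ℓ} {vs} → All P vs → All P (extract W vs)
    extract-All     []                 = []
    extract-All {W} {vs = v ∷ vs} (v∈ ∷ vs∈) with em {P = v ∈ SpanMod W k (extract W vs)}
    ... | yes _ = extract-All vs∈
    ... | no  _ = v∈ ∷ extract-All vs∈

    extract-length : ∀ W vs → length (extract W vs) ℕ.≤ length vs
    extract-length W []       = z≤n
    extract-length W (v ∷ vs) with em {P = v ∈ SpanMod W k (extract W vs)}
    ... | yes _ = ℕₚ.m≤n⇒m≤1+n (extract-length W vs)
    ... | no  _ = s≤s (extract-length W vs)

    -- Sieving only deletes vectors, so a list that has not become shorter is unchanged.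
    extract-full : ∀ W vs → length vs ℕ.≤ length (extract W vs) → Independent W k vs
    extract-full W vs full = ≡.subst (Independent W k) (whole vs full) (extract-independent W vs)
      where
      whole : ∀ vs → length vs ℕ.≤ length (extract W vs) → extract W vs ≡ vs
      whole []       _ = ≡.refl
      whole (v ∷ vs) n≤ with em {P = v ∈ SpanMod W k (extract W vs)}
      whole (v ∷ vs) n≤       | yes _ = ⊥-elim (ℕₚ.<⇒≱ n≤ (extract-length W vs))
      whole (v ∷ vs) (s≤s n≤) | no  _ = ≡.cong (v ∷_) (whole vs n≤)

    -- Because the sieve works from the right, an independent tail passes through untouched. This
    -- serves to extend an independent list to a basis.
    extract-suffix : ∀ {W} us {vs} → Independent W k vs → ∃[ ws ] (extract W (us ++ vs) ≡ ws ++ vs)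
    extract-suffix {W} []       i = [] , whole _ i
      where
      whole : ∀ vs → Independent W k vs → extract W vs ≡ vs
      whole []       _        = ≡.refl
      whole (v ∷ vs) (v∉ , i) with em {P = v ∈ SpanMod W k (extract W vs)}
      ... | yes v∈ = ⊥-elim (v∉ (≡.subst (λ vs → v ∈ SpanMod W k vs) (whole vs i) v∈))
      ... | no  _  = ≡.cong (v ∷_) (whole vs i)
    extract-suffix {W} (u ∷ us) {vs} i
      with em {P = u ∈ SpanMod W k (extract W (us ++ vs))} | extract-suffix us i
    ... | yes _ | ws , e = ws , e
    ... | no  _ | ws , e = u ∷ ws , ≡.cong (u ∷_) e

    unscale : ∀ {V c v} → IsAdditive V → (∀ {a x} → a ∈ k → x ∈ V → (a * x) ∈ V) →
              c ∈ k → c ≉ 0# → (c * v) ∈ V → v ∈ V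
    unscale {c = c} {v} VA scale c∈ c≉0 cv∈ =
      let d , d∈ , cd≈1 = inverse c∈ c≉0 in
      IsAdditive.respects VA (begin
        d * (c * v)   ≈⟨ solve 3 (λ c d v → d :* (c :* v) := c :* d :* v) refl c d v ⟩
        c * d * v     ≈⟨ *-congʳ cd≈1 ⟩
        1# * v        ≈⟨ *-identityˡ v ⟩
        v             ∎) (scale d∈ cv∈)

    subtract : ∀ {V x y} → IsAdditive V → (∀ {a x} → a ∈ k → x ∈ V → (a * x) ∈ V) →
               (x + y) ∈ V → y ∈ V → x ∈ V
    subtract {x = x} {y} VA scale xy∈ y∈ =
      IsAdditive.respects VA (solve 2 (λ x y → x :+ y :+ (:- con (1 , 0)) :* y := x) refl x y)
        (IsAdditive.+-closed VA xy∈ (scale (-‿closed 1∈) y∈))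

    -- `ws` holds the vectors already in place. As v is not in their span, some u has a nonzero
    -- coefficient in v; the first such u is solved for and dropped.
    exchange : ∀ us {ws v} → v ∈ Span k (us ++ ws) → v ∉ Span k ws →
               ∃[ us′ ] (length us ≡ suc (length us′) ×
                         All (Span k (us′ ++ v ∷ ws)) (us ++ ws))
    exchange []       v∈ v∉ = ⊥-elim (v∉ v∈)
    exchange (u ∷ us) {ws} {v} (step c c∈ y y∈ e) v∉ with em {P = c ≈ 0#}
    ... | yes c≈0 with exchange us (span-respects (us ++ ws) y≈v y∈) v∉
      where
      y≈v : y ≈ v
      y≈v = sym (trans e (trans (+-congʳ (trans (*-congʳ c≈0) (zeroˡ u))) (+-identityˡ y)))
    ...   | us′ , len , us∈ = u ∷ us′ , ≡.cong suc len ,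
            spanMod-head Zero-additive (us′ ++ v ∷ ws) ∷
            All.map (spanMod-skip Zero-additive additive (us′ ++ v ∷ ws)) us∈
    exchange (u ∷ us) {ws} {v} (step c c∈ y y∈ e) v∉ | no c≉0 =
      us , ≡.refl , u∈ ∷ rest
      where
      V = span-additive (us ++ v ∷ ws)

      ws∈ : All (Span k (v ∷ ws)) (v ∷ ws)
      ws∈ = span-members (v ∷ ws)

      rest : All (Span k (us ++ v ∷ ws)) (us ++ ws)
      rest with Allₚ.++⁻ us (span-members (us ++ v ∷ ws))
      ... | us∈ , _ ∷ ws∈ = Allₚ.++⁺ us∈ ws∈

      v∈ : v ∈ Span k (us ++ v ∷ ws)
      v∈ = span-++ˡ us (All.head ws∈)

      u∈ : u ∈ Span k (us ++ v ∷ ws)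
      u∈ = unscale V (span-scale-k (us ++ v ∷ ws)) c∈ c≉0 (subtract V (span-scale-k (us ++ v ∷ ws))
        (IsAdditive.respects V e v∈) (span-⊆ (us ++ v ∷ ws) rest y∈))

    steinitz : ∀ us vs → Independent Zero k vs → All (Span k us) vs → length vs ℕ.≤ length us
    steinitz us vs i vs∈ with replace vs i vs∈
      where
      -- Vectors are exchanged from the end of `vs`, so those in place form a tail, and independence
      -- says precisely that the next v avoids its span.
      replace : ∀ vs → Independent Zero k vs → All (Span k us) vs →
                ∃[ us′ ] (length us ≡ length vs ℕ.+ length us′ ×
                          All (Span k (us′ ++ vs)) us)
      replace []       i vs∈ = us , ≡.refl ,
        ≡.subst (λ ws → All (Span k ws) us) (≡.sym (++-identityʳ us)) (span-members us)
        where open import Data.List.Properties using (++-identityʳ)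
      replace (v ∷ vs) (v∉ , i) (v∈ ∷ vs∈) with replace vs i vs∈
      ... | us′ , len , us∈ with exchange us′ (span-⊆ (us′ ++ vs) us∈ v∈) v∉
      ...   | us″ , len′ , us′∈ = us″ ,
              ≡.trans len (≡.trans (≡.cong (length vs ℕ.+_) len′) (ℕₚ.+-suc _ _)) ,
              All.map (span-⊆ (us″ ++ v ∷ vs) us′∈) us∈
    ... | us′ , len , _ = ≡.subst (length vs ℕ.≤_) (≡.sym len) (ℕₚ.m≤m+n _ _)

  module _ {k K : Pred Carrier ℓ} (kF : IsSubfield k) (KF : IsSubfield K) (k⊆K : k ⊆ K) where
    private
      module k = Over kF
      module K = Over KF

    tensor-⊆ : ∀ {es} → All K es → ∀ fs → Span k (tensor es fs) ⊆ Span K fs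
    tensor-⊆ {es} es∈ fs = span-elim (K.span-additive fs)
      (All-tensor (All.map (λ {f} f∈ → All.map (λ {e} e∈ c c∈ →
         K.span-respects fs (*-assoc c e f)
           (K.span-scale-k fs (K.*-closed (k⊆K c∈) e∈) f∈)) es∈)
         (K.span-members fs)))

    -- The other half of the tower law. A dependence in the block of f reads e f = a f + y with a in
    -- the k-span of later elements of `es` and y in the K-span of later elements of `fs`. Then e -
    -- a is a nonzero element of K, and dividing by it puts f itself into that K-span.
    tensor-independent : ∀ {es} → All K es → Independent Zero k es →
                         ∀ fs → Independent Zero K fs → Independent Zero k (tensor es fs)
    tensor-independent es∈ i []       _        = tt
    tensor-independent {es} es∈ i (f ∷ fs) (f∉ , j) = row es∈ i
      where
      row : ∀ {es′} → All K es′ → Independent Zero k es′ →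
            Independent Zero k (map (_* f) es′ ++ tensor es fs)
      row []                              _        = tensor-independent es∈ i fs j
      row {es′ = e ∷ es′} (e∈ ∷ es′∈) (e∉ , i′) =
        (λ ef∈ → f∉ (contradict ef∈)) , row es′∈ i′
        where
        split : ∀ us {x} → x ∈ Span k (map (_* f) us ++ tensor es fs) →
                ∃[ a ] (a ∈ Span k us × ∃[ y ] (y ∈ Span K fs × x ≈ a * f + y))
        split []       {x} x∈ =
          0# , base refl , x , tensor-⊆ es∈ fs x∈ ,
          solve 2 (λ f x → x := con (0 , 0) :* f :+ x) refl f x
        split (u ∷ us) (step c c∈ z z∈ e) with split us z∈
        ... | a , a∈ , y , y∈ , e′ = c * u + a , step c c∈ a a∈ refl , y , y∈ ,
          trans e (trans (+-congˡ e′) (solve 5 (λ c u f a y →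
            c :* (u :* f) :+ (a :* f :+ y) := (c :* u :+ a) :* f :+ y) refl c u f a y))

        contradict : (e * f) ∈ Span k (map (_* f) es′ ++ tensor es fs) → f ∈ Span K fs
        contradict ef∈ with split es′ ef∈
        ... | a , a∈ , y , y∈ , eq with K.inverse e-a∈ e-a≉0
          where
          a∈K : a ∈ K
          a∈K = span-elim K.additive (All.map (λ v∈ c c∈ → K.*-closed (k⊆K c∈) v∈) es′∈) a∈
          e-a∈ : (e - a) ∈ K
          e-a∈ = K.+-closed e∈ (K.-‿closed a∈K)
          e-a≉0 : e - a ≉ 0#
          e-a≉0 eq = e∉ (k.span-respects es′ (sym (x-y≈0⇒x≈y eq)) a∈)
        ...   | b , b∈ , eq′ = K.span-respects fs (begin
          b * y                       ≈⟨ *-congˡ (begin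
            y                           ≈⟨ solve 2 (λ z y → y := z :+ y :- z) refl (a * f) y ⟩
            a * f + y - a * f           ≈⟨ +-congʳ eq ⟨
            e * f - a * f               ≈⟨ solve 3 (λ e f a → e :* f :- a :* f := (e :- a) :* f) refl e f a ⟩
            (e - a) * f                 ∎) ⟩
          b * ((e - a) * f)           ≈⟨ solve 3 (λ b c f → b :* (c :* f) := c :* b :* f) refl b (e - a) f ⟩
          (e - a) * b * f             ≈⟨ *-congʳ eq′ ⟩
          1# * f                      ≈⟨ *-identityˡ f ⟩
          f                           ∎) (K.span-scale-k fs b∈ y∈)

length-∷ʳ : ∀ {a} {A : Set a} (x : A) xs → length (xs ∷ʳ x) ≡ suc (length xs)
length-∷ʳ x xs = ≡.trans (length-++ xs) (ℕₚ.+-comm (length xs) 1)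

-- Polynomial arithmetic, derivatives and division

module PolynomialProperties {ℓ : Level} (R : CommutativeRing ℓ ℓ) where
  open CommutativeRing R
  open Polynomials R
  open IntegerRingSolver R
  open import Algebra.Properties.Semiring.Exp semiring using (_^_)
  open import Algebra.Properties.Semiring.Mult semiring using ()
    renaming (_×_ to _·_; ×-congʳ to ·-congʳ)
  open import Relation.Binary.Reasoning.Setoid setoid

  coeff-+ : ∀ p q i → coeff (p +ᵖ q) i ≈ coeff p i + coeff q i
  coeff-+ []      q       i       = sym (+-identityˡ _)
  coeff-+ (a ∷ p) []      i       = sym (+-identityʳ _)
  coeff-+ (a ∷ p) (b ∷ q) zero    = refl
  coeff-+ (a ∷ p) (b ∷ q) (suc i) = coeff-+ p q i

  coeff-map-* : ∀ a p i → coeff (map (a *_) p) i ≈ a * coeff p i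
  coeff-map-* a []      i       = sym (zeroʳ a)
  coeff-map-* a (b ∷ p) zero    = refl
  coeff-map-* a (b ∷ p) (suc i) = coeff-map-* a p i

  coeff-scale-* : ∀ a p q i → coeff (map (a *_) p *ᵖ q) i ≈ a * coeff (p *ᵖ q) i
  coeff-scale-* a []      q i = sym (zeroʳ a)
  coeff-scale-* a (b ∷ p) q i = begin
    coeff (map (a * b *_) q +ᵖ (0# ∷ (map (a *_) p *ᵖ q))) i
      ≈⟨ coeff-+ (map (a * b *_) q) _ i ⟩
    coeff (map (a * b *_) q) i + coeff (0# ∷ (map (a *_) p *ᵖ q)) i
      ≈⟨ +-cong (trans (coeff-map-* (a * b) q i) (*-assoc a b _)) (shifted i) ⟩
    a * (b * coeff q i) + a * coeff (0# ∷ (p *ᵖ q)) i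
      ≈⟨ distribˡ a _ _ ⟨
    a * (b * coeff q i + coeff (0# ∷ (p *ᵖ q)) i)
      ≈⟨ *-congˡ (trans (coeff-+ (map (b *_) q) _ i) (+-congʳ (coeff-map-* b q i))) ⟨
    a * coeff (map (b *_) q +ᵖ (0# ∷ (p *ᵖ q))) i   ∎
    where
    shifted : ∀ i → coeff (0# ∷ (map (a *_) p *ᵖ q)) i ≈ a * coeff (0# ∷ (p *ᵖ q)) i
    shifted zero    = sym (zeroʳ a)
    shifted (suc i) = coeff-scale-* a p q i

  coeff-derivative : ∀ p i → coeff (derivative p) i ≈ suc i · coeff p (suc i)
  coeff-derivative []      i       = sym (zeros (suc i))
    where
    zeros : ∀ n → n · 0# ≈ 0#
    zeros zero    = refl
    zeros (suc n) = trans (+-identityˡ _) (zeros n)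
  coeff-derivative (a ∷ p) zero    = coeff-+ p (0# ∷ derivative p) 0
  coeff-derivative (a ∷ p) (suc i) =
    trans (coeff-+ p (0# ∷ derivative p) (suc i)) (+-congˡ (coeff-derivative p i))

  derivative-cong : ∀ p q → p ≋ q → derivative p ≋ derivative q
  derivative-cong p q p≋q i = begin
    coeff (derivative p) i    ≈⟨ coeff-derivative p i ⟩
    suc i · coeff p (suc i)   ≈⟨ ·-congʳ (suc i) (p≋q (suc i)) ⟩
    suc i · coeff q (suc i)   ≈⟨ coeff-derivative q i ⟨
    coeff (derivative q) i    ∎

  eval-congʳ : ∀ p {x y} → x ≈ y → eval p x ≈ eval p y
  eval-congʳ []      x≈y = refl
  eval-congʳ (a ∷ p) x≈y = +-congˡ (*-cong x≈y (eval-congʳ p x≈y))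

  eval-≋[] : ∀ p → p ≋ [] → ∀ x → eval p x ≈ 0#
  eval-≋[] []      _   x = refl
  eval-≋[] (a ∷ p) p≋0 x = begin
    a + x * eval p x  ≈⟨ +-cong (p≋0 0) (*-congˡ (eval-≋[] p (λ i → p≋0 (suc i)) x)) ⟩
    0# + x * 0#       ≈⟨ trans (+-identityˡ _) (zeroʳ x) ⟩
    0#                ∎

  eval-cong : ∀ p q → p ≋ q → ∀ x → eval p x ≈ eval q x
  eval-cong []      q       p≋q x = sym (eval-≋[] q (λ i → sym (p≋q i)) x)
  eval-cong (a ∷ p) []      p≋q x = eval-≋[] (a ∷ p) p≋q x
  eval-cong (a ∷ p) (b ∷ q) p≋q x =
    +-cong (p≋q 0) (*-congˡ (eval-cong p q (λ i → p≋q (suc i)) x))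

  eval-+ : ∀ p q x → eval (p +ᵖ q) x ≈ eval p x + eval q x
  eval-+ []      q       x = sym (+-identityˡ _)
  eval-+ (a ∷ p) []      x = sym (+-identityʳ _)
  eval-+ (a ∷ p) (b ∷ q) x = trans (+-congˡ (*-congˡ (eval-+ p q x)))
    (solve 5 (λ a b x y z → a :+ b :+ x :* (y :+ z) := a :+ x :* y :+ (b :+ x :* z))
       refl a b x (eval p x) (eval q x))

  eval-0∷ : ∀ p x → eval (0# ∷ p) x ≈ x * eval p x
  eval-0∷ p x = +-identityˡ _

  eval-map-* : ∀ a p x → eval (map (a *_) p) x ≈ a * eval p x
  eval-map-* a []      x = sym (zeroʳ a)
  eval-map-* a (b ∷ p) x = trans (+-congˡ (*-congˡ (eval-map-* a p x)))
    (solve 4 (λ a b x y → a :* b :+ x :* (a :* y) := a :* (b :+ x :* y)) refl a b x (eval p x))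

  eval-* : ∀ p q x → eval (p *ᵖ q) x ≈ eval p x * eval q x
  eval-* []      q x = sym (zeroˡ _)
  eval-* (a ∷ p) q x = begin
    eval (map (a *_) q +ᵖ (0# ∷ (p *ᵖ q))) x
      ≈⟨ eval-+ (map (a *_) q) _ x ⟩
    eval (map (a *_) q) x + eval (0# ∷ (p *ᵖ q)) x
      ≈⟨ +-cong (eval-map-* a q x) (trans (eval-0∷ (p *ᵖ q) x) (*-congˡ (eval-* p q x))) ⟩
    a * eval q x + x * (eval p x * eval q x)
      ≈⟨ solve 4 (λ a x y z → a :* z :+ x :* (y :* z) := (a :+ x :* y) :* z)
           refl a x (eval p x) (eval q x) ⟩
    (a + x * eval p x) * eval q x   ∎

  eval-∷ʳ : ∀ p a x → eval (p ∷ʳ a) x ≈ eval p x + a * x ^ length p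
  eval-∷ʳ []      a x = solve 2 (λ a x → a :+ x :* con (0 , 0) :=
                                   con (0 , 0) :+ a :* con (1 , 0)) refl a x
  eval-∷ʳ (b ∷ p) a x = trans (+-congˡ (*-congˡ (eval-∷ʳ p a x)))
    (solve 5 (λ a b x y z → b :+ x :* (y :+ a :* z) := b :+ x :* y :+ a :* (x :* z))
       refl a b x (eval p x) (x ^ length p))

  eval-derivative-∷ : ∀ a p x →
    eval (derivative (a ∷ p)) x ≈ eval p x + x * eval (derivative p) x
  eval-derivative-∷ a p x = trans (eval-+ p (0# ∷ derivative p) x) (+-congˡ (eval-0∷ (derivative p) x))

  eval-derivative-+ : ∀ p q x →
    eval (derivative (p +ᵖ q)) x ≈ eval (derivative p) x + eval (derivative q) x
  eval-derivative-+ []      q       x = sym (+-identityˡ _)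
  eval-derivative-+ (a ∷ p) []      x = sym (+-identityʳ _)
  eval-derivative-+ (a ∷ p) (b ∷ q) x = begin
    eval (derivative (a + b ∷ p +ᵖ q)) x
      ≈⟨ eval-derivative-∷ (a + b) (p +ᵖ q) x ⟩
    eval (p +ᵖ q) x + x * eval (derivative (p +ᵖ q)) x
      ≈⟨ +-cong (eval-+ p q x) (*-congˡ (eval-derivative-+ p q x)) ⟩
    eval p x + eval q x + x * (eval (derivative p) x + eval (derivative q) x)
      ≈⟨ solve 5 (λ x p q p′ q′ → p :+ q :+ x :* (p′ :+ q′) := p :+ x :* p′ :+ (q :+ x :* q′))
           refl x (eval p x) (eval q x) _ _ ⟩
    eval p x + x * eval (derivative p) x + (eval q x + x * eval (derivative q) x)
      ≈⟨ +-cong (eval-derivative-∷ a p x) (eval-derivative-∷ b q x) ⟨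
    eval (derivative (a ∷ p)) x + eval (derivative (b ∷ q)) x   ∎

  eval-derivative-map-* : ∀ a p x →
    eval (derivative (map (a *_) p)) x ≈ a * eval (derivative p) x
  eval-derivative-map-* a []      x = sym (zeroʳ a)
  eval-derivative-map-* a (b ∷ p) x = begin
    eval (derivative (a * b ∷ map (a *_) p)) x
      ≈⟨ eval-derivative-∷ (a * b) (map (a *_) p) x ⟩
    eval (map (a *_) p) x + x * eval (derivative (map (a *_) p)) x
      ≈⟨ +-cong (eval-map-* a p x) (*-congˡ (eval-derivative-map-* a p x)) ⟩
    a * eval p x + x * (a * eval (derivative p) x)
      ≈⟨ solve 4 (λ a x p p′ → a :* p :+ x :* (a :* p′) := a :* (p :+ x :* p′)) refl a x _ _ ⟩
    a * (eval p x + x * eval (derivative p) x)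
      ≈⟨ *-congˡ (eval-derivative-∷ b p x) ⟨
    a * eval (derivative (b ∷ p)) x   ∎

  -- The product rule at the level of values, which is the form in which it is applied at a root.
  eval-derivative-* : ∀ p q x → eval (derivative (p *ᵖ q)) x ≈
                      eval (derivative p) x * eval q x + eval p x * eval (derivative q) x
  eval-derivative-* []      q x = solve 2 (λ y z → con (0 , 0) :=
                                     con (0 , 0) :* y :+ con (0 , 0) :* z) refl _ _
  eval-derivative-* (a ∷ p) q x = begin
    eval (derivative (map (a *_) q +ᵖ (0# ∷ (p *ᵖ q)))) x
      ≈⟨ eval-derivative-+ (map (a *_) q) _ x ⟩
    eval (derivative (map (a *_) q)) x + eval (derivative (0# ∷ (p *ᵖ q))) x
      ≈⟨ +-cong (eval-derivative-map-* a q x) (trans (eval-derivative-∷ 0# (p *ᵖ q) x)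
           (+-cong (eval-* p q x) (*-congˡ (eval-derivative-* p q x)))) ⟩
    a * q′ + (eval p x * eval q x + x * (p′ * eval q x + eval p x * q′))
      ≈⟨ solve 6 (λ a x p q p′ q′ → a :* q′ :+ (p :* q :+ x :* (p′ :* q :+ p :* q′)) :=
           (p :+ x :* p′) :* q :+ (a :+ x :* p) :* q′) refl a x (eval p x) (eval q x) p′ q′ ⟩
    (eval p x + x * p′) * eval q x + (a + x * eval p x) * q′
      ≈⟨ +-congʳ (*-congʳ (eval-derivative-∷ a p x)) ⟨
    eval (derivative (a ∷ p)) x * eval q x + eval (a ∷ p) x * q′   ∎
    where
    p′ = eval (derivative p) x
    q′ = eval (derivative q) x

  module _ {k : Pred Carrier ℓ} where

    All-+ᵖ : (∀ {x y} → x ∈ k → y ∈ k → (x + y) ∈ k) →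
             ∀ {p q} → All k p → All k q → All k (p +ᵖ q)
    All-+ᵖ +c []         q∈         = q∈
    All-+ᵖ +c (a∈ ∷ p∈) []         = a∈ ∷ p∈
    All-+ᵖ +c (a∈ ∷ p∈) (b∈ ∷ q∈) = +c a∈ b∈ ∷ All-+ᵖ +c p∈ q∈

    All-map-* : (∀ {x y} → x ∈ k → y ∈ k → (x * y) ∈ k) →
                ∀ {a p} → a ∈ k → All k p → All k (map (a *_) p)
    All-map-* *c a∈ p∈ = Allₚ.map⁺ (All.map (*c a∈) p∈)

    All-*ᵖ : Subfields.IsSubfield R k → ∀ {p q} → All k p → All k q → All k (p *ᵖ q)
    All-*ᵖ kF []         q∈ = []
    All-*ᵖ kF (a∈ ∷ p∈) q∈ =
      All-+ᵖ +-closed (All-map-* *-closed a∈ q∈) (0∈ ∷ All-*ᵖ kF p∈ q∈)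
      where open Subfields.IsSubfield kF

    All-derivative : Subfields.IsSubfield R k → ∀ {p} → All k p → All k (derivative p)
    All-derivative kF []        = []
    All-derivative kF (a∈ ∷ p∈) = All-+ᵖ +-closed p∈ (0∈ ∷ All-derivative kF p∈)
      where open Subfields.IsSubfield kF

  -- The list of zeros ending in 1 is the monomial of degree `length p`, so the leading term is
  -- split off.
  coeff-∷ʳ : ∀ p a i → coeff (p ∷ʳ a) i ≈ coeff p i + a * coeff (replicate (length p) 0# ∷ʳ 1#) i
  coeff-∷ʳ []      a zero    = solve 1 (λ a → a := con (0 , 0) :+ a :* con (1 , 0)) refl a
  coeff-∷ʳ []      a (suc i) = solve 1 (λ a → con (0 , 0) := con (0 , 0) :+ a :* con (0 , 0)) refl a
  coeff-∷ʳ (b ∷ p) a zero    = solve 2 (λ a b → b := b :+ a :* con (0 , 0)) refl a b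
  coeff-∷ʳ (b ∷ p) a (suc i) = coeff-∷ʳ p a i

  length-+ᵖ : ∀ p q → length p ≡ length q → length (p +ᵖ q) ≡ length p
  length-+ᵖ []      q       e = ≡.sym e
  length-+ᵖ (a ∷ p) []      e = ≡.refl
  length-+ᵖ (a ∷ p) (b ∷ q) e = ≡.cong suc (length-+ᵖ p q (ℕₚ.suc-injective e))

  module _ {k : Pred Carrier ℓ} (kF : Subfields.IsSubfield R k) where
    open Subfields.IsSubfield kF

    -- The remainder is padded to exactly the length of `c`, which keeps the recursion uniform and
    -- later allows it to be compared with a minimal polynomial.
    divide : ∀ {c} → All k c → ∀ {f} → All k f →
             ∃[ u ] ∃[ r ] (All k u × All k r × length r ≡ length c ×
                            f ≋ u *ᵖ (c ∷ʳ 1#) +ᵖ r)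
    divide {c} c∈ [] =
      [] , replicate (length c) 0# , [] , Allₚ.replicate⁺ (length c) 0∈ ,
      length-replicate (length c) , λ i → sym (zeros (length c) i)
      where
      zeros : ∀ n i → coeff (replicate n 0#) i ≈ 0#
      zeros zero    i       = refl
      zeros (suc n) zero    = refl
      zeros (suc n) (suc i) = zeros n i
    divide {c} c∈ {a ∷ f} (a∈ ∷ f∈) with divide c∈ f∈
    -- Multiplying the division of `f` by X and adding a leaves the remainder `a ∷ r`, one entry too
    -- long. Its top coefficient `b` is removed by subtracting b times the monic divisor, so `b`
    -- becomes the constant term of the new quotient.
    ... | u , r , u∈ , r∈ , len , e with a ∷ r in ar≡ | initLast (a ∷ r)
    ...   | .(s ∷ʳ b) | s ∷ʳ′ b =
      b ∷ u , s +ᵖ map (- b *_) c , b∈ ∷ u∈ ,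
      All-+ᵖ +-closed s∈ (All-map-* *-closed (-‿closed b∈) c∈) ,
      ≡.trans (length-+ᵖ s _ (≡.trans s≡c (≡.sym (length-map _ c)))) s≡c ,
      λ i → begin
        coeff (a ∷ f) i
          ≈⟨ expand i ⟩
        coeff (0# ∷ v) i + coeff (a ∷ r) i
          ≡⟨ ≡.cong (λ r → coeff (0# ∷ v) i + coeff r i) ar≡ ⟩
        coeff (0# ∷ v) i + coeff (s ∷ʳ b) i
          ≈⟨ +-congˡ (coeff-∷ʳ s b i) ⟩
        coeff (0# ∷ v) i + (coeff s i + b * coeff (replicate (length s) 0# ∷ʳ 1#) i)
          ≡⟨ ≡.cong (λ n → coeff (0# ∷ v) i + (coeff s i + b * coeff (replicate n 0# ∷ʳ 1#) i)) s≡c ⟩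
        coeff (0# ∷ v) i + (coeff s i + b * δ i)
          ≈⟨ solve 5 (λ v s b δ c → v :+ (s :+ b :* δ) :=
               b :* (c :+ con (1 , 0) :* δ) :+ v :+ (s :+ (:- b) :* c))
               refl (coeff (0# ∷ v) i) (coeff s i) b (δ i) (coeff c i) ⟩
        b * (coeff c i + 1# * δ i) + coeff (0# ∷ v) i + (coeff s i + - b * coeff c i)
          ≈⟨ +-cong (+-congʳ (*-congˡ (coeff-∷ʳ c 1# i))) (+-congˡ (coeff-map-* (- b) c i)) ⟨
        b * coeff (c ∷ʳ 1#) i + coeff (0# ∷ v) i + (coeff s i + coeff (map (- b *_) c) i)
          ≈⟨ +-cong (trans (coeff-+ (map (b *_) (c ∷ʳ 1#)) _ i) (+-congʳ (coeff-map-* b (c ∷ʳ 1#) i)))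
               (coeff-+ s _ i) ⟨
        coeff ((b ∷ u) *ᵖ (c ∷ʳ 1#)) i + coeff (s +ᵖ map (- b *_) c) i
          ≈⟨ coeff-+ ((b ∷ u) *ᵖ (c ∷ʳ 1#)) _ i ⟨
        coeff ((b ∷ u) *ᵖ (c ∷ʳ 1#) +ᵖ (s +ᵖ map (- b *_) c)) i   ∎
      where
      v = u *ᵖ (c ∷ʳ 1#)
      δ = coeff (replicate (length c) 0# ∷ʳ 1#)
      sb∈ : All k (s ∷ʳ b)
      sb∈ = ≡.subst (All k) ar≡ (a∈ ∷ r∈)
      s∈ = proj₁ (Allₚ.∷ʳ⁻ sb∈)
      b∈ = proj₂ (Allₚ.∷ʳ⁻ sb∈)
      s≡c : length s ≡ length c
      s≡c = ℕₚ.suc-injective (≡.trans (≡.sym (length-∷ʳ b s))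
              (≡.trans (≡.cong length (≡.sym ar≡)) (≡.cong suc len)))
      expand : ∀ i → coeff (a ∷ f) i ≈ coeff (0# ∷ v) i + coeff (a ∷ r) i
      expand zero    = sym (+-identityˡ a)
      expand (suc i) = trans (e i) (coeff-+ v r i)

-- Algebraic elements, minimal polynomials and finite extensions

module Extensions {ℓ : Level} (em : ExcludedMiddle ℓ) (Ω : Field ℓ) where
  open Field Ω renaming (inverse to field-inverse)
  open IntegerRingSolver commutativeRing
  open Subfields commutativeRing
  open Polynomials commutativeRing
  open PolynomialProperties commutativeRing public
  open LinearAlgebra em Ω public
  open import Algebra.Properties.Semiring.Exp semiring using (_^_; ^-homo-*) public
  open import Relation.Binary.Reasoning.Setoid setoid

  -- In decreasing order, so that pows x n is a suffix of pows x (1 + n).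

  pows : Carrier → ℕ → List Carrier
  pows x zero    = []
  pows x (suc n) = x ^ n ∷ pows x n

  length-pows : ∀ x n → length (pows x n) ≡ n
  length-pows x zero    = ≡.refl
  length-pows x (suc n) = ≡.cong suc (length-pows x n)

  module _ {A : Pred Carrier ℓ} (AA : IsAdditive A) where
    open IsAdditive AA

    span-pows-≤ : ∀ x {y m n} → m ℕ.≤ n → y ∈ Span A (pows x m) → y ∈ Span A (pows x n)
    span-pows-≤ x {y} {m} m≤n y∈ with ℕₚ.m≤n⇒∃[o]m+o≡n m≤n
    ... | o , ≡.refl = ≡.subst (λ n → y ∈ Span A (pows x n)) (ℕₚ.+-comm o m) (go o)
      where
      go : ∀ o → y ∈ Span A (pows x (o ℕ.+ m))
      go zero    = y∈
      go (suc o) = spanMod-skip Zero-additive AA (pows x (o ℕ.+ m)) (go o)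

    span-pows-const : ∀ x {a} n → a ∈ A → a ∈ Span A (pows x (suc n))
    span-pows-const x {a} n a∈ = span-pows-≤ x (s≤s z≤n)
      (step a a∈ 0# (base refl) (solve 1 (λ a → a := a :* con (1 , 0) :+ con (0 , 0)) refl a))

    span-pows-shift : ∀ x {y} n → y ∈ Span A (pows x n) → (x * y) ∈ Span A (pows x (suc n))
    span-pows-shift x {y} zero (base y≈0) =
      step 0# 0∈ 0# (base refl) (trans (*-congˡ y≈0)
        (solve 1 (λ x → x :* con (0 , 0) := con (0 , 0) :* con (1 , 0) :+ con (0 , 0)) refl x))
    span-pows-shift x {y} (suc n) (step c c∈ z z∈ e) =
      step c c∈ (x * z) (span-pows-shift x n z∈) (trans (*-congˡ e)
        (solve 4 (λ c x p z → x :* (c :* p :+ z) := c :* (x :* p) :+ x :* z) refl c x (x ^ n) z))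

    span-pows-shifts : ∀ x {y} i n → y ∈ Span A (pows x n) → (x ^ i * y) ∈ Span A (pows x (i ℕ.+ n))
    span-pows-shifts x {y} zero    n y∈ =
      spanMod-respects (IsAdditive.respects Zero-additive) (pows x n) (sym (*-identityˡ y)) y∈
    span-pows-shifts x {y} (suc i) n y∈ =
      spanMod-respects (IsAdditive.respects Zero-additive) (pows x (suc i ℕ.+ n))
        (sym (*-assoc x (x ^ i) y)) (span-pows-shift x (i ℕ.+ n) (span-pows-shifts x i n y∈))

  span-pows→eval : ∀ {A} x {y} n → y ∈ Span A (pows x n) →
                   ∃[ p ] (All A p × length p ≡ n × y ≈ eval p x)
  span-pows→eval x zero (base y≈0) = [] , [] , ≡.refl , y≈0
  span-pows→eval x {y} (suc n) (step c c∈ z z∈ e) with span-pows→eval x n z∈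
  ... | p , p∈ , ≡.refl , e′ = p ∷ʳ c , Allₚ.∷ʳ⁺ p∈ c∈ , length-∷ʳ c p , (begin
    y                          ≈⟨ e ⟩
    c * x ^ length p + z       ≈⟨ +-congˡ e′ ⟩
    c * x ^ length p + eval p x  ≈⟨ +-comm _ _ ⟩
    eval p x + c * x ^ length p  ≈⟨ eval-∷ʳ p c x ⟨
    eval (p ∷ʳ c) x            ∎)

  All-≈0⇒≋[] : ∀ {p} → All (_≈ 0#) p → p ≋ []
  All-≈0⇒≋[] []          i       = refl
  All-≈0⇒≋[] (a≈0 ∷ p≈0) zero    = a≈0
  All-≈0⇒≋[] (a≈0 ∷ p≈0) (suc i) = All-≈0⇒≋[] p≈0 i

  ¬NonZero⇒All-≈0 : ∀ p → ¬ NonZero p → All (_≈ 0#) p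
  ¬NonZero⇒All-≈0 p ¬nz = All.map (decidable-stable em) (Allₚ.¬Any⇒All¬ p ¬nz)

  isSubfield-≐ : ∀ {K L} → K ≐ L → IsSubfield K → IsSubfield L
  isSubfield-≐ (K⊆L , L⊆K) KF = record
    { respects = λ x≈y x∈ → K⊆L (respects x≈y (L⊆K x∈))
    ; 0∈       = K⊆L 0∈
    ; 1∈       = K⊆L 1∈
    ; 1≉0      = 1≉0
    ; +-closed = λ x∈ y∈ → K⊆L (+-closed (L⊆K x∈) (L⊆K y∈))
    ; -‿closed = λ x∈ → K⊆L (-‿closed (L⊆K x∈))
    ; *-closed = λ x∈ y∈ → K⊆L (*-closed (L⊆K x∈) (L⊆K y∈))
    ; inverse  = λ x∈ x≉0 → let y , y∈ , e = inverse (L⊆K x∈) x≉0 in y , K⊆L y∈ , e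
    }
    where open IsSubfield KF hiding (1≉0)

  -- An extension of finite degree, not a field with finitely many elements. The degree is the
  -- length of `basis`.
  record FiniteField (k K : Pred Carrier ℓ) : Set ℓ where
    field
      subfield    : IsSubfield K
      base⊆       : k ⊆ K
      basis       : List Carrier
      basis∈      : All K basis
      independent : Independent Zero k basis
      spans       : K ⊆ Span k basis

  module Base {k : Pred Carrier ℓ} (kF : IsSubfield k) where
    open Over kF

    evalSpan : ∀ {p x n} → All k p → length p ℕ.≤ n → eval p x ∈ Span k (pows x n)
    evalSpan {x = x} {n} [] _ = spanMod-base Zero-additive additive (pows x n) refl
    evalSpan {x = x} {suc n} (a∈ ∷ p∈) (s≤s p≤n) =
      span-+ (pows x (suc n))
        (span-pows-const additive x n a∈) (span-pows-shift additive x n (evalSpan p∈ p≤n))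

    eval-∈ : ∀ {p x} → All k p → x ∈ k → eval p x ∈ k
    eval-∈ []        x∈ = 0∈
    eval-∈ (a∈ ∷ p∈) x∈ = +-closed a∈ (*-closed x∈ (eval-∈ p∈ x∈))

    independent⇒All-≈0 : ∀ x n p → Independent Zero k (pows x n) → length p ≡ n →
                         Annihilates k p x → All (_≈ 0#) p
    independent⇒All-≈0 x zero    []       i       len ann = []
    -- `pows` begins with the highest power, which belongs to the last coefficient; hence `p` is
    -- taken apart from the right.
    independent⇒All-≈0 x (suc n) p i len (p∈ , e) with initLast p
    ... | q ∷ʳ′ a = conclude em
      where
      q≡n : length q ≡ n
      q≡n = ℕₚ.suc-injective (≡.trans (≡.sym (length-∷ʳ a q)) len)
      q∈ = proj₁ (Allₚ.∷ʳ⁻ p∈)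
      a∈ = proj₂ (Allₚ.∷ʳ⁻ p∈)
      e′ : eval q x + a * x ^ n ≈ 0#
      e′ = trans (sym (≡.subst (λ n → eval (q ∷ʳ a) x ≈ eval q x + a * x ^ n) q≡n
                        (eval-∷ʳ q a x))) e
      conclude : Dec (a ≈ 0#) → All (_≈ 0#) (q ∷ʳ a)
      conclude (yes a≈0) = Allₚ.∷ʳ⁺ (independent⇒All-≈0 x n q (proj₂ i) q≡n
        (q∈ , (begin
          eval q x               ≈⟨ +-identityʳ _ ⟨
          eval q x + 0#          ≈⟨ +-congˡ (trans (*-congʳ a≈0) (zeroˡ _)) ⟨
          eval q x + a * x ^ n   ≈⟨ e′ ⟩
          0#                     ∎))) a≈0
      conclude (no  a≉0) = ⊥-elim (proj₁ i
        (unscale (span-additive (pows x n)) (span-scale-k (pows x n)) a∈ a≉0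
          (subtract (span-additive (pows x n)) (span-scale-k (pows x n))
            (span-respects (pows x n) (sym (trans (+-comm _ _) e′))
              (span-0 (pows x n)))
            (evalSpan q∈ (ℕₚ.≤-reflexive q≡n)))))

    relation : ∀ {x} n → x ^ n ∈ Span k (pows x n) →
               ∃[ c ] (length c ≡ n × Annihilates k (c ∷ʳ 1#) x)
    relation {x} n xⁿ∈ with span-pows→eval x n (span-neg (pows x n) xⁿ∈)
    ... | c , c∈ , ≡.refl , e = c , ≡.refl , Allₚ.∷ʳ⁺ c∈ 1∈ , (begin
      eval (c ∷ʳ 1#) x               ≈⟨ eval-∷ʳ c 1# x ⟩
      eval c x + 1# * x ^ length c   ≈⟨ +-congʳ e ⟨
      - x ^ length c + 1# * x ^ length c
        ≈⟨ solve 1 (λ y → :- y :+ con (1 , 0) :* y := con (0 , 0)) refl (x ^ length c) ⟩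
      0#                             ∎)

    nonZero-∷ʳ1 : ∀ c → NonZero (c ∷ʳ 1#)
    nonZero-∷ʳ1 c = Anyₚ.++⁺ʳ c (here 1≉0)

    -- Descending from n, the search stops where the powers below m are independent but the m-th is
    -- not new. This m is the degree of x.
    dependent⇒relation : ∀ {x} n → ¬ Independent Zero k (pows x n) →
      ∃[ m ] (m ℕ.< n × Independent Zero k (pows x m) × x ^ m ∈ Span k (pows x m))
    dependent⇒relation zero    ¬i = ⊥-elim (¬i tt)
    dependent⇒relation {x} (suc n) ¬i with em {P = Independent Zero k (pows x n)}
    ... | yes i = n , ℕₚ.≤-refl , i , decidable-stable em (λ ∉ → ¬i (∉ , i))
    ... | no ¬j = let m , m<n , i , e = dependent⇒relation n ¬j in m , ℕₚ.m≤n⇒m≤1+n m<n , i , e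

    dependent⇒algebraic : ∀ {x} n → ¬ Independent Zero k (pows x n) → x ∈ AlgebraicOver k
    dependent⇒algebraic n ¬i with dependent⇒relation n ¬i
    ... | m , _ , _ , xᵐ∈ with relation m xᵐ∈
    ...   | c , _ , ann = c ∷ʳ 1# , nonZero-∷ʳ1 c , ann

    degree : ∀ {x} → x ∈ AlgebraicOver k →
             ∃[ d ] (Independent Zero k (pows x d) × x ^ d ∈ Span k (pows x d))
    degree {x} (p , nz , ann) with dependent⇒relation (length p)
      (λ i → Allₚ.Any¬⇒¬All nz (independent⇒All-≈0 _ (length p) p i ≡.refl ann))
    ... | d , _ , i , xᵈ∈ = d , i , xᵈ∈

    independent-pows-≤ : ∀ {x m n} → m ℕ.≤ n → Independent Zero k (pows x n) →
                         Independent Zero k (pows x m)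
    independent-pows-≤ {x} {m} m≤n i with ℕₚ.m≤n⇒∃[o]m+o≡n m≤n
    ... | o , ≡.refl = go o (≡.subst (λ n → Independent Zero k (pows x n)) (ℕₚ.+-comm m o) i)
      where
      go : ∀ o → Independent Zero k (pows x (o ℕ.+ m)) → Independent Zero k (pows x m)
      go zero    i       = i
      go (suc o) (_ , i) = go o i

    isMinimalPolynomial : ∀ {x} c → Independent Zero k (pows x (length c)) →
                          Annihilates k (c ∷ʳ 1#) x → IsMinimalPolynomial k x (c ∷ʳ 1#)
    isMinimalPolynomial {x} c i ann = ann , c , ≡.refl , λ q annq q≤c nz →
      Allₚ.Any¬⇒¬All nz (independent⇒All-≈0 x (length q) q (independent-pows-≤ q≤c i) ≡.refl annq)

    minimalPolynomial : ∀ {x} → x ∈ AlgebraicOver k →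
      ∃[ c ] (Independent Zero k (pows x (length c)) × Annihilates k (c ∷ʳ 1#) x)
    minimalPolynomial x∈ with degree x∈
    ... | d , i , xᵈ∈ with relation d xᵈ∈
    ...   | c , ≡.refl , ann = c , i , ann

    -- The remainder kills x too and has smaller degree than the minimal polynomial, so it vanishes.
    minimalPolynomial-divides : ∀ {x c f} → Independent Zero k (pows x (length c)) → Annihilates k (c ∷ʳ 1#) x →
              Annihilates k f x → ∃[ u ] (All k u × f ≋ u *ᵖ (c ∷ʳ 1#))
    minimalPolynomial-divides {x} {c} {f} i (c1∈ , c1≈0) (f∈ , f≈0)
      with divide kF (proj₁ (Allₚ.∷ʳ⁻ c1∈)) f∈
    ... | u , r , u∈ , r∈ , len , e = u , u∈ , λ j →
      trans (e j) (trans (coeff-+ (u *ᵖ (c ∷ʳ 1#)) r j)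
        (trans (+-congˡ (All-≈0⇒≋[] r≈0 j)) (+-identityʳ _)))
      where
      r≈0 : All (_≈ 0#) r
      r≈0 = independent⇒All-≈0 x (length c) r i len (r∈ , (begin
        eval r x                                      ≈⟨ +-identityˡ _ ⟨
        0# + eval r x                                 ≈⟨ +-congʳ (zeroʳ _) ⟨
        eval u x * 0# + eval r x                      ≈⟨ +-congʳ (*-congˡ c1≈0) ⟨
        eval u x * eval (c ∷ʳ 1#) x + eval r x        ≈⟨ +-congʳ (eval-* u (c ∷ʳ 1#) x) ⟨
        eval (u *ᵖ (c ∷ʳ 1#)) x + eval r x            ≈⟨ eval-+ (u *ᵖ (c ∷ʳ 1#)) r x ⟨
        eval (u *ᵖ (c ∷ʳ 1#) +ᵖ r) x                  ≈⟨ eval-cong f (u *ᵖ (c ∷ʳ 1#) +ᵖ r) e x ⟨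
        eval f x                                      ≈⟨ f≈0 ⟩
        0#                                            ∎))

    -- If p(y) = 0 then the lowest nonzero coefficient of p is divisible by y in k[y].

    inverse-polynomial : ∀ {y} p → NonZero p → Annihilates k p y → y ≉ 0# →
                         ∃[ g ] (All k g × y * eval g y ≈ 1#)
    inverse-polynomial {y} (a ∷ p) nz (a∈ ∷ p∈ , e) y≉0 with em {P = a ≈ 0#}
    ... | yes a≈0 = inverse-polynomial p (tail nz)
            (p∈ , *-integral (trans (sym (+-identityˡ _)) (trans (+-congʳ (sym a≈0)) e)) y≉0) y≉0
      where
      tail : NonZero (a ∷ p) → NonZero p
      tail (here a≉0) = ⊥-elim (a≉0 a≈0)
      tail (there nz) = nz
    ... | no  a≉0 with inverse a∈ a≉0
    ...   | b , b∈ , ab≈1 = map (- b *_) p , All-map-* {k} *-closed (-‿closed b∈) p∈ , (begin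
      y * eval (map (- b *_) p) y   ≈⟨ *-congˡ (eval-map-* (- b) p y) ⟩
      y * (- b * eval p y)
        ≈⟨ solve 4 (λ a b y z → y :* (:- b :* z) := a :* b :- b :* (a :+ y :* z))
             refl a b y (eval p y) ⟩
      a * b - b * (a + y * eval p y)  ≈⟨ +-cong ab≈1 (-‿cong (trans (*-congˡ e) (zeroʳ b))) ⟩
      1# - 0#                       ≈⟨ solve 0 (con (1 , 0) :- con (0 , 0) := con (1 , 0)) refl ⟩
      1#                            ∎)

    All-pows : ∀ {V : Pred Carrier ℓ} → (∀ {x y} → x ∈ V → y ∈ V → (x * y) ∈ V) → 1# ∈ V →
               ∀ {x} → x ∈ V → ∀ n → All V (pows x n)
    All-pows {V} *c 1∈V {x} x∈ n = go n
      where
      pow : ∀ n → x ^ n ∈ V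
      pow zero    = 1∈V
      pow (suc n) = *c x∈ (pow n)
      go : ∀ n → All V (pows x n)
      go zero    = []
      go (suc n) = pow n ∷ go n

    module FiniteAlgebra (gs : List Carrier)
      (1∈gs  : 1# ∈ Span k gs)
      (*-gs : ∀ {x y} → x ∈ Span k gs → y ∈ Span k gs → (x * y) ∈ Span k gs) where

      finite⇒algebraic : Span k gs ⊆ AlgebraicOver k
      finite⇒algebraic {x} x∈ = dependent⇒algebraic (suc (length gs)) λ i →
        ℕₚ.<-irrefl ≡.refl (≡.subst (ℕ._≤ length gs) (length-pows x (suc (length gs)))
          (steinitz gs (pows x (suc (length gs))) i
            (All-pows *-gs 1∈gs x∈ (suc (length gs)))))

      finite-eval : ∀ {p x} → All k p → x ∈ Span k gs → eval p x ∈ Span k gs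
      finite-eval []        x∈ = spanMod-base Zero-additive additive gs refl
      finite-eval {a ∷ p} (a∈ ∷ p∈) x∈ = span-+ gs
        (span-respects gs (*-identityʳ a) (span-scale-k gs a∈ 1∈gs))
        (*-gs x∈ (finite-eval p∈ x∈))

      -- Counting powers makes every element of the finite-dimensional algebra algebraic, and the
      -- inverse of a nonzero algebraic element is a polynomial in it, hence stays in the algebra.
      finite-subfield : IsSubfield (Span k gs)
      finite-subfield = record
        { respects = span-respects gs
        ; 0∈       = span-0 gs
        ; 1∈       = 1∈gs
        ; 1≉0      = 1≉0
        ; +-closed = span-+ gs
        ; -‿closed = span-neg gs
        ; *-closed = *-gs
        ; inverse  = λ x∈ x≉0 →
            let p , nz , ann = finite⇒algebraic x∈
                g , g∈ , e   = inverse-polynomial p nz ann x≉0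
            in _ , finite-eval g∈ x∈ , e
        }

      finite-base⊆ : k ⊆ Span k gs
      finite-base⊆ {a} a∈ = span-respects gs (*-identityʳ a)
                              (span-scale-k gs a∈ 1∈gs)

    module _ {x d} (xᵈ∈ : x ^ d ∈ Span k (pows x d)) where

      pows-eval : ∀ {p y} → All k p → y ∈ Span k (pows x d) → (eval p x * y) ∈ Span k (pows x d)
      pows-eval {y = y} [] y∈ = span-respects (pows x d) (sym (zeroˡ y))
                                  (span-0 (pows x d))
      pows-eval {a ∷ p} {y} (a∈ ∷ p∈) y∈ =
        span-respects (pows x d)
          (solve 4 (λ a x p y → a :* y :+ x :* (p :* y) := (a :+ x :* p) :* y) refl a x (eval p x) y)
          (span-+ (pows x d) (span-scale-k (pows x d) a∈ y∈)
            (span-⊆ (pows x d) (xᵈ∈ ∷ span-members (pows x d))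
              (span-pows-shift additive x d (pows-eval p∈ y∈))))

      pows-* : ∀ {y z} → y ∈ Span k (pows x d) → z ∈ Span k (pows x d) →
               (y * z) ∈ Span k (pows x d)
      pows-* y∈ z∈ with span-pows→eval x d y∈
      ... | p , p∈ , _ , e = span-respects (pows x d)
              (*-congʳ (sym e)) (pows-eval p∈ z∈)

    pows-1∈ : ∀ {x} d → x ^ d ∈ Span k (pows x d) → 1# ∈ Span k (pows x d)
    -- For d = 0 the hypothesis itself concerns the zeroth power, which is 1.
    pows-1∈ zero    1∈ = 1∈
    pows-1∈ {x} (suc d) _   = span-pows-const additive x d 1∈

    pows-x∈ : ∀ {x} d → x ^ d ∈ Span k (pows x d) → x ∈ Span k (pows x d)
    pows-x∈ {x} d xᵈ∈ = span-respects (pows x d) (*-identityʳ x)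
      (span-⊆ (pows x d) (xᵈ∈ ∷ span-members (pows x d))
        (span-pows-shift additive x d (pows-1∈ d xᵈ∈)))

    simple-subfield : ∀ {x} d → x ^ d ∈ Span k (pows x d) → IsSubfield (Span k (pows x d))
    simple-subfield {x} d xᵈ∈ = FiniteAlgebra.finite-subfield (pows x d)
      (pows-1∈ d xᵈ∈) (pows-* {x} {d} xᵈ∈)

    finiteField : ∀ {K} gs → IsSubfield K → k ⊆ K → All K gs → K ⊆ Span k gs → FiniteField k K
    finiteField {K} gs KF k⊆K gs∈ K⊆ = record
      { subfield    = KF
      ; base⊆       = k⊆K
      ; basis       = extract Zero gs
      ; basis∈      = extract-All gs∈
      ; independent = extract-independent Zero gs
      ; spans       = λ x∈ → span-⊆ (extract Zero gs) (extract-spans Zero-additive gs) (K⊆ x∈)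
      }

    finiteField-base : FiniteField k k
    finiteField-base = finiteField (1# ∷ []) kF (λ x∈ → x∈) (1∈ ∷ []) λ {x} x∈ →
      step x x∈ 0# (base refl) (solve 1 (λ x → x := x :* con (1 , 0) :+ con (0 , 0)) refl x)

    finiteField⇒algebraic : ∀ {K} → FiniteField k K → K ⊆ AlgebraicOver k
    finiteField⇒algebraic {K} KF x∈ = FiniteAlgebra.finite⇒algebraic basis
      (spans (IsSubfield.1∈ subfield))
      (λ y∈ z∈ → spans (IsSubfield.*-closed subfield (span∈ y∈) (span∈ z∈)))
      (spans x∈)
      where
      open FiniteField KF
      span∈ : Span k basis ⊆ K
      span∈ = span-elim (Over.additive subfield)
        (All.map (λ v∈ c c∈ → IsSubfield.*-closed subfield (base⊆ c∈) v∈) basis∈)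

    algebraic-mono : ∀ {K} → k ⊆ K → AlgebraicOver k ⊆ AlgebraicOver K
    algebraic-mono k⊆K (p , nz , p∈ , e) = p , nz , All.map k⊆K p∈ , e

  module _ {k : Pred Carrier ℓ} (kF : IsSubfield k) where
    private
      module k = Base kF
      module kO = Over kF

    -- `least` later locates the generated field inside a given one, such as 𝔏alg or k Kᵖ. It
    -- quantifies over predicates, which raises the universe level.
    record Adjunction (K : Pred Carrier ℓ) (x : Carrier) : Set (Level.suc ℓ) where
      field
        field′      : Pred Carrier ℓ
        finiteField : FiniteField k field′
        extends     : K ⊆ field′
        member      : x ∈ field′
        least       : ∀ {L} → IsSubfield L → K ⊆ L → x ∈ L → field′ ⊆ L

    adjoin : ∀ {K x} → FiniteField k K → x ∈ AlgebraicOver k → Adjunction K x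
    -- Here `d` is the degree of x over K, not over k. The powers below d span K[x] over K, and
    -- their products with the basis of K span it over k.
    adjoin {K} {x} KF x∈ with Base.degree (FiniteField.subfield KF)
                                (k.algebraic-mono (FiniteField.base⊆ KF) x∈)
    ... | d , _ , xᵈ∈ = record
      { field′      = Span K (pows x d)
      ; finiteField = k.finiteField (tensor basis (pows x d)) K[x]F
          (λ a∈ → K⊆K[x] (base⊆ a∈))
          (All-tensor (All.map (λ p∈ → All.map (λ e∈ → KO.span-scale-k (pows x d) e∈ p∈) basis∈)
            (KO.span-members (pows x d))))
          (span-tensor spans (pows x d))
      ; extends     = K⊆K[x]
      ; member      = Base.pows-x∈ subfield d xᵈ∈
      ; least       = λ LF K⊆L x∈L → span-elim (Over.additive LF)
          (All.map (λ v∈ c c∈ → IsSubfield.*-closed LF (K⊆L c∈) v∈)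
            (Base.All-pows LF (IsSubfield.*-closed LF) (IsSubfield.1∈ LF) x∈L d))
      }
      where
      open FiniteField KF
      module KO = Over subfield
      K[x]F : IsSubfield (Span K (pows x d))
      K[x]F = Base.simple-subfield subfield d xᵈ∈
      K⊆K[x] : K ⊆ Span K (pows x d)
      K⊆K[x] {a} a∈ = KO.span-respects (pows x d) (*-identityʳ a)
        (KO.span-scale-k (pows x d) a∈ (IsSubfield.1∈ K[x]F))

    adjoin₂ : ∀ {x y} → x ∈ AlgebraicOver k → y ∈ AlgebraicOver k →
              Σ[ K ∈ Pred Carrier ℓ ] (FiniteField k K × x ∈ K × y ∈ K ×
                (∀ {L} → IsSubfield L → k ⊆ L → x ∈ L → y ∈ L → K ⊆ L))
    adjoin₂ x∈ y∈ = k[x,y].field′ , k[x,y].finiteField , k[x,y].extends k[x].member ,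
      k[x,y].member , λ LF k⊆L x∈L y∈L → k[x,y].least LF (k[x].least LF k⊆L x∈L) y∈L
      where
      module k[x] = Adjunction (adjoin k.finiteField-base x∈)
      module k[x,y] = Adjunction (adjoin k[x].finiteField y∈)

    -- The field operations on x and y take place inside the finite extension K = k(x, y), so it
    -- suffices that K ⊆ V. Leastness of K is handed on because the separable case needs it to
    -- compare K with k Kᵖ.
    generated-subfield : ∀ {V} → V Respects _≈_ → k ⊆ V → V ⊆ AlgebraicOver k →
      (∀ {K x y} → FiniteField k K → x ∈ K → y ∈ K →
        (∀ {L} → IsSubfield L → k ⊆ L → x ∈ L → y ∈ L → K ⊆ L) → x ∈ V → y ∈ V → K ⊆ V) →
      IsSubfield V
    generated-subfield {V} resp k⊆V V⊆ closed = record
      { respects = resp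
      ; 0∈       = k⊆V kO.0∈
      ; 1∈       = k⊆V kO.1∈
      ; 1≉0      = 1≉0
      ; +-closed = λ x∈ y∈ → let K , KF , x∈K , y∈K , K⊆V = within x∈ y∈ in
          K⊆V (IsSubfield.+-closed (FiniteField.subfield KF) x∈K y∈K)
      ; -‿closed = λ x∈ → let K , KF , x∈K , y∈K , K⊆V = within x∈ x∈ in
          K⊆V (IsSubfield.-‿closed (FiniteField.subfield KF) x∈K)
      ; *-closed = λ x∈ y∈ → let K , KF , x∈K , y∈K , K⊆V = within x∈ y∈ in
          K⊆V (IsSubfield.*-closed (FiniteField.subfield KF) x∈K y∈K)
      ; inverse  = λ x∈ x≉0 →
          let K , KF , x∈K , y∈K , K⊆V = within x∈ x∈
              y , y∈ , e = IsSubfield.inverse (FiniteField.subfield KF) x∈K x≉0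
          in y , K⊆V y∈ , e
      }
      where
      within : ∀ {x y} → x ∈ V → y ∈ V →
               Σ[ K ∈ Pred Carrier ℓ ] (FiniteField k K × x ∈ K × y ∈ K × K ⊆ V)
      within x∈ y∈ with adjoin₂ (V⊆ x∈) (V⊆ y∈)
      ... | K , KF , x∈K , y∈K , least = K , KF , x∈K , y∈K , closed KF x∈K y∈K least x∈ y∈

    base⊆algebraic : k ⊆ AlgebraicOver k
    base⊆algebraic = k.finiteField⇒algebraic k.finiteField-base

    algebraic-subfield : IsSubfield (AlgebraicOver k)
    algebraic-subfield = generated-subfield
      (λ x≈y (p , nz , p∈ , e) → p , nz , p∈ , trans (eval-congʳ p (sym x≈y)) e)
      base⊆algebraic (λ x∈ → x∈)
      (λ KF _ _ _ _ _ → k.finiteField⇒algebraic KF)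

-- Raising the slope from r to r + 1 gains N, whereas the shift by c costs at most M c. Hence N = M
-- c + 1 suffices, whatever r is.
threshold-large : ∀ M c {r} → r ℕ.< M → (suc (M ℕ.* c) ℕ.+ c) ℕ.* r ℕ.< M ℕ.* suc (M ℕ.* c)
threshold-large M c {r} r<M = begin-strict
  (N ℕ.+ c) ℕ.* r         ≡⟨ ℕₚ.*-distribʳ-+ r N c ⟩
  N ℕ.* r ℕ.+ c ℕ.* r     ≤⟨ ℕₚ.+-monoʳ-≤ (N ℕ.* r) (ℕₚ.*-monoʳ-≤ c (ℕₚ.<⇒≤ r<M)) ⟩
  N ℕ.* r ℕ.+ c ℕ.* M     ≡⟨ ≡.cong (N ℕ.* r ℕ.+_) (ℕₚ.*-comm c M) ⟩
  N ℕ.* r ℕ.+ M ℕ.* c     <⟨ ℕₚ.+-monoʳ-< (N ℕ.* r) ℕₚ.≤-refl ⟩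
  N ℕ.* r ℕ.+ N           ≡⟨ ℕₚ.+-comm (N ℕ.* r) N ⟩
  N ℕ.+ N ℕ.* r           ≡⟨ ℕₚ.*-suc N r ⟨
  N ℕ.* suc r             ≤⟨ ℕₚ.*-monoʳ-≤ N r<M ⟩
  N ℕ.* M                 ≡⟨ ℕₚ.*-comm N M ⟩
  M ℕ.* N                 ∎
  where
  open ℕₚ.≤-Reasoning
  N = suc (M ℕ.* c)

-- Rational function fields and polynomials of bounded degree

module RationalFunctionFields {ℓ : Level} (em : ExcludedMiddle ℓ) (Ω : Field ℓ) where
  open Field Ω renaming (inverse to field-inverse)
  open IntegerRingSolver commutativeRing
  open Subfields commutativeRing
  open Polynomials commutativeRing
  open Extensions em Ω
  open import Relation.Binary.Reasoning.Setoid setoid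

  Degree< : Pred Carrier ℓ → Carrier → ℕ → Pred Carrier ℓ
  Degree< k t n = Span k (pows t n)

  -- F = k(t) described inside an ambient field, so that it covers both 𝔉ₛ in its algebraic closure
  -- and 𝐅 in the ultraproduct. Transcendence of t is stated as independence of its powers.
  record IsRationalFunctionField (k : Pred Carrier ℓ) (t : Carrier) (F : Pred Carrier ℓ) : Set ℓ where
    field
      constants      : IsSubfield k
      functions      : IsSubfield F
      constants⊆     : k ⊆ F
      t∈             : t ∈ F
      transcendental : ∀ n → Independent Zero k (pows t n)
      fraction       : ∀ {x} → x ∈ F → ∃[ g ] ∃[ n ]
                       (g ≉ 0# × g ∈ Degree< k t n × (g * x) ∈ Degree< k t n)

  dot : List Carrier → List Carrier → Carrier
  dot []       vs       = 0#
  dot (c ∷ cs) []       = 0#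
  dot (c ∷ cs) (v ∷ vs) = c * v + dot cs vs

  dot-map-* : ∀ a cs vs → dot (map (a *_) cs) vs ≈ a * dot cs vs
  dot-map-* a []       vs       = sym (zeroʳ a)
  dot-map-* a (c ∷ cs) []       = sym (zeroʳ a)
  dot-map-* a (c ∷ cs) (v ∷ vs) = trans (+-congˡ (dot-map-* a cs vs))
    (solve 4 (λ a c v y → a :* c :* v :+ a :* y := a :* (c :* v :+ y)) refl a c v (dot cs vs))

  dot-∈ : ∀ {A P : Pred Carrier ℓ} → IsAdditive P → ∀ {cs vs} → All A cs →
          All (λ v → ∀ c → c ∈ A → (c * v) ∈ P) vs → dot cs vs ∈ P
  dot-∈ PA []         vs∈        = IsAdditive.0∈ PA
  dot-∈ PA (c∈ ∷ cs∈) []         = IsAdditive.0∈ PA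
  dot-∈ PA (c∈ ∷ cs∈) (v∈ ∷ vs∈) = IsAdditive.+-closed PA (v∈ _ c∈) (dot-∈ PA cs∈ vs∈)

  span→dot : ∀ {A} vs {x} → x ∈ Span A vs →
             ∃[ cs ] (All A cs × length cs ≡ length vs × x ≈ dot cs vs)
  span→dot []       (base x≈0) = [] , [] , ≡.refl , x≈0
  span→dot (v ∷ vs) (step c c∈ y y∈ e) with span→dot vs y∈
  ... | cs , cs∈ , len , e′ = c ∷ cs , c∈ ∷ cs∈ , ≡.cong suc len , trans e (+-congˡ e′)

  span-terms : ∀ {A} → IsAdditive A → ∀ vs → All (λ v → ∀ c → c ∈ A → (c * v) ∈ Span A vs) vs
  span-terms AA []       = []
  span-terms AA (v ∷ vs) =
    (λ c c∈ → step c c∈ 0# (spanMod-base Zero-additive AA vs refl) (sym (+-identityʳ _))) ∷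
    All.map (λ v∈ c c∈ → spanMod-skip Zero-additive AA vs (v∈ c c∈)) (span-terms AA vs)

  module _ {k : Pred Carrier ℓ} (kF : IsSubfield k) where
    open Over kF

    dependent⇒dot : ∀ vs → ¬ Independent Zero k vs →
      ∃[ cs ] (All k cs × length cs ≡ length vs × NonZero cs × dot cs vs ≈ 0#)
    dependent⇒dot []       ¬i = ⊥-elim (¬i tt)
    dependent⇒dot (v ∷ vs) ¬i with em {P = v ∈ Span k vs}
    ... | yes v∈ = let cs , cs∈ , len , e = span→dot vs (span-neg vs v∈) in
            1# ∷ cs , 1∈ ∷ cs∈ , ≡.cong suc len , here 1≉0 ,
            trans (+-congˡ (sym e)) (solve 1 (λ v → con (1 , 0) :* v :- v := con (0 , 0)) refl v)
    ... | no  v∉ = let cs , cs∈ , len , nz , e = dependent⇒dot vs (λ i → ¬i (v∉ , i)) in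
            0# ∷ cs , 0∈ ∷ cs∈ , ≡.cong suc len , there nz ,
            trans (+-cong (zeroˡ v) e) (+-identityˡ 0#)

    -- The first vector with a nonzero coefficient can be solved for in terms of the later ones,
    -- modulo W.
    dot⇒dependent : ∀ {W} → IsAdditive W → (∀ {a x} → a ∈ k → x ∈ W → (a * x) ∈ W) →
      ∀ {cs} vs → All k cs → length cs ≡ length vs → NonZero cs → dot cs vs ∈ W →
      ¬ Independent W k vs
    dot⇒dependent {W} WA scale {c ∷ cs} (v ∷ vs) (c∈ ∷ cs∈) len nz r∈ (v∉ , i) with em {P = c ≈ 0#}
    ... | yes c≈0 = dot⇒dependent WA scale vs cs∈ (ℕₚ.suc-injective len) (tail nz)
            (IsAdditive.respects WA (trans (+-congʳ (trans (*-congʳ c≈0) (zeroˡ v))) (+-identityˡ _)) r∈) i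
      where
      tail : NonZero (c ∷ cs) → NonZero cs
      tail (here c≉0) = ⊥-elim (c≉0 c≈0)
      tail (there nz) = nz
    ... | no  c≉0 = v∉ (unscale V V-scale c∈ c≉0 (subtract V V-scale (spanMod-base WA additive vs r∈)
            (dot-∈ V cs∈ (All.map (λ v∈ c c∈ → V-scale c∈ v∈) (spanMod-members WA vs)))))
      where
      V = spanMod-additive WA additive vs
      V-scale : ∀ {a x} → a ∈ k → x ∈ SpanMod W k vs → (a * x) ∈ SpanMod W k vs
      V-scale a∈ = spanMod-scale (scale a∈) (*-closed a∈) vs

    span-map-*⁻ : ∀ {A} a vs {x} → x ∈ Span A (map (a *_) vs) → ∃[ y ] (y ∈ Span A vs × x ≈ a * y)
    span-map-*⁻ a []       (base x≈0) = 0# , base refl , trans x≈0 (sym (zeroʳ a))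
    span-map-*⁻ a (v ∷ vs) (step c c∈ y y∈ e) with span-map-*⁻ a vs y∈
    ... | z , z∈ , e′ = c * v + z , step c c∈ z z∈ refl , trans e (trans (+-congˡ e′)
      (solve 4 (λ a c v z → c :* (a :* v) :+ a :* z := a :* (c :* v :+ z)) refl a c v z))

    independent-map-* : ∀ {a} → a ≉ 0# → ∀ vs → Independent Zero k vs →
                        Independent Zero k (map (a *_) vs)
    independent-map-* a≉0 []       _        = tt
    independent-map-* {a} a≉0 (v ∷ vs) (v∉ , i) =
      (λ av∈ → let z , z∈ , e = span-map-*⁻ a vs av∈ in
        v∉ (span-respects vs (sym (x-y≈0⇒x≈y (*-integral (begin
          a * (v - z)     ≈⟨ solve 3 (λ a v z → a :* (v :- z) := a :* v :- a :* z) refl a v z ⟩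
          a * v - a * z   ≈⟨ +-congʳ e ⟩
          a * z - a * z   ≈⟨ -‿inverseʳ _ ⟩
          0#              ∎) a≉0))) z∈)) ,
      independent-map-* a≉0 vs i

    independent-map-*⁻ : ∀ a vs → Independent Zero k (map (a *_) vs) → Independent Zero k vs
    independent-map-*⁻ a []       _         = tt
    independent-map-*⁻ a (v ∷ vs) (av∉ , i) =
      (λ v∈ → av∉ (span-map-* a vs v∈)) , independent-map-*⁻ a vs i

    -- Coordinates in an independent list are unique, so u times the coordinates of x must be the
    -- coordinates of u x found in B. Each coordinate of x thus satisfies both conditions at once.
    span-coordinates : ∀ {A B u} → A ⊆ k → B ⊆ k → B Respects _≈_ → u ∈ k →
      ∀ vs → Independent Zero k vs → ∀ {x} → x ∈ Span A vs → (u * x) ∈ Span B vs →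
      x ∈ Span (λ z → z ∈ A × (u * z) ∈ B) vs
    span-coordinates A⊆ B⊆ resp u∈ []       i        (base x≈0) _ = base x≈0
    span-coordinates {u = u} A⊆ B⊆ resp u∈ (v ∷ vs) (v∉ , i) {x} (step c c∈ y y∈ e) (step b b∈ z z∈ e′) =
      step c (c∈ , resp (sym uc≈b) b∈) y
        (span-coordinates A⊆ B⊆ resp u∈ vs i y∈
          (spanMod-respects (IsAdditive.respects Zero-additive) vs (sym uy≈z) z∈)) e
      where
      uc : k (u * c - b)
      uc = +-closed (*-closed u∈ (A⊆ c∈)) (-‿closed (B⊆ b∈))
      eq : (u * c - b) * v ≈ z - u * y
      eq = begin
        (u * c - b) * v
          ≈⟨ solve 5 (λ u c b v y → (u :* c :- b) :* v := u :* (c :* v :+ y) :- b :* v :- u :* y)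
               refl u c b v y ⟩
        u * (c * v + y) - b * v - u * y
          ≈⟨ +-congʳ (+-congʳ (trans (*-congˡ (sym e)) e′)) ⟩
        b * v + z - b * v - u * y
          ≈⟨ solve 4 (λ b v z w → b :* v :+ z :- b :* v :- w := z :- w) refl b v z (u * y) ⟩
        z - u * y   ∎
      eq∈ : (z - u * y) ∈ Span k vs
      eq∈ = span-+ vs (span-mono B⊆ vs z∈)
              (span-neg vs (span-scale-k vs u∈ (span-mono A⊆ vs y∈)))
      uc≈b : u * c ≈ b
      uc≈b with em {P = u * c - b ≈ 0#}
      ... | yes e = x-y≈0⇒x≈y e
      ... | no ≉0 = ⊥-elim (v∉ (unscale (span-additive vs) (span-scale-k vs) uc ≉0
                      (span-respects vs (sym eq) eq∈)))
      uy≈z : u * y ≈ z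
      uy≈z = sym (x-y≈0⇒x≈y (begin
        z - u * y         ≈⟨ eq ⟨
        (u * c - b) * v   ≈⟨ *-congʳ (trans (+-congʳ uc≈b) (-‿inverseʳ b)) ⟩
        0# * v            ≈⟨ zeroˡ v ⟩
        0#                ∎))

    split-base : ∀ {W} → IsAdditive W → ∀ vs {x} → x ∈ SpanMod W k vs →
                 ∃[ w ] ∃[ y ] (w ∈ W × y ∈ Span k vs × x ≈ w + y)
    split-base WA []       (base {x} x∈) = x , 0# , x∈ , base refl , sym (+-identityʳ x)
    split-base WA (v ∷ vs) (step c c∈ y y∈ e) with split-base WA vs y∈
    ... | w , z , w∈ , z∈ , e′ = w , c * v + z , w∈ , step c c∈ z z∈ refl ,
      trans e (trans (+-congˡ e′) (solve 3 (λ p w z → p :+ (w :+ z) := w :+ (p :+ z)) refl (c * v) w z))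

    span-++ʳ : ∀ us {vs} → Span k us ⊆ Span k (us ++ vs)
    span-++ʳ us {vs} {x} x∈ = span-respects (us ++ vs) (+-identityʳ x)
      (span-++ us x∈ (span-0 vs))

    -- Bounding the independent lists speaks of dimension without choosing a basis or knowing
    -- beforehand that V has a finite one.
    HasDimension≤ : Pred Carrier ℓ → ℕ → Set ℓ
    HasDimension≤ V n = ∀ xs → Independent Zero k xs → All V xs → length xs ℕ.≤ n

    -- A list `xs` involves only finitely many W-components. It lies in the span of these together
    -- with the part of `xs` that is independent modulo W, and the two parts are bounded separately.
    dimension-quotient : ∀ {V W m n} → IsAdditive W → HasDimension≤ W m →
      (∀ xs → Independent W k xs → All V xs → length xs ℕ.≤ n) → HasDimension≤ V (m ℕ.+ n)
    dimension-quotient {V} {W} {m} {n} WA dimW dimV/W xs i xs∈ =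
      ℕₚ.≤-trans (steinitz (ws′ ++ zs) xs i (All.map (span-⊆ (ws′ ++ zs) both) spanned))
        (≡.subst (ℕ._≤ m ℕ.+ n) (≡.sym (length-++ ws′))
          (ℕₚ.+-mono-≤
            (dimW ws′ (extract-independent Zero ws) (extract-All ws∈))
            (dimV/W zs (extract-independent W xs) (extract-All xs∈))))
      where
      zs = extract W xs
      collect : ∀ {xs} → All (SpanMod W k zs) xs →
                ∃[ ws ] (All W ws × All (Span k (ws ++ zs)) xs)
      collect []         = [] , [] , []
      collect (x∈ ∷ xs∈) with collect xs∈ | split-base WA zs x∈
      ... | ws , ws∈ , xs∈′ | w , y , w∈ , y∈ , e = w ∷ ws , w∈ ∷ ws∈ ,
        span-respects (w ∷ ws ++ zs) (sym e)
          (span-+ (w ∷ ws ++ zs)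
            (spanMod-head Zero-additive (ws ++ zs)) (span-++ˡ (w ∷ ws) y∈)) ∷
        All.map (spanMod-skip Zero-additive additive (ws ++ zs)) xs∈′
      ws = proj₁ (collect (extract-spans WA xs))
      ws∈ = proj₁ (proj₂ (collect (extract-spans WA xs)))
      spanned = proj₂ (proj₂ (collect (extract-spans WA xs)))
      ws′ = extract Zero ws
      both : All (Span k (ws′ ++ zs)) (ws ++ zs)
      both = Allₚ.++⁺ (All.map (span-++ʳ ws′) (extract-spans Zero-additive ws))
                      (All.map (span-++ˡ ws′) (span-members zs))

  module Degrees {k : Pred Carrier ℓ} (kF : IsSubfield k) (t : Carrier) where
    private module k = Over kF

    T : ℕ → Pred Carrier ℓ
    T = Degree< k t

    T-additive : ∀ n → IsAdditive (T n)
    T-additive n = k.span-additive (pows t n)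

    T-respects : ∀ n {x y} → x ≈ y → x ∈ T n → y ∈ T n
    T-respects n = IsAdditive.respects (T-additive n)

    T-≤ : ∀ {m n} → m ℕ.≤ n → T m ⊆ T n
    T-≤ m≤n x∈ = span-pows-≤ k.additive t m≤n x∈

    t^∈ : ∀ n → t ^ n ∈ T (suc n)
    t^∈ n = k.spanMod-head Zero-additive (pows t n)

    -- The sharp bound: a degree below m and a degree at most n add up to less than m + n. The
    -- leading-coefficient argument of `quotient-relation` depends on the one saved here.
    T-*-suc : ∀ m n {x y} → x ∈ T m → y ∈ T (suc n) → (x * y) ∈ T (m ℕ.+ n)
    T-*-suc zero    n {x} {y} (base x≈0) y∈ =
      T-respects n (sym (trans (*-congʳ x≈0) (zeroˡ y))) (IsAdditive.0∈ (T-additive n))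
    T-*-suc (suc m) n {x} {y} (step c c∈ x′ x′∈ e) y∈ =
      T-respects (suc m ℕ.+ n)
        (sym (trans (*-congʳ e) (solve 4 (λ c p x y → (c :* p :+ x) :* y := c :* (p :* y) :+ x :* y)
          refl c (t ^ m) x′ y)))
        (IsAdditive.+-closed (T-additive (suc m ℕ.+ n))
          (k.span-scale-k (pows t (suc m ℕ.+ n)) c∈
            (≡.subst (λ i → (t ^ m * y) ∈ T i) (ℕₚ.+-suc m n) (span-pows-shifts k.additive t m (suc n) y∈)))
          (T-≤ (ℕₚ.n≤1+n (m ℕ.+ n)) (T-*-suc m n x′∈ y∈)))

    T-* : ∀ m n {x y} → x ∈ T m → y ∈ T n → (x * y) ∈ T (m ℕ.+ n)
    T-* m n x∈ y∈ = T-*-suc m n x∈ (T-≤ (ℕₚ.n≤1+n n) y∈)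

    -- k(t) inside the ambient field. Inversion exchanges `g` and `g * x`, so it is convenient that
    -- both obey the same bound.
    Fractions : Pred Carrier ℓ
    Fractions x = ∃[ g ] ∃[ n ] (g ≉ 0# × g ∈ T n × (g * x) ∈ T n)

    fractions-subfield : IsSubfield Fractions
    fractions-subfield = record
      { respects = λ x≈y (g , n , g≉0 , g∈ , gx∈) → g , n , g≉0 , g∈ , T-respects n (*-congˡ x≈y) gx∈
      ; 0∈       = k⊆Fractions k.0∈
      ; 1∈       = k⊆Fractions k.1∈
      ; 1≉0      = 1≉0
      ; +-closed = λ { {x} {y} (g , m , g≉0 , g∈ , gx∈) (h , n , h≉0 , h∈ , hy∈) →
          g * h , m ℕ.+ n , *-≉0 g≉0 h≉0 , T-* m n g∈ h∈ ,
          T-respects (m ℕ.+ n)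
            (solve 4 (λ g h x y → g :* x :* h :+ g :* (h :* y) := g :* h :* (x :+ y)) refl g h x y)
            (IsAdditive.+-closed (T-additive (m ℕ.+ n)) (T-* m n gx∈ h∈) (T-* m n g∈ hy∈)) }
      ; -‿closed = λ { {x} (g , n , g≉0 , g∈ , gx∈) → g , n , g≉0 , g∈ ,
          T-respects n (solve 2 (λ g x → :- (g :* x) := g :* :- x) refl g x)
            (k.span-neg (pows t n) gx∈) }
      ; *-closed = λ { {x} {y} (g , m , g≉0 , g∈ , gx∈) (h , n , h≉0 , h∈ , hy∈) →
          g * h , m ℕ.+ n , *-≉0 g≉0 h≉0 , T-* m n g∈ h∈ ,
          T-respects (m ℕ.+ n)
            (solve 4 (λ g h x y → g :* x :* (h :* y) := g :* h :* (x :* y)) refl g h x y)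
            (T-* m n gx∈ hy∈) }
      ; inverse  = λ { {x} (g , n , g≉0 , g∈ , gx∈) x≉0 →
          let y , xy≈1 = field-inverse x x≉0 in
          y , (g * x , n , *-≉0 g≉0 x≉0 , gx∈ , T-respects n (begin
            g              ≈⟨ *-identityʳ g ⟨
            g * 1#         ≈⟨ *-congˡ xy≈1 ⟨
            g * (x * y)    ≈⟨ *-assoc g x y ⟨
            g * x * y      ∎) g∈) , xy≈1 }
      }
      where
      k⊆Fractions : k ⊆ Fractions
      k⊆Fractions a∈ = 1# , 1 , 1≉0 , t^∈ 0 ,
        T-respects 1 (sym (*-identityˡ _)) (span-pows-const k.additive t 0 a∈)

    T⊆Fractions : ∀ n → T n ⊆ Fractions
    T⊆Fractions n x∈ = 1# , suc n , 1≉0 , span-pows-const k.additive t n k.1∈ ,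
      T-respects (suc n) (sym (*-identityˡ _)) (T-≤ (ℕₚ.n≤1+n n) x∈)

  module DegreeFiltration {k F : Pred Carrier ℓ} {t : Carrier} (RF : IsRationalFunctionField k t F) where
    open IsRationalFunctionField RF
    module k = Over constants
    module F = Over functions

    open Degrees constants t hiding (Fractions; fractions-subfield; T⊆Fractions) public

    T⊆F : ∀ n → T n ⊆ F
    T⊆F n = span-elim F.additive (All.map (λ v∈ c c∈ → F.*-closed (constants⊆ c∈) v∈)
      (Base.All-pows functions F.*-closed F.1∈ t∈ n))

    -- If z had degree n ≥ d, the product of tⁱ and z would have degree i + n, although it is
    -- assumed to have degree less than m + d ≤ i + n. This contradicts the independence of the
    -- powers of t.
    T-cancel : ∀ n d i m {z} → z ∈ T n → m ℕ.≤ i → (t ^ i * z) ∈ T (m ℕ.+ d) → z ∈ T d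
    T-cancel zero    d i m {z} z∈ m≤i tz∈ = T-≤ z≤n z∈
    T-cancel (suc n) d i m {z} z∈@(step a a∈ y y∈ e) m≤i tz∈ with suc n ℕₚ.≤? d | em {P = a ≈ 0#}
    ... | yes n<d | _       = T-≤ n<d z∈
    ... | no  n≮d | yes a≈0 = T-cancel n d i m (T-respects n (sym z≈y) y∈) m≤i tz∈
      where
      z≈y : z ≈ y
      z≈y = trans e (trans (+-congʳ (trans (*-congʳ a≈0) (zeroˡ _))) (+-identityˡ y))
    ... | no  n≮d | no  a≉0 = ⊥-elim (proj₁ (transcendental (suc (i ℕ.+ n)))
            (k.unscale T-i+n scale a∈ a≉0 (k.subtract T-i+n scale
              (T-respects (i ℕ.+ n) tⁱz≈ (T-≤ (ℕₚ.+-mono-≤ m≤i (ℕₚ.≤-pred (ℕₚ.≰⇒> n≮d))) tz∈))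
              (span-pows-shifts k.additive t i n y∈))))
      where
      T-i+n = T-additive (i ℕ.+ n)
      scale : ∀ {a x} → a ∈ k → x ∈ T (i ℕ.+ n) → (a * x) ∈ T (i ℕ.+ n)
      scale = k.span-scale-k (pows t (i ℕ.+ n))
      tⁱz≈ : t ^ i * z ≈ a * t ^ (i ℕ.+ n) + t ^ i * y
      tⁱz≈ = begin
        t ^ i * z                        ≈⟨ *-congˡ e ⟩
        t ^ i * (a * t ^ n + y)
          ≈⟨ solve 4 (λ p a q y → p :* (a :* q :+ y) := a :* (p :* q) :+ p :* y) refl (t ^ i) a (t ^ n) y ⟩
        a * (t ^ i * t ^ n) + t ^ i * y  ≈⟨ +-congʳ (*-congˡ (^-homo-* t i n)) ⟨
        a * t ^ (i ℕ.+ n) + t ^ i * y    ∎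

    Clearable : (ℕ → Pred Carrier ℓ) → Pred Carrier ℓ
    Clearable Q x = ∃[ g ] ∃[ n ] (g ≉ 0# × g ∈ T n × (g * x) ∈ Q n)

    module _ {Q : ℕ → Pred Carrier ℓ} (resp : ∀ n {x y} → x ≈ y → x ∈ Q n → y ∈ Q n)
             (scale : ∀ m n {a x} → a ∈ T m → x ∈ Q n → (a * x) ∈ Q (m ℕ.+ n)) where

      -- The graded family Q allows one argument for scalars, with Q = `T`, and for vectors, with Q
      -- n the combinations whose coefficients lie in `T n`.
      common-denominator : ∀ {xs} → All (Clearable Q) xs →
        ∃[ g ] ∃[ n ] (g ≉ 0# × g ∈ T n × All (λ x → (g * x) ∈ Q n) xs)
      common-denominator [] = 1# , 1 , 1≉0 , t^∈ 0 , []
      common-denominator {x ∷ _} ((g , m , g≉0 , g∈ , gx∈) ∷ xs∈) with common-denominator xs∈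
      ... | h , n , h≉0 , h∈ , hxs∈ = g * h , m ℕ.+ n , *-≉0 g≉0 h≉0 , T-* m n g∈ h∈ ,
        ≡.subst (λ i → (g * h * x) ∈ Q i) (ℕₚ.+-comm n m)
          (resp (n ℕ.+ m) (solve 3 (λ g h x → h :* (g :* x) := g :* h :* x) refl g h x)
            (scale n m h∈ gx∈)) ∷
        All.map (λ hx∈ → resp (m ℕ.+ n) (sym (*-assoc g h _)) (scale m n g∈ hx∈)) hxs∈

    span-T-respects : ∀ vs n {x y} → x ≈ y → x ∈ Span (T n) vs → y ∈ Span (T n) vs
    span-T-respects vs n = spanMod-respects (IsAdditive.respects Zero-additive) vs

    span-T-additive : ∀ vs n → IsAdditive (Span (T n) vs)
    span-T-additive vs n = spanMod-additive Zero-additive (T-additive n) vs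

    span-T-≤ : ∀ vs {m n} → m ℕ.≤ n → Span (T m) vs ⊆ Span (T n) vs
    span-T-≤ vs m≤n = span-mono (T-≤ m≤n) vs

    span-T-scale : ∀ vs m n {a x} → a ∈ T m → x ∈ Span (T n) vs → (a * x) ∈ Span (T (m ℕ.+ n)) vs
    span-T-scale vs m n a∈ = span-scale (T-* m n a∈) vs

    span-T-shifts : ∀ vs i n {x} → x ∈ Span (T n) vs → (t ^ i * x) ∈ Span (T (i ℕ.+ n)) vs
    span-T-shifts vs i n = span-scale (span-pows-shifts k.additive t i n) vs

    clear-span : ∀ vs {x} → x ∈ Span F vs → Clearable (λ n → Span (T n) vs) x
    clear-span []       {x} (base x≈0) = 1# , 1 , 1≉0 , t^∈ 0 , base (Zero-scale 1# x≈0)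
    clear-span (v ∷ vs) {x} (step c c∈ y y∈ e) with fraction c∈ | clear-span vs y∈
    ... | g , m , g≉0 , g∈ , gc∈ | h , n , h≉0 , h∈ , hy∈ =
      g * h , m ℕ.+ n , *-≉0 g≉0 h≉0 , T-* m n g∈ h∈ ,
      step (h * (g * c)) (≡.subst (λ i → (h * (g * c)) ∈ T i) (ℕₚ.+-comm n m) (T-* n m h∈ gc∈))
        (g * (h * y)) (span-T-scale vs m n g∈ hy∈) (trans (*-congˡ e)
        (solve 5 (λ g h c v y → g :* h :* (c :* v :+ y) := h :* (g :* c) :* v :+ g :* (h :* y))
          refl g h c v y))

  -- Independence over k(t) from independence of finitely many monomials over k

  module Disjointness {k F : Pred Carrier ℓ} {t : Carrier} (RF : IsRationalFunctionField k t F)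
    (es : List Carrier) (h : ℕ)
    (products : All (λ e → All (λ e′ → (e * e′) ∈ Span (Degree< k t h) es) es) es) where
    open IsRationalFunctionField RF
    open DegreeFiltration RF

    span-T-* : ∀ m n {x y} → x ∈ Span (T m) es → y ∈ Span (T n) es →
               (x * y) ∈ Span (T (m ℕ.+ (n ℕ.+ h))) es
    span-T-* m n {x} {y} x∈ y∈ = resp (*-comm y x) (span-elim (preimage-additive y V)
      (All.map (λ {e} e∈ c c∈ → resp
          (solve 3 (λ c e y → c :* (e :* y) := y :* (c :* e)) refl c e y)
          (span-T-scale es m (n ℕ.+ h) c∈ (left e∈))) products) x∈)
      where
      V = span-T-additive es (m ℕ.+ (n ℕ.+ h))
      resp = λ {x y} → IsAdditive.respects V {x} {y}
      left : ∀ {e} → All (λ e′ → (e * e′) ∈ Span (T h) es) es → (e * y) ∈ Span (T (n ℕ.+ h)) es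
      left {e} ee∈ = span-elim (preimage-additive e (span-T-additive es (n ℕ.+ h)))
        (All.map (λ {e′} e′∈ c c∈ → span-T-respects es (n ℕ.+ h)
          (solve 3 (λ c e y → c :* (e :* y) := e :* (c :* y)) refl c e e′)
          (span-T-scale es n h c∈ e′∈)) ee∈) y∈

    -- O = Σ k[t] e, while J i n consists of the combinations of the e whose
    -- coefficients have a power of t as denominator and degree less than n - i.

    O : Pred Carrier ℓ
    O x = ∃[ n ] (x ∈ Span (T n) es)

    J : ℕ → ℕ → Pred Carrier ℓ
    J i n x = ∃[ m ] ((t ^ (m ℕ.+ i) * x) ∈ Span (T (m ℕ.+ n)) es)

    O-additive : IsAdditive O
    O-additive = record
      { respects = λ x≈y (n , x∈) → n , span-T-respects es n x≈y x∈
      ; 0∈       = 0 , IsAdditive.0∈ (span-T-additive es 0)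
      ; +-closed = λ { {x} {y} (m , x∈) (n , y∈) → m ℕ.+ n ,
          IsAdditive.+-closed (span-T-additive es (m ℕ.+ n))
            (span-T-≤ es (ℕₚ.m≤m+n m n) x∈) (span-T-≤ es (ℕₚ.m≤n+m n m) y∈) }
      }

    -- A larger power of t is always admissible as denominator, so finitely many elements of J can
    -- share one.
    J-raise : ∀ {i n x} o m → (t ^ (m ℕ.+ i) * x) ∈ Span (T (m ℕ.+ n)) es →
              (t ^ (o ℕ.+ m ℕ.+ i) * x) ∈ Span (T (o ℕ.+ m ℕ.+ n)) es
    J-raise {i} {n} {x} o m x∈ =
      ≡.subst (λ j → (t ^ (o ℕ.+ m ℕ.+ i) * x) ∈ Span (T j) es) (≡.sym (ℕₚ.+-assoc o m n))
        (span-T-respects es (o ℕ.+ (m ℕ.+ n)) (begin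
          t ^ o * (t ^ (m ℕ.+ i) * x)   ≈⟨ *-assoc _ _ _ ⟨
          t ^ o * t ^ (m ℕ.+ i) * x     ≈⟨ *-congʳ (^-homo-* t o (m ℕ.+ i)) ⟨
          t ^ (o ℕ.+ (m ℕ.+ i)) * x     ≡⟨ ≡.cong (λ j → t ^ j * x) (ℕₚ.+-assoc o m i) ⟨
          t ^ (o ℕ.+ m ℕ.+ i) * x       ∎)
          (span-T-shifts es o (m ℕ.+ n) x∈))

    J-additive : ∀ i n → IsAdditive (J i n)
    J-additive i n = record
      { respects = λ x≈y (m , x∈) → m , span-T-respects es (m ℕ.+ n) (*-congˡ x≈y) x∈
      ; 0∈       = 0 , span-T-respects es n (sym (zeroʳ _)) (IsAdditive.0∈ (span-T-additive es n))
      ; +-closed = λ { {x} {y} (l , x∈) (m , y∈) → l ℕ.+ m ,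
          span-T-respects es (l ℕ.+ m ℕ.+ n) (sym (distribˡ _ x y))
            (IsAdditive.+-closed (span-T-additive es (l ℕ.+ m ℕ.+ n))
              (≡.subst (λ j → (t ^ (j ℕ.+ i) * x) ∈ Span (T (j ℕ.+ n)) es) (ℕₚ.+-comm m l)
                (J-raise {n = n} m l x∈))
              (J-raise {n = n} l m y∈)) }
      }

    J-scale : ∀ i n {a x} → a ∈ k → x ∈ J i n → (a * x) ∈ J i n
    J-scale i n {a} {x} a∈ (m , x∈) = m , span-T-respects es (m ℕ.+ n)
      (solve 3 (λ a p x → a :* (p :* x) := p :* (a :* x)) refl a _ x)
      (span-scale (k.span-scale-k (pows t (m ℕ.+ n)) a∈) es x∈)

    O-scale : ∀ {a x} → a ∈ k → x ∈ O → (a * x) ∈ O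
    O-scale a∈ (n , x∈) = n , span-scale (k.span-scale-k (pows t n) a∈) es x∈

    O-* : ∀ {x y} → x ∈ O → y ∈ O → (x * y) ∈ O
    O-* (m , x∈) (n , y∈) = m ℕ.+ (n ℕ.+ h) , span-T-* m n x∈ y∈

    -- A product of two expressions in the e picks up structure constants of degree less than h. Of
    -- the two shifts by h one pays for them and the other survives.
    J-* : ∀ a b {x y} → x ∈ J (h ℕ.+ a) 0 → y ∈ J (h ℕ.+ b) 0 → (x * y) ∈ J (h ℕ.+ (a ℕ.+ b)) 0
    J-* a b {x} {y} (l , x∈) (m , y∈) = l ℕ.+ (m ℕ.+ h) ,
      ≡.subst (λ j → (t ^ (l ℕ.+ (m ℕ.+ h) ℕ.+ (h ℕ.+ (a ℕ.+ b))) * (x * y)) ∈ Span (T j) es)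
        (N.solve 3 (λ l m h → l N.:+ N.con 0 N.:+ (m N.:+ N.con 0 N.:+ h) N.:=
                              l N.:+ (m N.:+ h) N.:+ N.con 0) ≡.refl l m h)
        (span-T-respects es (l ℕ.+ 0 ℕ.+ (m ℕ.+ 0 ℕ.+ h)) (begin
          t ^ (l ℕ.+ (h ℕ.+ a)) * x * (t ^ (m ℕ.+ (h ℕ.+ b)) * y)
            ≈⟨ solve 4 (λ p q x y → p :* x :* (q :* y) := p :* q :* (x :* y)) refl _ _ x y ⟩
          t ^ (l ℕ.+ (h ℕ.+ a)) * t ^ (m ℕ.+ (h ℕ.+ b)) * (x * y)
            ≈⟨ *-congʳ (^-homo-* t (l ℕ.+ (h ℕ.+ a)) (m ℕ.+ (h ℕ.+ b))) ⟨
          t ^ (l ℕ.+ (h ℕ.+ a) ℕ.+ (m ℕ.+ (h ℕ.+ b))) * (x * y)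
            ≡⟨ ≡.cong (λ j → t ^ j * (x * y)) (N.solve 5 (λ l m h a b →
                 l N.:+ (h N.:+ a) N.:+ (m N.:+ (h N.:+ b)) N.:=
                 l N.:+ (m N.:+ h) N.:+ (h N.:+ (a N.:+ b))) ≡.refl l m h a b) ⟩
          t ^ (l ℕ.+ (m ℕ.+ h) ℕ.+ (h ℕ.+ (a ℕ.+ b))) * (x * y)   ∎)
          (span-T-* (l ℕ.+ 0) (m ℕ.+ 0) x∈ y∈))
      where module N = +-*-Solver

    J-pred : ∀ a {x} → x ∈ J (h ℕ.+ suc a) 0 → x ∈ J (h ℕ.+ a) 0
    J-pred a {x} (m , x∈) = suc m ,
      ≡.subst (λ j → (t ^ j * x) ∈ Span (T (suc m ℕ.+ 0)) es)
        (≡.trans (≡.cong (m ℕ.+_) (ℕₚ.+-suc h a)) (ℕₚ.+-suc m (h ℕ.+ a)))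
        (span-T-≤ es (ℕₚ.n≤1+n (m ℕ.+ 0)) x∈)

    -- In the shift h + 1 the h makes H 0 closed under products. The additional 1 leaves a strict
    -- drop in degree at every multiplication, which is what excludes 1 from H 0.
    H : ℕ → Pred Carrier ℓ
    H n x = x ∈ O × x ∈ J (h ℕ.+ 1) n

    H-additive : ∀ n → IsAdditive (H n)
    H-additive n = record
      { respects = λ x≈y (o , j) → IsAdditive.respects O-additive x≈y o ,
                                   IsAdditive.respects (J-additive _ n) x≈y j
      ; 0∈       = IsAdditive.0∈ O-additive , IsAdditive.0∈ (J-additive _ n)
      ; +-closed = λ (o , j) (o′ , j′) → IsAdditive.+-closed O-additive o o′ ,
                                         IsAdditive.+-closed (J-additive _ n) j j′
      }

    H-scale : ∀ n {a x} → a ∈ k → x ∈ H n → (a * x) ∈ H n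
    H-scale n a∈ (o , j) = O-scale a∈ o , J-scale _ n a∈ j

    H₀-* : ∀ {x y} → x ∈ H 0 → y ∈ H 0 → (x * y) ∈ H 0
    H₀-* (o , j) (o′ , j′) = O-* o o′ , J-pred 1 (J-* 1 1 j j′)

    -- A basis over F of the span of `es`. Its length is the dimension r, and coordinates in it are
    -- unique, as they need not be in `es`.
    vs : List Carrier
    vs = F.extract Zero es

    vs-independent : Independent Zero F vs
    vs-independent = F.extract-independent Zero es

    O⊆ : O ⊆ Span F vs
    O⊆ (n , x∈) = F.span-⊆ vs (F.extract-spans Zero-additive es) (span-mono (T⊆F n) es x∈)

    -- Let g clear the coordinates of `es` in `vs`, with degrees below d. For x in H 0 the
    -- coordinates of g x in `vs` are polynomials, and smallness at infinity forces their degrees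
    -- below d. Multiplication by g thus embeds H 0 into a space spanned by d r elements.
    H₀-finite : ∃[ n ] HasDimension≤ constants (H 0) n
    H₀-finite with common-denominator (span-T-respects vs) (span-T-scale vs)
                     (All.map (clear-span vs) (F.extract-spans Zero-additive es))
    ... | g , d , g≉0 , _ , ges∈ = length (tensor (pows t d) vs) , λ xs i xs∈ →
      ≡.subst (ℕ._≤ length (tensor (pows t d) vs)) (length-map (g *_) xs)
        (k.steinitz (tensor (pows t d) vs) (map (g *_) xs)
          (independent-map-* constants g≉0 xs i)
          (Allₚ.map⁺ (All.map (λ x∈ → span-tensor (λ z∈ → z∈) vs (bounded x∈)) xs∈)))
      where
      scaled : ∀ n {x} → x ∈ Span (T n) es → (g * x) ∈ Span (T (n ℕ.+ d)) vs
      scaled n = span-elim (preimage-additive g (span-T-additive vs (n ℕ.+ d)))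
        (All.map (λ {e} ge∈ c c∈ → span-T-respects vs (n ℕ.+ d)
          (solve 3 (λ c e g → c :* (g :* e) := g :* (c :* e)) refl c e g)
          (span-T-scale vs n d c∈ ge∈)) ges∈)
      bounded : ∀ {x} → x ∈ H 0 → (g * x) ∈ Span (T d) vs
      bounded {x} ((n , x∈) , m , tx∈) = span-mono
        (λ (z∈ , tz∈) → T-cancel (n ℕ.+ d) d i (m ℕ.+ 0) z∈
          (ℕₚ.+-monoʳ-≤ m z≤n) tz∈) vs
        (span-coordinates functions (T⊆F (n ℕ.+ d)) (T⊆F (m ℕ.+ 0 ℕ.+ d)) (T-respects (m ℕ.+ 0 ℕ.+ d))
          (T⊆F (suc i) (t^∈ i)) vs vs-independent (scaled n x∈)
          (span-T-respects vs (m ℕ.+ 0 ℕ.+ d)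
            (solve 3 (λ g p x → g :* (p :* x) := p :* (g :* x)) refl g (t ^ i) x)
            (scaled (m ℕ.+ 0) tx∈)))
        where i = m ℕ.+ (h ℕ.+ 1)

    -- H 0 is a finite-dimensional k-algebra, possibly without unit, so a nonzero
    -- element of it is algebraic over k and divides 1. But 1 has degree less than
    -- 0 at infinity, hence so do its powers, and 1 has arbitrarily small degree.

    H₀-zero : ∀ {y} → y ∈ H 0 → y ≈ 0#
    H₀-zero {y} y∈ = decidable-stable em λ y≉0 →
      let p , nz , ann = Base.dependent⇒algebraic constants (suc dim) λ i →
            ℕₚ.<-irrefl ≡.refl (≡.subst (ℕ._≤ dim)
              (≡.trans (length-map (y *_) (pows y (suc dim))) (length-pows y (suc dim)))
              (bound (map (y *_) (pows y (suc dim)))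
                (independent-map-* constants y≉0 (pows y (suc dim)) i)
                (Allₚ.map⁺ (multiples (suc dim)))))
          g , g∈ , e = Base.inverse-polynomial constants p nz ann y≉0
          1∈H = IsAdditive.respects (H-additive 0) e (y*eval∈ g∈)
      in ℕₚ.<-irrefl ≡.refl (≡.subst (ℕ._≤ dim) (length-pows t (suc dim))
           (bound (pows t (suc dim)) (transcendental (suc dim)) (t-powers 1∈H (suc dim))))
      where
      dim = proj₁ H₀-finite
      bound = proj₂ H₀-finite
      multiples : ∀ n → All (λ z → (y * z) ∈ H 0) (pows y n)
      multiples zero    = []
      multiples (suc n) = multiple n ∷ multiples n
        where
        multiple : ∀ n → (y * y ^ n) ∈ H 0
        multiple zero    = IsAdditive.respects (H-additive 0) (sym (*-identityʳ y)) y∈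
        multiple (suc n) = H₀-* y∈ (multiple n)
      y*eval∈ : ∀ {g} → All k g → (y * eval g y) ∈ H 0
      y*eval∈ []        = IsAdditive.respects (H-additive 0) (sym (zeroʳ y)) (IsAdditive.0∈ (H-additive 0))
      y*eval∈ {a ∷ g} (a∈ ∷ g∈) = IsAdditive.respects (H-additive 0)
        (solve 3 (λ a y z → a :* y :+ y :* (y :* z) := y :* (a :+ y :* z)) refl a y (eval g y))
        (IsAdditive.+-closed (H-additive 0) (H-scale 0 a∈ y∈) (H₀-* y∈ (y*eval∈ g∈)))
      module _ (1∈H : 1# ∈ H 0) where
        1∈J : ∀ a → 1# ∈ J (h ℕ.+ suc a) 0
        1∈J zero    = proj₂ 1∈H
        1∈J (suc a) = IsAdditive.respects (J-additive (h ℕ.+ suc (suc a)) 0) (*-identityˡ 1#)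
                        (J-* 1 (suc a) (proj₂ 1∈H) (1∈J a))
        t^∈H : ∀ j → t ^ j ∈ H 0
        t^∈H j =
          (let n , 1∈ = proj₁ 1∈H in
            j ℕ.+ n , span-T-respects es (j ℕ.+ n) (*-identityʳ (t ^ j)) (span-T-shifts es j n 1∈)) ,
          (let m , 1∈ = 1∈J j in
            m , span-T-respects es (m ℕ.+ 0) (begin
              t ^ (m ℕ.+ (h ℕ.+ suc j)) * 1#     ≈⟨ *-identityʳ _ ⟩
              t ^ (m ℕ.+ (h ℕ.+ suc j))
                ≡⟨ ≡.cong (t ^_) (≡.sym (≡.trans (ℕₚ.+-assoc m (h ℕ.+ 1) j)
                                  (≡.cong (m ℕ.+_) (ℕₚ.+-assoc h 1 j)))) ⟩
              t ^ (m ℕ.+ (h ℕ.+ 1) ℕ.+ j)        ≈⟨ ^-homo-* t (m ℕ.+ (h ℕ.+ 1)) j ⟩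
              t ^ (m ℕ.+ (h ℕ.+ 1)) * t ^ j      ∎) 1∈)
        t-powers : ∀ n → All (H 0) (pows t n)
        t-powers zero    = []
        t-powers (suc n) = t^∈H n ∷ t-powers n

    J-uniform : ∀ {i n xs} → All (J i n) xs →
                ∃[ m ] All (λ x → (t ^ (m ℕ.+ i) * x) ∈ Span (T (m ℕ.+ n)) es) xs
    J-uniform []                 = 0 , []
    J-uniform {i} {n} ((l , x∈) ∷ xs∈) with J-uniform xs∈
    ... | m , xs∈′ = m ℕ.+ l , J-raise {n = n} m l x∈ ∷
      All.map (λ {x} x∈ → ≡.subst (λ j → (t ^ (j ℕ.+ i) * x) ∈ Span (T (j ℕ.+ n)) es) (ℕₚ.+-comm l m)
        (J-raise {n = n} l m x∈)) xs∈′

    -- In a relation Σ c y = 0 with c ∈ k[t] the coefficients of the highest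
    -- power of t give a relation over k modulo terms of lower degree.

    quotient-relation : ∀ n ys → All (H (suc n)) ys → ∀ d cs → All (T d) cs →
      length cs ≡ length ys → NonZero cs → dot cs ys ≈ 0# → ¬ Independent (H n) k ys
    quotient-relation n ys ys∈ zero    cs cs∈ len nz e =
      ⊥-elim (Allₚ.Any¬⇒¬All nz (All.map (λ { (base c≈0) → c≈0 }) cs∈))
    quotient-relation n ys ys∈ (suc d) cs cs∈ len nz e with leading cs∈
      where
      leading : ∀ {cs} → All (T (suc d)) cs → ∃[ as ] ∃[ bs ] (All k as × All (T d) bs ×
        length as ≡ length cs × (All (_≈ 0#) as → All (T d) cs) ×
        (∀ ys → dot cs ys ≈ t ^ d * dot as ys + dot bs ys))
      leading [] = [] , [] , [] , [] , ≡.refl , (λ _ → []) , λ _ →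
        solve 1 (λ p → con (0 , 0) := p :* con (0 , 0) :+ con (0 , 0)) refl (t ^ d)
      leading {c ∷ cs} (step a a∈ b b∈ e ∷ cs∈) with leading cs∈
      ... | as , bs , as∈ , bs∈ , len , drop , eq =
        a ∷ as , b ∷ bs , a∈ ∷ as∈ , b∈ ∷ bs∈ , ≡.cong suc len ,
        (λ { (a≈0 ∷ as≈0) → T-respects d (sym (trans e
               (trans (+-congʳ (trans (*-congʳ a≈0) (zeroˡ _))) (+-identityˡ b)))) b∈ ∷ drop as≈0 }) ,
        λ { [] → solve 1 (λ p → con (0 , 0) := p :* con (0 , 0) :+ con (0 , 0)) refl (t ^ d)
          ; (y ∷ ys) → trans (+-cong (*-congʳ e) (eq ys)) (solve 6 (λ a p b y A B →
              (a :* p :+ b) :* y :+ (p :* A :+ B) := p :* (a :* y :+ A) :+ (b :* y :+ B))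
              refl a (t ^ d) b y (dot as ys) (dot bs ys)) }
    ... | as , bs , as∈ , bs∈ , len′ , drop , eq with em {P = NonZero as}
    ...   | no  as≈0 = quotient-relation n ys ys∈ d cs (drop (¬NonZero⇒All-≈0 as as≈0)) len nz e
    ...   | yes nzₐ  = dot⇒dependent constants (H-additive n) (H-scale n) ys as∈
                         (≡.trans len′ len) nzₐ (w∈O , d ℕ.+ m , w∈J)
      where
      w = dot as ys
      i = h ℕ.+ 1
      w∈O : w ∈ O
      w∈O = dot-∈ O-additive as∈ (All.map (λ y∈ c c∈ → O-scale c∈ (proj₁ y∈)) ys∈)
      uniform = J-uniform {n = suc n} (All.map proj₂ ys∈)
      m = proj₁ uniform
      bs∈J : (t ^ (m ℕ.+ i) * dot bs ys) ∈ Span (T (d ℕ.+ (m ℕ.+ n))) es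
      bs∈J = dot-∈ (preimage-additive (t ^ (m ℕ.+ i)) (span-T-additive es (d ℕ.+ (m ℕ.+ n)))) bs∈
        (All.map (λ {y} y∈ c c∈ → span-T-respects es (d ℕ.+ (m ℕ.+ n))
          (solve 3 (λ c p y → c :* (p :* y) := p :* (c :* y)) refl c (t ^ (m ℕ.+ i)) y)
          (span-scale (T-*-suc d (m ℕ.+ n) c∈) es
            (≡.subst (λ j → (t ^ (m ℕ.+ i) * y) ∈ Span (T j) es) (ℕₚ.+-suc m n) y∈)))
          (proj₂ uniform))
      w∈J : (t ^ (d ℕ.+ m ℕ.+ i) * w) ∈ Span (T (d ℕ.+ m ℕ.+ n)) es
      w∈J = ≡.subst (λ j → (t ^ (d ℕ.+ m ℕ.+ i) * w) ∈ Span (T j) es) (≡.sym (ℕₚ.+-assoc d m n))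
        (span-T-respects es (d ℕ.+ (m ℕ.+ n)) (begin
          - 1# * (t ^ (m ℕ.+ i) * dot bs ys)
            ≈⟨ solve 4 (λ p q b w → (:- con (1 , 0)) :* (p :* b) :=
                 q :* p :* w :- p :* (q :* w :+ b)) refl (t ^ (m ℕ.+ i)) (t ^ d) (dot bs ys) w ⟩
          t ^ d * t ^ (m ℕ.+ i) * w - t ^ (m ℕ.+ i) * (t ^ d * w + dot bs ys)
            ≈⟨ +-congˡ (-‿cong (trans (*-congˡ (trans (sym (eq ys)) e)) (zeroʳ _))) ⟩
          t ^ d * t ^ (m ℕ.+ i) * w - 0#
            ≈⟨ solve 1 (λ x → x :- con (0 , 0) := x) refl _ ⟩
          t ^ d * t ^ (m ℕ.+ i) * w
            ≈⟨ *-congʳ (^-homo-* t d (m ℕ.+ i)) ⟨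
          t ^ (d ℕ.+ (m ℕ.+ i)) * w
            ≡⟨ ≡.cong (λ j → t ^ j * w) (ℕₚ.+-assoc d m i) ⟨
          t ^ (d ℕ.+ m ℕ.+ i) * w   ∎)
          (span-scale (k.span-scale-k (pows t (d ℕ.+ (m ℕ.+ n))) (k.-‿closed k.1∈)) es bs∈J))

    -- More than r elements of O are dependent over F. Clearing denominators turns the relation into
    -- one with polynomial coefficients, which `quotient-relation` reduces to a relation over k.
    H-quotient : ∀ n ys → Independent (H n) k ys → All (H (suc n)) ys → length ys ℕ.≤ length vs
    H-quotient n ys i ys∈ with length ys ℕₚ.≤? length vs
    ... | yes ≤ = ≤
    ... | no  ≰ with dependent⇒dot functions ys
                       (λ j → ≰ (F.steinitz vs ys j (All.map (λ y∈ → O⊆ (proj₁ y∈)) ys∈)))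
    ...   | cs , cs∈ , len , nz , e with common-denominator T-respects T-* (All.map fraction cs∈)
    ...     | g , d , g≉0 , _ , gcs∈ = ⊥-elim (quotient-relation n ys ys∈ d (map (g *_) cs)
                (Allₚ.map⁺ gcs∈) (≡.trans (length-map (g *_) cs) len)
                (Anyₚ.map⁺ (Any.map (*-≉0 g≉0) nz))
                (trans (dot-map-* g cs ys) (Zero-scale g e)) i)

    H-dimension : ∀ n → HasDimension≤ constants (H n) (n ℕ.* length vs)
    H-dimension zero    []       i        xs∈       = z≤n
    -- As H 0 = 0, the first vector of a nonempty list would be zero and so would lie in every span.
    H-dimension zero    (x ∷ xs) (x∉ , _) (x∈ ∷ _) =
      ⊥-elim (x∉ (k.span-respects xs (sym (H₀-zero x∈))
        (k.span-0 xs)))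
    H-dimension (suc n) = ≡.subst (HasDimension≤ constants (H (suc n))) (ℕₚ.+-comm (n ℕ.* length vs) _)
      (dimension-quotient constants (H-additive n) (H-dimension n) (H-quotient n))

    threshold : ℕ
    threshold = suc (length es ℕ.* (h ℕ.+ 1))

    independent-over-functions : Independent Zero k (tensor (pows t threshold) es) →
                                 Independent Zero F es
    independent-over-functions i = F.extract-full Zero es (ℕₚ.≮⇒≥ λ r<M →
      ℕₚ.<⇒≱ (threshold-large M c r<M) (ℕₚ.≤-trans
        (ℕₚ.≤-reflexive (≡.sym (≡.trans (length-tensor (pows t N) es) (≡.cong (M ℕ.*_) (length-pows t N)))))
        (H-dimension (N ℕ.+ c) (tensor (pows t N) es) i monomials)))
      where
      N = threshold
      M = length es
      c = h ℕ.+ 1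
      r = length vs
      -- The monomials have degree less than N, which is the bound for index N + c after the shift
      -- by c. No power of t is needed as denominator, hence the witness 0.
      monomials : All (H (N ℕ.+ c)) (tensor (pows t N) es)
      monomials = All-tensor (All.map (λ e∈ → powers e∈ N ℕₚ.≤-refl)
        (spanned es (λ n → span-terms (T-additive n) es)))
        where
        spanned : ∀ xs → (∀ n → All (λ v → ∀ c → c ∈ T n → (c * v) ∈ Span (T n) es) xs) →
                  All (λ v → ∀ n c → c ∈ T n → (c * v) ∈ Span (T n) es) xs
        spanned []       _  = []
        spanned (x ∷ xs) f = (λ n → All.head (f n)) ∷ spanned xs (λ n → All.tail (f n))
        powers : ∀ {e} → (∀ n c → c ∈ T n → (c * e) ∈ Span (T n) es) →
                 ∀ n → n ℕ.≤ N → All (λ p → (p * e) ∈ H (N ℕ.+ c)) (pows t n)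
        powers e∈ zero    _   = []
        powers {e} e∈ (suc n) n<N = ((suc n , e∈ (suc n) (t ^ n) (t^∈ n)) , 0 ,
          span-T-≤ es (ℕₚ.≤-trans (ℕₚ.≤-reflexive (ℕₚ.+-comm (suc c) n))
              (ℕₚ.≤-trans (ℕₚ.≤-reflexive (ℕₚ.+-suc n c)) (ℕₚ.+-monoˡ-≤ c n<N)))
            (span-T-respects es (suc c ℕ.+ n) (*-assoc (t ^ c) (t ^ n) e)
              (e∈ (suc c ℕ.+ n) (t ^ c * t ^ n) (T-*-suc (suc c) n (t^∈ c) (t^∈ n))))) ∷
          powers e∈ n (ℕₚ.<⇒≤ n<N)

-- Binomial coefficients and primes

nC0≡1 : ∀ n → n C 0 ≡ 1
nC0≡1 n = ≡.trans (nCk≡nC[n∸k] {0} {n} z≤n) (nCn≡1 n)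

-- The absorption identity, from Pascal's rule by induction; it exhibits the factor n + 1 from which
-- divisibility by a prime is read off.
[k+1]*[n+1]C[k+1]≡[n+1]*nCk : ∀ n k → suc k ℕ.* (suc n C suc k) ≡ suc n ℕ.* (n C k)
[k+1]*[n+1]C[k+1]≡[n+1]*nCk zero    zero    = ≡.refl
[k+1]*[n+1]C[k+1]≡[n+1]*nCk zero    (suc k) = ≡.trans
  (≡.cong (suc (suc k) ℕ.*_) (k>n⇒nCk≡0 {1} {suc (suc k)} (s≤s (s≤s z≤n))))
  (≡.trans (ℕₚ.*-zeroʳ (suc (suc k))) (≡.sym (≡.cong (1 ℕ.*_) (k>n⇒nCk≡0 {0} {suc k} (s≤s z≤n)))))
[k+1]*[n+1]C[k+1]≡[n+1]*nCk (suc n) zero    = begin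
  1 ℕ.* (suc (suc n) C 1)          ≡⟨ ℕₚ.*-identityˡ (suc (suc n) C 1) ⟩
  suc (suc n) C 1                  ≡⟨ nCk+nC[k+1]≡[n+1]C[k+1] (suc n) 0 ⟨
  suc n C 0 ℕ.+ suc n C 1          ≡⟨ ≡.cong (suc n C 0 ℕ.+_) (ℕₚ.*-identityˡ (suc n C 1)) ⟨
  suc n C 0 ℕ.+ 1 ℕ.* (suc n C 1)
    ≡⟨ ≡.cong (suc n C 0 ℕ.+_) ([k+1]*[n+1]C[k+1]≡[n+1]*nCk n 0) ⟩
  suc n C 0 ℕ.+ suc n ℕ.* (n C 0)
    ≡⟨ ≡.cong₂ (λ a b → a ℕ.+ suc n ℕ.* b) (nC0≡1 (suc n)) (nC0≡1 n) ⟩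
  suc (suc n) ℕ.* 1                ≡⟨ ≡.cong (suc (suc n) ℕ.*_) (nC0≡1 (suc n)) ⟨
  suc (suc n) ℕ.* (suc n C 0)      ∎
  where open ≡.≡-Reasoning
[k+1]*[n+1]C[k+1]≡[n+1]*nCk (suc n) (suc k) = begin
  suc (suc k) ℕ.* (suc (suc n) C suc (suc k))
    ≡⟨ ≡.cong (suc (suc k) ℕ.*_) (nCk+nC[k+1]≡[n+1]C[k+1] (suc n) (suc k)) ⟨
  suc (suc k) ℕ.* (a ℕ.+ b)
    ≡⟨ solve 3 (λ k a b → (con 2 :+ k) :* (a :+ b) :=
         a :+ ((con 1 :+ k) :* a :+ (con 2 :+ k) :* b)) ≡.refl k a b ⟩
  a ℕ.+ (suc k ℕ.* a ℕ.+ suc (suc k) ℕ.* b)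
    ≡⟨ ≡.cong (a ℕ.+_) (≡.cong₂ ℕ._+_ ([k+1]*[n+1]C[k+1]≡[n+1]*nCk n k)
         ([k+1]*[n+1]C[k+1]≡[n+1]*nCk n (suc k))) ⟩
  a ℕ.+ (suc n ℕ.* (n C k) ℕ.+ suc n ℕ.* (n C suc k))
    ≡⟨ ≡.cong (a ℕ.+_) (ℕₚ.*-distribˡ-+ (suc n) (n C k) (n C suc k)) ⟨
  a ℕ.+ suc n ℕ.* (n C k ℕ.+ n C suc k)
    ≡⟨ ≡.cong (λ c → a ℕ.+ suc n ℕ.* c) (nCk+nC[k+1]≡[n+1]C[k+1] n k) ⟩
  suc (suc n) ℕ.* a   ∎
  where
  open ≡.≡-Reasoning
  open +-*-Solver
  a = suc n C suc k
  b = suc n C suc (suc k)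

-- By absorption the prime divides k + 1 times the coefficient, and it cannot divide the smaller
-- number k + 1.
prime∣C : ∀ {n k} → Prime (suc n) → suc k ℕ.< suc n → suc n ∣ suc n C suc k
prime∣C {n} {k} pr k<n with euclidsLemma (suc k) (suc n C suc k) pr
  (≡.subst (suc n ∣_) (≡.sym ([k+1]*[n+1]C[k+1]≡[n+1]*nCk n k)) (m∣m*n (n C k)))
... | inj₁ n∣k = ⊥-elim (ℕₚ.<⇒≱ k<n (∣⇒≤ n∣k))
... | inj₂ n∣C = n∣C

-- Separable elements and derivatives

module Separability {ℓ : Level} (em : ExcludedMiddle ℓ) (Ω : Field ℓ) where
  open Field Ω renaming (inverse to field-inverse)
  open IntegerRingSolver commutativeRing
  open Subfields commutativeRing
  open Polynomials commutativeRing
  open Extensions em Ω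
  open Mult semiring using (×1-homo-*; ×-assoc-*; ×-congʳ) renaming (_×_ to _·_)
  open CommutativeExp commutativeSemiring using (^-distrib-*; ^-congˡ; ^-assocʳ)
  open import Relation.Binary.Reasoning.Setoid setoid

  HasPrimeCharacteristic : Set ℓ
  HasPrimeCharacteristic = ∃[ p ] (Prime p × p · 1# ≈ 0#)

  -- In the absence of zero divisors, one of the prime factors of n + 1 must already vanish.
  n·1≈0⇒hasPrimeCharacteristic : ∀ n → suc n · 1# ≈ 0# → HasPrimeCharacteristic
  n·1≈0⇒hasPrimeCharacteristic n e =
    factor factors factorsPrime (≡.subst (λ n → n · 1# ≈ 0#) isFactorisation e)
    where
    open PrimeFactorisation (factorise (suc n))
    factor : ∀ ps → All Prime ps → product ps · 1# ≈ 0# → HasPrimeCharacteristic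
    factor []       []         e = ⊥-elim (1≉0 (trans (sym (+-identityʳ 1#)) e))
    factor (p ∷ ps) (pr ∷ prs) e with em {P = p · 1# ≈ 0#}
    ... | yes p≈0 = p , pr , p≈0
    ... | no  p≉0 = factor ps prs (*-integral (trans (sym (×1-homo-* p (product ps))) e) p≉0)

  coeff-beyond : ∀ p i → length p ℕ.≤ i → coeff p i ≈ 0#
  coeff-beyond []      i       _         = refl
  coeff-beyond (a ∷ p) (suc i) (s≤s p≤i) = coeff-beyond p i p≤i

  take-≋ : ∀ n p → (∀ i → n ℕ.≤ i → coeff p i ≈ 0#) → take n p ≋ p
  take-≋ zero    p       p≈0 i       = sym (p≈0 i z≤n)
  take-≋ (suc n) []      p≈0 i       = refl
  take-≋ (suc n) (a ∷ p) p≈0 zero    = refl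
  take-≋ (suc n) (a ∷ p) p≈0 (suc i) = take-≋ n p (λ j n≤j → p≈0 (suc j) (s≤s n≤j)) i

  n·0≈0 : ∀ n → n · 0# ≈ 0#
  n·0≈0 zero    = refl
  n·0≈0 (suc n) = trans (+-identityˡ _) (n·0≈0 n)

  coeff-top : ∀ (c : List Carrier) → coeff (c ∷ʳ 1#) (length c) ≈ 1#
  coeff-top []      = refl
  coeff-top (a ∷ c) = coeff-top c

  module _ {k : Pred Carrier ℓ} (kF : IsSubfield k) where
    open Base kF
    open Over kF

    -- The pair consists of value and derivative at x of one polynomial over k, that is, of its
    -- value at x + ε in the dual numbers. The closure rules produce polynomials with prescribed
    -- value and derivative without writing them out.
    Jet : Carrier → Carrier → Carrier → Set ℓ
    Jet x y y′ = ∃[ f ] (All k f × eval f x ≈ y × eval (derivative f) x ≈ y′)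

    jet-const : ∀ {x a} → a ∈ k → Jet x a 0#
    jet-const {x} {a} a∈ = a ∷ [] , a∈ ∷ [] , trans (+-congˡ (zeroʳ x)) (+-identityʳ a) ,
      trans (+-identityˡ _) (zeroʳ x)

    jet-variable : ∀ {x} → Jet x x 1#
    jet-variable {x} = 0# ∷ 1# ∷ [] , 0∈ ∷ 1∈ ∷ [] ,
      solve 1 (λ x → con (0 , 0) :+ x :* (con (1 , 0) :+ x :* con (0 , 0)) := x) refl x ,
      solve 1 (λ x → con (1 , 0) :+ con (0 , 0) :+ x :* (con (0 , 0) :+ x :* con (0 , 0)) :=
                     con (1 , 0)) refl x

    jet-+ : ∀ {x y y′ z z′} → Jet x y y′ → Jet x z z′ → Jet x (y + z) (y′ + z′)
    jet-+ {x} (f , f∈ , e , e′) (g , g∈ , d , d′) =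
      f +ᵖ g , All-+ᵖ {k} +-closed f∈ g∈ , trans (eval-+ f g x) (+-cong e d) ,
      trans (eval-derivative-+ f g x) (+-cong e′ d′)

    jet-* : ∀ {x y y′ z z′} → Jet x y y′ → Jet x z z′ → Jet x (y * z) (y′ * z + y * z′)
    jet-* {x} (f , f∈ , e , e′) (g , g∈ , d , d′) =
      f *ᵖ g , All-*ᵖ kF f∈ g∈ , trans (eval-* f g x) (*-cong e d) ,
      trans (eval-derivative-* f g x) (+-cong (*-cong e′ d) (*-cong e d′))

    jet-cong : ∀ {x y z y′ z′} → y ≈ z → y′ ≈ z′ → Jet x y y′ → Jet x z z′
    jet-cong p q (f , f∈ , e , e′) = f , f∈ , trans e p , trans e′ q

    jet-^ : ∀ {x y} n → Jet x y 0# → Jet x (y ^ n) 0#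
    jet-^ zero    j = jet-const 1∈
    jet-^ {y = y} (suc n) j = jet-cong refl
      (solve 2 (λ y z → con (0 , 0) :* z :+ y :* con (0 , 0) := con (0 , 0)) refl y (y ^ n))
      (jet-* j (jet-^ n j))

    jet-variable-^ : ∀ {x} n → Jet x (x ^ suc n) (suc n · 1# * x ^ n)
    jet-variable-^ {x} zero = jet-cong (sym (*-identityʳ x))
      (solve 0 (con (1 , 0) := (con (1 , 0) :+ con (0 , 0)) :* con (1 , 0)) refl) jet-variable
    jet-variable-^ {x} (suc n) = jet-cong refl
      (solve 3 (λ x z m → con (1 , 0) :* (x :* z) :+ x :* (m :* z) :=
         (con (1 , 0) :+ m) :* (x :* z)) refl x (x ^ n) (suc n · 1#))
      (jet-* jet-variable (jet-variable-^ n))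

    eval-derivative-multiple : ∀ {f} u g x → f ≋ u *ᵖ g → eval g x ≈ 0# →
      eval (derivative f) x ≈ eval u x * eval (derivative g) x
    eval-derivative-multiple {f} u g x f≋ug g≈0 = begin
      eval (derivative f) x
        ≈⟨ eval-cong (derivative f) (derivative (u *ᵖ g)) (derivative-cong f (u *ᵖ g) f≋ug) x ⟩
      eval (derivative (u *ᵖ g)) x
        ≈⟨ eval-derivative-* u g x ⟩
      eval (derivative u) x * eval g x + eval u x * eval (derivative g) x
        ≈⟨ +-congʳ (trans (*-congˡ g≈0) (zeroʳ _)) ⟩
      0# + eval u x * eval (derivative g) x
        ≈⟨ +-identityˡ _ ⟩
      eval u x * eval (derivative g) x   ∎

    root⇒power∈ : ∀ {x} c → Annihilates k (c ∷ʳ 1#) x → x ^ length c ∈ Span k (pows x (length c))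
    root⇒power∈ {x} c (p∈ , p≈0) =
      subtract V (span-scale-k (pows x (length c)))
        (IsAdditive.respects V (begin
          0#                          ≈⟨ p≈0 ⟨
          eval (c ∷ʳ 1#) x            ≈⟨ eval-∷ʳ c 1# x ⟩
          eval c x + 1# * x ^ length c
            ≈⟨ solve 2 (λ y z → y :+ con (1 , 0) :* z := z :+ y) refl (eval c x) (x ^ length c) ⟩
          x ^ length c + eval c x     ∎) (IsAdditive.0∈ V))
        (evalSpan (proj₁ (Allₚ.∷ʳ⁻ p∈)) ℕₚ.≤-refl)
      where V = span-additive (pows x (length c))

    -- 1/p′(x) = v(x) for some v over k, and p divides v p′ - 1.

    bezout : ∀ {x} c → Independent Zero k (pows x (length c)) → Annihilates k (c ∷ʳ 1#) x →
             eval (derivative (c ∷ʳ 1#)) x ≉ 0# → SeparablePolynomial k (c ∷ʳ 1#)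
    bezout {x} c i ann@(p∈ , _) p′≉0 =
      map (- 1# *_) w , v , All-map-* {k} *-closed (-‿closed 1∈) (proj₁ (proj₂ quotient)) , v∈ , λ i → begin
        coeff (map (- 1# *_) w *ᵖ p +ᵖ v *ᵖ p′) i
          ≈⟨ coeff-+ (map (- 1# *_) w *ᵖ p) (v *ᵖ p′) i ⟩
        coeff (map (- 1# *_) w *ᵖ p) i + coeff (v *ᵖ p′) i
          ≈⟨ +-congʳ (coeff-scale-* (- 1#) w p i) ⟩
        - 1# * coeff (w *ᵖ p) i + coeff (v *ᵖ p′) i
          ≈⟨ +-congʳ (*-congˡ (trans (sym (proj₂ (proj₂ quotient) i)) (coeff-+ (v *ᵖ p′) (- 1# ∷ []) i))) ⟩
        - 1# * (coeff (v *ᵖ p′) i + coeff (- 1# ∷ []) i) + coeff (v *ᵖ p′) i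
          ≈⟨ solve 2 (λ a b → (:- con (1 , 0)) :* (a :+ b) :+ a := :- b) refl
               (coeff (v *ᵖ p′) i) (coeff (- 1# ∷ []) i) ⟩
        - coeff (- 1# ∷ []) i
          ≈⟨ negate i ⟩
        coeff (1# ∷ []) i   ∎
      where
      d = length c
      p = c ∷ʳ 1#
      p′ = derivative p
      xᵈ∈ = root⇒power∈ c ann
      k[x] = simple-subfield d xᵈ∈
      p′∈ : eval p′ x ∈ Span k (pows x d)
      p′∈ = Base.eval-∈ k[x]
        (All.map (FiniteAlgebra.finite-base⊆ (pows x d) (pows-1∈ d xᵈ∈) (pows-* {x} {d} xᵈ∈))
          (All-derivative kF p∈))
        (pows-x∈ d xᵈ∈)
      inverted : ∃[ y ] (y ∈ Span k (pows x d) × eval p′ x * y ≈ 1#)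
      inverted = IsSubfield.inverse k[x] p′∈ p′≉0
      polynomial : ∃[ v ] (All k v × length v ≡ d × proj₁ inverted ≈ eval v x)
      polynomial = span-pows→eval x d (proj₁ (proj₂ inverted))
      v : List Carrier
      v = proj₁ polynomial
      v∈ : All k v
      v∈ = proj₁ (proj₂ polynomial)
      annihilates : eval (v *ᵖ p′ +ᵖ (- 1# ∷ [])) x ≈ 0#
      annihilates = begin
        eval (v *ᵖ p′ +ᵖ (- 1# ∷ [])) x   ≈⟨ eval-+ (v *ᵖ p′) (- 1# ∷ []) x ⟩
        eval (v *ᵖ p′) x + (- 1# + x * 0#)
          ≈⟨ +-congʳ (trans (eval-* v p′ x) (trans (*-congʳ (sym (proj₂ (proj₂ (proj₂ polynomial)))))
               (trans (*-comm _ _) (proj₂ (proj₂ inverted))))) ⟩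
        1# + (- 1# + x * 0#)
          ≈⟨ solve 1 (λ x → con (1 , 0) :+ (:- con (1 , 0) :+ x :* con (0 , 0)) := con (0 , 0)) refl x ⟩
        0#   ∎
      quotient : ∃[ w ] (All k w × v *ᵖ p′ +ᵖ (- 1# ∷ []) ≋ w *ᵖ p)
      quotient = Base.minimalPolynomial-divides kF {x} {c} i ann
        (All-+ᵖ {k} +-closed (All-*ᵖ kF v∈ (All-derivative kF p∈)) (-‿closed 1∈ ∷ []) , annihilates)
      w : List Carrier
      w = proj₁ quotient
      negate : ∀ i → - coeff (- 1# ∷ []) i ≈ coeff (1# ∷ []) i
      negate zero    = solve 0 (:- (:- con (1 , 0)) := con (1 , 0)) refl
      negate (suc i) = solve 0 (:- con (0 , 0) := con (0 , 0)) refl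

    -- If f = u p with p minimal, then f′(x) = u(x) p′(x), so p′(x) ≠ 0. Any polynomial over k with
    -- x as a simple root therefore certifies separability.
    simple-root⇒separable : ∀ {x f} → x ∈ AlgebraicOver k → Annihilates k f x →
                            eval (derivative f) x ≉ 0# → x ∈ SeparableOver k
    simple-root⇒separable {x} {f} x∈ annf f′≉0 =
      let c , i , ann    = minimalPolynomial x∈
          u , _ , f≋up = Base.minimalPolynomial-divides kF {x} {c} {f} i ann annf
      in c ∷ʳ 1# , isMinimalPolynomial c i ann , bezout c i ann λ p′≈0 →
           f′≉0 (trans (eval-derivative-multiple {f} u (c ∷ʳ 1#) x f≋up (proj₂ ann))
             (trans (*-congˡ p′≈0) (zeroʳ _)))

    jet⇒separable : ∀ {x} → x ∈ AlgebraicOver k → Jet x 0# 1# → x ∈ SeparableOver k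
    jet⇒separable x∈ (f , f∈ , e , e′) =
      simple-root⇒separable x∈ (f∈ , e) λ f′≈0 → 1≉0 (trans (sym e′) f′≈0)

    separable⇒simple-root : ∀ {x} → x ∈ SeparableOver k →
                            ∃[ f ] (Annihilates k f x × eval (derivative f) x ≉ 0#)
    separable⇒simple-root {x} (p , (ann , _) , u , v , _ , _ , e) = p , ann , λ p′≈0 → 1≉0 (begin
      1#
        ≈⟨ solve 1 (λ x → con (1 , 0) := con (1 , 0) :+ x :* con (0 , 0)) refl x ⟩
      eval (1# ∷ []) x                          ≈⟨ eval-cong (u *ᵖ p +ᵖ v *ᵖ derivative p) (1# ∷ []) e x ⟨
      eval (u *ᵖ p +ᵖ v *ᵖ derivative p) x      ≈⟨ eval-+ (u *ᵖ p) (v *ᵖ derivative p) x ⟩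
      eval (u *ᵖ p) x + eval (v *ᵖ derivative p) x
        ≈⟨ +-cong (eval-* u p x) (eval-* v (derivative p) x) ⟩
      eval u x * eval p x + eval v x * eval (derivative p) x
        ≈⟨ +-cong (trans (*-congˡ (proj₂ ann)) (zeroʳ _)) (trans (*-congˡ p′≈0) (zeroʳ _)) ⟩
      0# + 0#                                   ≈⟨ +-identityˡ 0# ⟩
      0#                                        ∎)

    separable⊆algebraic : SeparableOver k ⊆ AlgebraicOver k
    separable⊆algebraic (.(c ∷ʳ 1#) , (ann , c , ≡.refl , _) , _) = c ∷ʳ 1# , nonZero-∷ʳ1 c , ann

    base⊆separable : k ⊆ SeparableOver k
    base⊆separable {a} a∈ = jet⇒separable (base⊆algebraic kF a∈)
      (jet-cong (-‿inverseʳ a) (+-identityʳ 1#) (jet-+ jet-variable (jet-const (-‿closed a∈))))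

    separable-respects : SeparableOver k Respects _≈_
    separable-respects {x} {y} x≈y x∈ with separable⇒simple-root x∈
    ... | f , (f∈ , e) , f′≉0 = simple-root⇒separable
      (IsSubfield.respects (algebraic-subfield kF) x≈y (separable⊆algebraic x∈))
      (f∈ , trans (eval-congʳ f (sym x≈y)) e)
      (λ f′≈0 → f′≉0 (trans (eval-congʳ (derivative f) x≈y) f′≈0))

    -- The derivative kills x and has smaller degree than the minimal polynomial, so minimality
    -- makes all of its coefficients zero.
    derivative-vanishes : ∀ {x} c → Independent Zero k (pows x (length c)) →
      Annihilates k (c ∷ʳ 1#) x → eval (derivative (c ∷ʳ 1#)) x ≈ 0# → derivative (c ∷ʳ 1#) ≋ []
    derivative-vanishes {x} c i ann@(p∈ , _) p′≈0 j =
      trans (sym (trimmed j)) (All-≈0⇒≋[] (¬NonZero⇒All-≈0 q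
        (proj₂ (proj₂ (proj₂ (isMinimalPolynomial c i ann))) q
          (Allₚ.take⁺ (length c) (All-derivative kF p∈) ,
           trans (eval-cong q p′ trimmed x) p′≈0)
          (ℕₚ.≤-trans (ℕₚ.≤-reflexive (length-take (length c) p′)) (ℕₚ.m⊓n≤m (length c) _)))) j)
      where
      p = c ∷ʳ 1#
      p′ = derivative p
      -- `derivative` preserves the length of a list and leaves a vanishing entry at the end. This
      -- is cut off because minimality is stated in terms of length.
      q = take (length c) p′
      trimmed : q ≋ p′
      trimmed = take-≋ (length c) p′ λ i c≤i → trans (coeff-derivative p i)
        (trans (×-congʳ (suc i) (coeff-beyond p (suc i)
          (ℕₚ.≤-trans (ℕₚ.≤-reflexive (length-∷ʳ 1# c)) (s≤s c≤i)))) (n·0≈0 (suc i)))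

    inseparable⇒hasPrimeCharacteristic : ∀ {x} → x ∈ AlgebraicOver k → x ∉ SeparableOver k →
                                         HasPrimeCharacteristic
    inseparable⇒hasPrimeCharacteristic {x} x∈ x∉ with minimalPolynomial x∈
    ... | c , i , ann with em {P = eval (derivative (c ∷ʳ 1#)) x ≈ 0#}
    ...   | no  p′≉0 = ⊥-elim (x∉ (simple-root⇒separable x∈ ann p′≉0))
    ...   | yes p′≈0 = top c ann (derivative-vanishes c i ann p′≈0)
      where
      top : ∀ c → Annihilates k (c ∷ʳ 1#) x → derivative (c ∷ʳ 1#) ≋ [] → HasPrimeCharacteristic
      top []      (_ , e) _ = ⊥-elim (1≉0 (trans (solve 1 (λ x → con (1 , 0) :=
                                con (1 , 0) :+ x :* con (0 , 0)) refl x) e))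
      top (a ∷ c) _ p′≋0 = n·1≈0⇒hasPrimeCharacteristic (length c) (begin
        suc (length c) · 1#
          ≈⟨ ×-congʳ (suc (length c)) (coeff-top c) ⟨
        suc (length c) · coeff (c ∷ʳ 1#) (length c)
          ≈⟨ coeff-derivative (a ∷ (c ∷ʳ 1#)) (length c) ⟨
        coeff (derivative (a ∷ (c ∷ʳ 1#))) (length c)
          ≈⟨ p′≋0 (length c) ⟩
        0#   ∎)

  -- Separability in prime characteristic

  module Frobenius {m : ℕ} (pr : Prime (suc m)) (p≈0 : suc m · 1# ≈ 0#) where

    p : ℕ
    p = suc m

    multiple≈0 : ∀ {n} z → p ∣ n → n · z ≈ 0#
    multiple≈0 {n} z (divides q n≡qp) = begin
      n · z                       ≡⟨ ≡.cong (_· z) n≡qp ⟩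
      (q ℕ.* p) · z               ≈⟨ ×-congʳ (q ℕ.* p) (*-identityˡ z) ⟨
      (q ℕ.* p) · (1# * z)        ≈⟨ ×-assoc-* (q ℕ.* p) 1# z ⟨
      (q ℕ.* p) · 1# * z          ≈⟨ *-congʳ (×1-homo-* q p) ⟩
      (q · 1#) * (p · 1#) * z     ≈⟨ *-congʳ (trans (*-congˡ p≈0) (zeroʳ _)) ⟩
      0# * z                      ≈⟨ zeroˡ z ⟩
      0#                          ∎

    ^p-+ : ∀ x y → (x + y) ^ p ≈ x ^ p + y ^ p
    ^p-+ x y = begin
      (x + y) ^ p
        ≈⟨ theorem p x y ⟩
      (p C 0) · (1# * y ^ p) + sum (λ i → term (Fin.suc i))
        ≈⟨ +-cong first (sum-init-last (λ i → term (Fin.suc i))) ⟩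
      y ^ p + (sum (λ i → term (Fin.suc (inject₁ i))) + term (Fin.suc (fromℕ m)))
        ≈⟨ +-congˡ (+-cong (trans (sum-cong-≋ middle) (sum-replicate-zero m)) last) ⟩
      y ^ p + (0# + x ^ p)
        ≈⟨ solve 2 (λ a b → b :+ (con (0 , 0) :+ a) := a :+ b) refl (x ^ p) (y ^ p) ⟩
      x ^ p + y ^ p   ∎
      where
      open Binomial commutativeSemiring using (theorem; binomialTerm)
      open import Algebra.Properties.Monoid.Sum +-monoid
        using (sum; sum-init-last; sum-cong-≋; sum-replicate-zero)
      term = binomialTerm x y p
      first : (p C 0) · (1# * y ^ p) ≈ y ^ p
      first = begin
        (p C 0) · (1# * y ^ p)   ≡⟨ ≡.cong (_· (1# * y ^ p)) (nC0≡1 p) ⟩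
        1# * y ^ p + 0#          ≈⟨ trans (+-identityʳ _) (*-identityˡ _) ⟩
        y ^ p                    ∎
      middle : ∀ i → term (Fin.suc (inject₁ i)) ≈ 0#
      middle i = multiple≈0 _ (prime∣C pr (s≤s (≡.subst (ℕ._< m) (≡.sym (Finₚ.toℕ-inject₁ i)) (Finₚ.toℕ<n i))))
      last : term (Fin.suc (fromℕ m)) ≈ x ^ p
      last = begin
        (p C suc (toℕ (fromℕ m))) · (x ^ suc (toℕ (fromℕ m)) * y ^ (m ℕ.∸ toℕ (fromℕ m)))
          ≡⟨ ≡.cong (λ j → (p C suc j) · (x ^ suc j * y ^ (m ℕ.∸ j))) (Finₚ.toℕ-fromℕ m) ⟩
        (p C p) · (x ^ p * y ^ (m ℕ.∸ m))
          ≡⟨ ≡.cong₂ (λ n j → n · (x ^ p * y ^ j)) (nCn≡1 p) (ℕₚ.n∸n≡0 m) ⟩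
        x ^ p * 1# + 0#   ≈⟨ trans (+-identityʳ _) (*-identityʳ _) ⟩
        x ^ p             ∎

    ^≉0 : ∀ n {x} → x ≉ 0# → x ^ n ≉ 0#
    ^≉0 zero    x≉0 = 1≉0
    ^≉0 (suc n) x≉0 = *-≉0 x≉0 (^≉0 n x≉0)

    -- Additivity is applied to (x - y) + y, which avoids the sign of (-1)ᵖ; a vanishing p-th power
    -- then forces x - y = 0.
    ^p-injective : ∀ {x y} → x ^ p ≈ y ^ p → x ≈ y
    ^p-injective {x} {y} e = decidable-stable em λ x≉y →
      ^≉0 p (λ x-y≈0 → x≉y (x-y≈0⇒x≈y x-y≈0)) (begin
        (x - y) ^ p                     ≈⟨ solve 2 (λ a b → a := a :+ b :- b) refl _ (y ^ p) ⟩
        (x - y) ^ p + y ^ p - y ^ p     ≈⟨ +-congʳ (^p-+ (x - y) y) ⟨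
        (x - y + y) ^ p - y ^ p
          ≈⟨ +-congʳ (^-congˡ p (solve 2 (λ x y → x :- y :+ y := x) refl x y)) ⟩
        x ^ p - y ^ p                   ≈⟨ +-congʳ e ⟩
        y ^ p - y ^ p                   ≈⟨ -‿inverseʳ _ ⟩
        0#                              ∎)

    ^p-0 : ∀ {x} → x ≈ 0# → x ^ p ≈ 0#
    ^p-0 x≈0 = trans (*-congʳ x≈0) (zeroˡ _)

    1^≈1 : ∀ n → 1# ^ n ≈ 1#
    1^≈1 zero    = refl
    1^≈1 (suc n) = trans (*-identityˡ _) (1^≈1 n)

    frobenius : List Carrier → List Carrier
    frobenius = map (_^ p)

    ^p-^ : ∀ x n → (x ^ n) ^ p ≈ (x ^ p) ^ n
    ^p-^ x n = begin
      (x ^ n) ^ p        ≈⟨ ^-assocʳ x n p ⟩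
      x ^ (n ℕ.* p)      ≡⟨ ≡.cong (x ^_) (ℕₚ.*-comm n p) ⟩
      x ^ (p ℕ.* n)      ≈⟨ ^-assocʳ x p n ⟨
      (x ^ p) ^ n        ∎

    -- The ambient field as a subfield of itself, so that division by X - x is divisibility by the
    -- minimal polynomial of x over it.
    Everything : Pred Carrier ℓ
    Everything _ = ⊤

    everything-subfield : IsSubfield Everything
    everything-subfield = record
      { respects = λ _ _ → tt ; 0∈ = tt ; 1∈ = tt ; 1≉0 = 1≉0 ; +-closed = λ _ _ → tt
      ; -‿closed = λ _ → tt ; *-closed = λ _ _ → tt
      ; inverse  = λ {x} _ x≉0 → let y , e = field-inverse x x≉0 in y , tt , e }

    module _ (closed : ∀ a f → NonZero f → ∃[ x ] (eval (a ∷ f) x ≈ 0#)) where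

      -- If all roots of the polynomial f = (X - x) u equal x, and x is a simple root,
      -- then u has no roots and f is linear.

      only-root⇒linear : ∀ {x} c → eval (c ∷ʳ 1#) x ≈ 0# → eval (derivative (c ∷ʳ 1#)) x ≉ 0# →
        (∀ y → eval (c ∷ʳ 1#) y ≈ 0# → y ≈ x) → ∃[ a ] (c ≡ a ∷ [] × x ≈ - a)
      only-root⇒linear {x} c f≈0 f′≉0 only = shape c f≈0 λ i 2≤i →
        trans (f≋ug i) (tail-zero (proj₁ factor) u-tail≈0 i 2≤i)
        where
        f = c ∷ʳ 1#
        g = (- x ∷ []) ∷ʳ 1#
        g≈0 : eval g x ≈ 0#
        g≈0 = solve 1 (λ x → :- x :+ x :* (con (1 , 0) :+ x :* con (0 , 0)) := con (0 , 0)) refl x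
        factor : ∃[ u ] (All Everything u × f ≋ u *ᵖ g)
        factor = Base.minimalPolynomial-divides everything-subfield {x} { - x ∷ []} {f}
          ((λ { (base 1≈0) → 1≉0 1≈0 }) , tt) (tt ∷ tt ∷ [] , g≈0) (All.universal (λ _ → tt) f , f≈0)
        f≋ug = proj₂ (proj₂ factor)
        eval-f : ∀ y → eval f y ≈ eval (proj₁ factor) y * eval g y
        eval-f y = trans (eval-cong f (proj₁ factor *ᵖ g) f≋ug y) (eval-* (proj₁ factor) g y)
        u≉0 : eval (proj₁ factor) x ≉ 0#
        u≉0 u≈0 = f′≉0 (trans (eval-derivative-multiple everything-subfield {f} (proj₁ factor) g x f≋ug g≈0)
          (trans (*-congʳ u≈0) (zeroˡ _)))
        rootless : ∀ a q → (∀ y → eval (a ∷ q) y ≈ 0# → eval f y ≈ 0#) →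
                   eval (a ∷ q) x ≉ 0# → ¬ NonZero q
        rootless a q u⇒f u≉0 nz =
          let y , u≈0 = closed a q nz in u≉0 (trans (eval-congʳ (a ∷ q) (sym (only y (u⇒f y u≈0)))) u≈0)
        TailZero : List Carrier → Set ℓ
        TailZero []      = ⊤
        TailZero (a ∷ q) = All (_≈ 0#) q
        conclude : ∀ u → (∀ y → eval u y ≈ 0# → eval f y ≈ 0#) → eval u x ≉ 0# → TailZero u
        conclude []      _   _   = tt
        conclude (a ∷ q) u⇒f u≉0 = ¬NonZero⇒All-≈0 q (rootless a q u⇒f u≉0)
        u-tail≈0 : TailZero (proj₁ factor)
        u-tail≈0 = conclude (proj₁ factor)
          (λ y u≈0 → trans (eval-f y) (trans (*-congʳ u≈0) (zeroˡ _))) u≉0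
        zero-* : ∀ q r → All (_≈ 0#) q → q *ᵖ r ≋ []
        zero-* []      r []          i = refl
        zero-* (a ∷ q) r (a≈0 ∷ q≈0) i = trans (coeff-+ (map (a *_) r) (0# ∷ (q *ᵖ r)) i)
          (trans (+-cong (trans (coeff-map-* a r i) (trans (*-congʳ a≈0) (zeroˡ _))) (shifted i))
            (+-identityˡ 0#))
          where
          shifted : ∀ i → coeff (0# ∷ (q *ᵖ r)) i ≈ 0#
          shifted zero    = refl
          shifted (suc i) = zero-* q r q≈0 i
        tail-zero : ∀ u → TailZero u → ∀ i → 2 ℕ.≤ i → coeff (u *ᵖ g) i ≈ 0#
        tail-zero []      _   i             _               = refl
        tail-zero (a ∷ q) q≈0 (suc (suc i)) (s≤s (s≤s z≤n)) =
          trans (coeff-+ (map (a *_) g) (0# ∷ (q *ᵖ g)) (suc (suc i)))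
            (trans (+-identityˡ _) (zero-* q g q≈0 (suc i)))
        shape : ∀ c → eval (c ∷ʳ 1#) x ≈ 0# → (∀ i → 2 ℕ.≤ i → coeff (c ∷ʳ 1#) i ≈ 0#) →
                ∃[ a ] (c ≡ a ∷ [] × x ≈ - a)
        shape [] e _ = ⊥-elim (1≉0 (trans
          (solve 1 (λ x → con (1 , 0) := con (1 , 0) :+ x :* con (0 , 0)) refl x) e))
        shape (a ∷ []) e _ = a , ≡.refl , (begin
          x                                 ≈⟨ solve 2 (λ a x → x :=
                                                 a :+ x :* (con (1 , 0) :+ x :* con (0 , 0)) :- a) refl a x ⟩
          a + x * (1# + x * 0#) - a         ≈⟨ +-congʳ e ⟩
          0# - a                            ≈⟨ +-identityˡ _ ⟩
          - a                               ∎)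
        shape (a ∷ b ∷ c) _ e = ⊥-elim (1≉0 (trans (sym (coeff-top (a ∷ b ∷ c)))
          (e (length (a ∷ b ∷ c)) (s≤s (s≤s z≤n)))))

      module _ {k : Pred Carrier ℓ} (kF : IsSubfield k) where
        open Base kF
        open Over kF

        -- A separable element x is purely inseparable over k(xᵖ), hence lies in it.

        separable-descent : ∀ {L x} → IsSubfield L → k ⊆ L → x ^ p ∈ L → x ∈ SeparableOver k → x ∈ L
        separable-descent {L} {x} LF k⊆L xᵖ∈ x∈ =
          let a , c≡a , x≈-a = only-root⇒linear c (proj₂ ann) m′≉0 only in
          L.respects (sym x≈-a) (L.-‿closed
            (All.head (≡.subst (All L) c≡a (proj₁ (Allₚ.∷ʳ⁻ (proj₁ ann))))))
          where
          module L = IsSubfield LF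
          minimal = Base.minimalPolynomial LF (Base.algebraic-mono kF k⊆L (separable⊆algebraic kF x∈))
          c : List Carrier
          c = proj₁ minimal
          i = proj₁ (proj₂ minimal)
          ann = proj₂ (proj₂ minimal)
          simple = separable⇒simple-root kF x∈
          f = proj₁ simple
          f-multiple = Base.minimalPolynomial-divides LF {x} {c} {f} i ann
            (All.map k⊆L (proj₁ (proj₁ (proj₂ simple))) , proj₂ (proj₁ (proj₂ simple)))
          m′≉0 : eval (derivative (c ∷ʳ 1#)) x ≉ 0#
          m′≉0 m′≈0 = proj₂ (proj₂ simple) (trans
            (eval-derivative-multiple LF {f} (proj₁ f-multiple) (c ∷ʳ 1#) x (proj₂ (proj₂ f-multiple)) (proj₂ ann))
            (trans (*-congˡ m′≈0) (zeroʳ _)))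
          -- Followed by 1 this list is Xᵖ - xᵖ, as p = m + 1. The minimal polynomial over L divides
          -- it, and injectivity of the Frobenius map leaves x as the only root.
          b = - (x ^ p) ∷ replicate m 0#
          eval-b : ∀ y → eval (b ∷ʳ 1#) y ≈ y ^ p - x ^ p
          eval-b y = begin
            eval (b ∷ʳ 1#) y              ≈⟨ eval-∷ʳ b 1# y ⟩
            - (x ^ p) + y * eval (replicate m 0#) y + 1# * y ^ length b
              ≈⟨ +-cong (+-congˡ (trans (*-congˡ (zeros m)) (zeroʳ y)))
                   (*-congˡ (reflexive (≡.cong (λ n → y ^ suc n) (length-replicate m)))) ⟩
            - (x ^ p) + 0# + 1# * y ^ p
              ≈⟨ solve 2 (λ a b → :- a :+ con (0 , 0) :+ con (1 , 0) :* b := b :- a) refl (x ^ p) (y ^ p) ⟩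
            y ^ p - x ^ p                 ∎
            where
            zeros : ∀ n → eval (replicate n 0#) y ≈ 0#
            zeros zero    = refl
            zeros (suc n) = trans (+-identityˡ _) (trans (*-congˡ (zeros n)) (zeroʳ y))
          b-multiple = Base.minimalPolynomial-divides LF {x} {c} {b ∷ʳ 1#} i ann
            (Allₚ.∷ʳ⁺ (L.-‿closed xᵖ∈ ∷ Allₚ.replicate⁺ m L.0∈) L.1∈ , trans (eval-b x) (-‿inverseʳ _))
          only : ∀ y → eval (c ∷ʳ 1#) y ≈ 0# → y ≈ x
          only y m≈0 = ^p-injective (x-y≈0⇒x≈y (begin
            y ^ p - x ^ p                       ≈⟨ eval-b y ⟨
            eval (b ∷ʳ 1#) y
              ≈⟨ eval-cong (b ∷ʳ 1#) (proj₁ b-multiple *ᵖ (c ∷ʳ 1#)) (proj₂ (proj₂ b-multiple)) y ⟩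
            eval (proj₁ b-multiple *ᵖ (c ∷ʳ 1#)) y
              ≈⟨ eval-* (proj₁ b-multiple) (c ∷ʳ 1#) y ⟩
            eval (proj₁ b-multiple) y * eval (c ∷ʳ 1#) y
              ≈⟨ trans (*-congˡ m≈0) (zeroʳ _) ⟩
            0#                                  ∎))

        ^∈ : ∀ {L : Pred Carrier ℓ} → IsSubfield L → ∀ n {x} → x ∈ L → x ^ n ∈ L
        ^∈ LF zero    x∈ = IsSubfield.1∈ LF
        ^∈ LF (suc n) x∈ = IsSubfield.*-closed LF x∈ (^∈ LF n x∈)

        span-frobenius : ∀ vs {x} → x ∈ Span k vs → x ^ p ∈ Span k (frobenius vs)
        span-frobenius []       (base x≈0) = base (^p-0 x≈0)
        span-frobenius (v ∷ vs) {x} (step c c∈ y y∈ e) =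
          step (c ^ p) (^∈ kF p c∈) (y ^ p) (span-frobenius vs y∈) (begin
            x ^ p                    ≈⟨ ^-congˡ p e ⟩
            (c * v + y) ^ p          ≈⟨ ^p-+ (c * v) y ⟩
            (c * v) ^ p + y ^ p      ≈⟨ +-congʳ (^-distrib-* c v p) ⟩
            c ^ p * v ^ p + y ^ p    ∎)

        span-frobenius-⊆ : ∀ us vs → All (Span k vs) us → Span k (frobenius us) ⊆ Span k (frobenius vs)
        span-frobenius-⊆ us vs us∈ = span-⊆ (frobenius vs)
          (Allₚ.map⁺ (All.map (span-frobenius vs) us∈))

        -- Otherwise `ws` could be lengthened to an independent list inside the span of `vs` but
        -- longer than `vs`, against Steinitz.
        independent-spans : ∀ vs ws → Independent Zero k ws → All (Span k vs) ws →
                            length vs ℕ.≤ length ws → Span k vs ⊆ Span k ws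
        independent-spans vs ws i ws∈ vs≤ws x∈ = decidable-stable em λ x∉ →
          ℕₚ.<⇒≱ (steinitz vs (_ ∷ ws) (x∉ , i) (x∈ ∷ ws∈)) vs≤ws

        module _ {K : Pred Carrier ℓ} (KF : FiniteField k K) where
          open FiniteField KF
          private module K = IsSubfield subfield

          -- The compositum k Kᵖ: coefficients range over k, not over kᵖ.

          Kᵖ : Pred Carrier ℓ
          Kᵖ = Span k (frobenius basis)

          ^p∈Kᵖ : ∀ {x} → x ∈ K → x ^ p ∈ Kᵖ
          ^p∈Kᵖ x∈ = span-frobenius basis (spans x∈)

          1∈Kᵖ : 1# ∈ Kᵖ
          1∈Kᵖ = span-respects (frobenius basis) (1^≈1 p) (^p∈Kᵖ K.1∈)

          Kᵖ-* : ∀ {x y} → x ∈ Kᵖ → y ∈ Kᵖ → (x * y) ∈ Kᵖ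
          Kᵖ-* {x} {y} x∈ y∈ = span-elim (preimage-additive x V)
            (Allₚ.map⁺ (All.map (λ {f} f∈ c c∈ → resp
              (solve 3 (λ c f x → c :* (f :* x) := x :* (c :* f)) refl c (f ^ p) x)
              (span-scale-k (frobenius basis) c∈ (resp (*-comm x (f ^ p)) (inner f∈)))) basis∈)) y∈
            where
            V = span-additive (frobenius basis)
            resp = λ {x y} → IsAdditive.respects V {x} {y}
            inner : ∀ {f} → f ∈ K → (x * f ^ p) ∈ Kᵖ
            inner {f} f∈ = resp (*-comm (f ^ p) x) (span-elim (preimage-additive (f ^ p) V)
              (Allₚ.map⁺ (All.map (λ {e} e∈ c c∈ → resp
                (trans (*-congˡ (^-distrib-* e f p))
                  (solve 3 (λ c e f → c :* (e :* f) := f :* (c :* e)) refl c (e ^ p) (f ^ p)))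
                (span-scale-k (frobenius basis) c∈ (^p∈Kᵖ (K.*-closed e∈ f∈)))) basis∈)) x∈)

          Kᵖ-subfield : IsSubfield Kᵖ
          Kᵖ-subfield = FiniteAlgebra.finite-subfield (frobenius basis) 1∈Kᵖ Kᵖ-*

          -- Extend `vs` to a basis `ws` of K. The p-th powers of `ws` span k Kᵖ, which contains K,
          -- and there are no more of them than the degree of K; so they are independent, and in
          -- particular those of `vs` are.
          frobenius-independent : K ⊆ Kᵖ → ∀ vs → All K vs → Independent Zero k vs →
                                  Independent Zero k (frobenius vs)
          frobenius-independent K⊆Kᵖ vs vs∈ i =
            independent-++ʳ (frobenius (proj₁ extended))
              (≡.subst (Independent Zero k) (map-++ (_^ p) (proj₁ extended) vs)
                (≡.subst (λ ws → Independent Zero k (frobenius ws)) (proj₂ extended) ws-independent))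
            where
            extended = extract-suffix {Zero} basis i
            ws = extract Zero (basis ++ vs)
            basis⊆ws : All (Span k ws) basis
            basis⊆ws = Allₚ.++⁻ˡ basis (extract-spans Zero-additive (basis ++ vs))
            ws∈K : All K ws
            ws∈K = extract-All (Allₚ.++⁺ basis∈ vs∈)
            us = extract Zero (frobenius ws)
            K⊆us : K ⊆ Span k us
            K⊆us x∈ = span-⊆ us (extract-spans Zero-additive (frobenius ws))
              (span-frobenius-⊆ basis ws basis⊆ws (K⊆Kᵖ x∈))
            ws-independent : Independent Zero k (frobenius ws)
            ws-independent = extract-full Zero (frobenius ws)
              (ℕₚ.≤-trans (ℕₚ.≤-reflexive (length-map (_^ p) ws))
                (steinitz us ws (extract-independent Zero (basis ++ vs)) (All.map K⊆us ws∈K)))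

          -- z is a polynomial g(zᵖ), so it is a simple root of X - g(Xᵖ).

          frobenius⇒separable : K ⊆ Kᵖ → K ⊆ SeparableOver k
          frobenius⇒separable K⊆Kᵖ {z} z∈ =
            let d , i , zᵈ∈ = degree z∈alg
                zs∈ = Base.All-pows subfield K.*-closed K.1∈ z∈ d
                k[z] = simple-subfield d zᵈ∈
                z∈frob = independent-spans (pows z d) (frobenius (pows z d))
                  (frobenius-independent K⊆Kᵖ (pows z d) zs∈ i)
                  (Allₚ.map⁺ (All.map (^∈ k[z] p) (span-members (pows z d))))
                  (ℕₚ.≤-reflexive (≡.sym (length-map (_^ p) (pows z d))))
                  (pows-x∈ d zᵈ∈)
            in jet⇒separable kF z∈alg (jet-cong kF
                 (solve 1 (λ z → z :+ (:- con (1 , 0)) :* z := con (0 , 0)) refl z)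
                 (solve 1 (λ z → con (1 , 0) :+ (con (0 , 0) :* z :+ (:- con (1 , 0)) :* con (0 , 0)) :=
                                 con (1 , 0)) refl z)
                 (jet-+ kF (jet-variable kF)
                   (jet-* kF (jet-const kF (-‿closed 1∈)) (stationary d z∈frob))))
            where
            z∈alg : z ∈ AlgebraicOver k
            z∈alg = finiteField⇒algebraic KF z∈
            stationary-^ : ∀ n → Jet kF z ((z ^ n) ^ p) 0#
            stationary-^ n = jet-cong kF (sym (^p-^ z n)) refl (jet-^ kF n
              (jet-cong kF refl (trans (*-congʳ p≈0) (zeroˡ _)) (jet-variable-^ kF m)))
            stationary : ∀ n {y} → y ∈ Span k (frobenius (pows z n)) → Jet kF z y 0#
            stationary zero    (base y≈0) = jet-cong kF (sym y≈0) refl (jet-const kF 0∈)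
            stationary (suc n) (step c c∈ y y∈ e) = jet-cong kF (sym e)
              (solve 2 (λ c x → con (0 , 0) :* x :+ c :* con (0 , 0) :+ con (0 , 0) := con (0 , 0))
                refl c ((z ^ n) ^ p))
              (jet-+ kF (jet-* kF (jet-const kF c∈) (stationary-^ n)) (stationary n y∈))

        -- Let K = k(x, y). By descent the separable generators x and y lie in the field k Kᵖ, so
        -- leastness gives K ⊆ k Kᵖ, and then all of K is separable.
        frobenius-separable-subfield : IsSubfield (SeparableOver k)
        frobenius-separable-subfield = generated-subfield kF (separable-respects kF)
          (base⊆separable kF) (separable⊆algebraic kF)
          λ KF x∈K y∈K least x∈ y∈ →
            let KᵖF  = Kᵖ-subfield KF
                k⊆Kᵖ = FiniteAlgebra.finite-base⊆ _ (1∈Kᵖ KF) (Kᵖ-* KF)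
            in frobenius⇒separable KF (least KᵖF k⊆Kᵖ
                 (separable-descent KᵖF k⊆Kᵖ (^p∈Kᵖ KF x∈K) x∈)
                 (separable-descent KᵖF k⊆Kᵖ (^p∈Kᵖ KF y∈K) y∈))

  separable-subfield : (∀ a f → NonZero f → ∃[ x ] (eval (a ∷ f) x ≈ 0#)) →
                       ∀ {k} → IsSubfield k → IsSubfield (SeparableOver k)
  separable-subfield closed {k} kF with em {P = HasPrimeCharacteristic}
  ... | yes (suc m , pr , p≈0) = Frobenius.frobenius-separable-subfield pr p≈0 closed kF
  ... | yes (zero  , pr , p≈0) = ⊥-elim (ℕ.≢-nonZero⁻¹ 0 {{prime⇒nonZero pr}} ≡.refl)
  ... | no  char0 = isSubfield-≐
    ((λ x∈ → decidable-stable em λ x∉ → char0 (inseparable⇒hasPrimeCharacteristic kF x∈ x∉)) ,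
     separable⊆algebraic kF)
    (algebraic-subfield kF)

∈⇒≤total : ∀ {n ns} → n ∈ₗ ns → n ℕ.≤ total ns
∈⇒≤total {ns = n ∷ ns} (here ≡.refl) = ℕₚ.m≤m+n n (total ns)
∈⇒≤total {ns = m ∷ ns} (there n∈)    = ℕₚ.≤-trans (∈⇒≤total n∈) (ℕₚ.m≤n+m (total ns) m)

-- Fields in which a prime vanishes

module Characteristics {ℓ : Level} (K : Field ℓ) where
  open Field K
  open Polynomials commutativeRing
  open Mult semiring using (×-homo-+; ×1-homo-*) renaming (_×_ to _·_)
  open import Relation.Binary.Reasoning.Setoid setoid

  multiples≈0 : ∀ {n} q → n · 1# ≈ 0# → (q ℕ.* n) · 1# ≈ 0#
  multiples≈0 {n} q n≈0 = trans (×1-homo-* q n) (trans (*-congˡ n≈0) (zeroʳ _))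

  -- A remainder 0 < r < p with r · 1 = 0 is coprime to p, so a Bézout identity would give 1 = 0.
  prime-characteristic : ∀ {p} → Prime p → p · 1# ≈ 0# → Characteristic p
  prime-characteristic {p} pr p≈0 m = mk⇔ divisible λ { (divides q ≡.refl) → multiples≈0 q p≈0 }
    where
    instance _ = prime⇒nonZero pr
    combination : ∀ {x y} i j → x · 1# ≈ 0# → y · 1# ≈ 0# → 1 ℕ.+ i ℕ.* x ≡ j ℕ.* y → 1# ≈ 0#
    combination {x} {y} i j x≈0 y≈0 e = begin
      1#                           ≈⟨ +-identityʳ 1# ⟨
      1# + 0#                      ≈⟨ +-congˡ (multiples≈0 i x≈0) ⟨
      (1 ℕ.+ i ℕ.* x) · 1#         ≡⟨ ≡.cong (_· 1#) e ⟩
      (j ℕ.* y) · 1#               ≈⟨ multiples≈0 j y≈0 ⟩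
      0#                           ∎
    below : ∀ r → r ℕ.< p → r · 1# ≈ 0# → r ≡ 0
    below zero    _   _   = ≡.refl
    below (suc r) r<p r≈0 with coprime-Bézout (prime⇒coprime pr r<p)
    ... | Bézout.+- i j eq = ⊥-elim (1≉0 (combination j i r≈0 p≈0 eq))
    ... | Bézout.-+ i j eq = ⊥-elim (1≉0 (combination i j p≈0 r≈0 eq))
    divisible : m · 1# ≈ 0# → p ∣ m
    divisible m≈0 = m%n≡0⇒n∣m m p (below (m ℕ.% p) (m%n<n m p) (begin
      (m ℕ.% p) · 1#           ≈⟨ +-identityʳ _ ⟨
      (m ℕ.% p) · 1# + 0#      ≈⟨ +-congˡ (multiples≈0 (m ℕ./ p) p≈0) ⟨
      (m ℕ.% p) · 1# + (m ℕ./ p ℕ.* p) · 1#  ≈⟨ ×-homo-+ 1# (m ℕ.% p) _ ⟨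
      (m ℕ.% p ℕ.+ m ℕ./ p ℕ.* p) · 1#  ≡⟨ ≡.cong (_· 1#) (m≡m%n+[m/n]*n m p) ⟨
      m · 1#                   ≈⟨ m≈0 ⟩
      0#                       ∎))

-- Bases and degrees of finite extensions

module FiniteExtensions {ℓ : Level} (em : ExcludedMiddle ℓ) (Ω : Field ℓ) where
  open Field Ω renaming (inverse to field-inverse)
  open Subfields commutativeRing
  open Extensions em Ω
  open RawMonoidDefs +-rawMonoid using (sum)

  ∩-subfield : ∀ {K L} → IsSubfield K → IsSubfield L → IsSubfield (K ∩ L)
  ∩-subfield KF LF = record
    { respects = λ x≈y (x∈K , x∈L) → K.respects x≈y x∈K , L.respects x≈y x∈L
    ; 0∈       = K.0∈ , L.0∈
    ; 1∈       = K.1∈ , L.1∈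
    ; 1≉0      = 1≉0
    ; +-closed = λ (x∈K , x∈L) (y∈K , y∈L) → K.+-closed x∈K y∈K , L.+-closed x∈L y∈L
    ; -‿closed = λ (x∈K , x∈L) → K.-‿closed x∈K , L.-‿closed x∈L
    ; *-closed = λ (x∈K , x∈L) (y∈K , y∈L) → K.*-closed x∈K y∈K , L.*-closed x∈L y∈L
    ; inverse  = λ { {x} (x∈K , x∈L) x≉0 →
        let y , y∈K , xy≈1 = K.inverse x∈K x≉0
            z , z∈L , xz≈1 = L.inverse x∈L x≉0
        in y , (y∈K , L.respects (unique xz≈1 xy≈1) z∈L) , xy≈1 }
    }
    where
    module K = IsSubfield KF
    module L = IsSubfield LF
    unique : ∀ {x y z} → x * z ≈ 1# → x * y ≈ 1# → z ≈ y
    unique {x} {y} {z} xz≈1 xy≈1 = trans (sym (*-identityʳ z)) (trans (*-congˡ (sym xy≈1))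
      (trans (solve 3 (λ x y z → z :* (x :* y) := x :* z :* y) refl x y z)
        (trans (*-congʳ xz≈1) (*-identityˡ y))))
      where open IntegerRingSolver commutativeRing

  sum→span : ∀ {k n} (b c : Fin n → Carrier) → (∀ i → c i ∈ k) →
             sum (λ i → c i * b i) ∈ Span k (tabulate b)
  sum→span {n = zero}  b c c∈ = base refl
  sum→span {n = suc n} b c c∈ = step (c Fin.zero) (c∈ Fin.zero) _
    (sum→span (λ i → b (Fin.suc i)) (λ i → c (Fin.suc i)) (λ i → c∈ (Fin.suc i))) refl

  span→sum : ∀ {k n} (b : Fin n → Carrier) {x} → x ∈ Span k (tabulate b) →
             Σ[ c ∈ (Fin n → Carrier) ] ((∀ i → c i ∈ k) × x ≈ sum (λ i → c i * b i))
  span→sum {n = zero}  b (base x≈0) = (λ ()) , (λ ()) , x≈0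
  span→sum {n = suc n} b (step c c∈ y y∈ e) with span→sum (λ i → b (Fin.suc i)) y∈
  ... | cs , cs∈ , e′ = (λ { Fin.zero → c ; (Fin.suc i) → cs i }) ,
    (λ { Fin.zero → c∈ ; (Fin.suc i) → cs∈ i }) , trans e (+-congˡ e′)

  lookup-∈ : ∀ {P : Pred Carrier ℓ} {vs} → All P vs → ∀ i → lookup vs i ∈ P
  lookup-∈ (v∈ ∷ vs∈) Fin.zero    = v∈
  lookup-∈ (v∈ ∷ vs∈) (Fin.suc i) = lookup-∈ vs∈ i

  tabulate-∈ : ∀ {P : Pred Carrier ℓ} {n} {b : Fin n → Carrier} → (∀ i → b i ∈ P) → All P (tabulate b)
  tabulate-∈ {n = zero}  b∈ = []
  tabulate-∈ {n = suc n} b∈ = b∈ Fin.zero ∷ tabulate-∈ (λ i → b∈ (Fin.suc i))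

  tabulate-lookup : ∀ (vs : List Carrier) → tabulate (lookup vs) ≡ vs
  tabulate-lookup []       = ≡.refl
  tabulate-lookup (v ∷ vs) = ≡.cong (v ∷_) (tabulate-lookup vs)

  module _ {k : Pred Carrier ℓ} (kF : IsSubfield k) where
    open Over kF

    basis⇒independent : ∀ {n} (b : Fin n → Carrier) →
      (∀ (c : Fin n → Carrier) → (∀ i → c i ∈ k) → sum (λ i → c i * b i) ≈ 0# → ∀ i → c i ≈ 0#) →
      Independent Zero k (tabulate b)
    basis⇒independent {zero}  b ind = tt
    basis⇒independent {suc n} b ind =
      (λ b₀∈ → let cs , cs∈ , e = span→sum (λ i → b (Fin.suc i)) (span-neg _ b₀∈) in
        1≉0 (ind (λ { Fin.zero → 1# ; (Fin.suc i) → cs i }) (λ { Fin.zero → 1∈ ; (Fin.suc i) → cs∈ i })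
          (trans (+-cong (*-identityˡ _) (sym e)) (-‿inverseʳ _)) Fin.zero)) ,
      basis⇒independent (λ i → b (Fin.suc i)) λ c c∈ e i →
        ind (λ { Fin.zero → 0# ; (Fin.suc i) → c i }) (λ { Fin.zero → 0∈ ; (Fin.suc i) → c∈ i })
          (trans (+-cong (zeroˡ _) e) (+-identityˡ 0#)) (Fin.suc i)

    independent⇒basis : ∀ {n} (b : Fin n → Carrier) → Independent Zero k (tabulate b) →
      ∀ (c : Fin n → Carrier) → (∀ i → c i ∈ k) → sum (λ i → c i * b i) ≈ 0# → ∀ i → c i ≈ 0#
    independent⇒basis {suc n} b (b₀∉ , ind) c c∈ e = λ
      { Fin.zero    → c₀≈0
      ; (Fin.suc i) → independent⇒basis (λ i → b (Fin.suc i)) ind (λ i → c (Fin.suc i))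
          (λ i → c∈ (Fin.suc i))
          (trans (sym (trans (+-congʳ (trans (*-congʳ c₀≈0) (zeroˡ _))) (+-identityˡ _))) e) i
      }
      where
      rest = sum→span (λ i → b (Fin.suc i)) (λ i → c (Fin.suc i)) (λ i → c∈ (Fin.suc i))
      V = span-additive (tabulate (λ i → b (Fin.suc i)))
      c₀≈0 : c Fin.zero ≈ 0#
      c₀≈0 = decidable-stable em λ c₀≉0 → b₀∉ (unscale V (span-scale-k _) (c∈ Fin.zero) c₀≉0
        (subtract V (span-scale-k _) (IsAdditive.respects V (sym e) (IsAdditive.0∈ V)) rest))

    finiteField⇒isFiniteExtension : ∀ {K} → FiniteField k K → IsFiniteExtension k K
    finiteField⇒isFiniteExtension KF = length basis ,
      record { base = kF ; top = subfield ; base⊆top = base⊆ } ,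
      lookup basis , record
        { members     = lookup-∈ basis∈
        ; spanning    = λ x∈ → span→sum (lookup basis)
            (≡.subst (λ vs → Span k vs _) (≡.sym (tabulate-lookup basis)) (spans x∈))
        ; independent = independent⇒basis (lookup basis)
            (≡.subst (Independent Zero k) (≡.sym (tabulate-lookup basis)) independent)
        }
      where open FiniteField KF

    -- The field K is part of the data, which puts this type one universe above the reach of `em`. A
    -- maximal degree is therefore not selected by excluded middle; `bounded⇒finite` climbs to it.
    FiniteField⊆ : ℕ → Pred Carrier ℓ → Set (Level.suc ℓ)
    FiniteField⊆ n V = Σ[ K ∈ Pred Carrier ℓ ] Σ[ KF ∈ FiniteField k K ]
                       (K ⊆ V × length (FiniteField.basis KF) ≡ n)

    bounded⇒finite : ∀ {V} → IsSubfield V → k ⊆ V → V ⊆ AlgebraicOver k →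
      ∀ N → (∀ {n} → FiniteField⊆ n V → n ℕ.≤ N) → IsFiniteExtension k V
    bounded⇒finite {V} VF k⊆V V⊆ N bound =
      enlarge N (Base.finiteField-base kF) k⊆V (ℕₚ.m≤m+n N _)
      where
      -- `m` bounds the enlargements still possible: each lengthens the basis by at least one, and
      -- when m = 0 the length has already reached N.
      enlarge : ∀ m {K} (KF : FiniteField k K) → K ⊆ V →
                N ℕ.≤ m ℕ.+ length (FiniteField.basis KF) → IsFiniteExtension k V
      enlarge m {K} KF K⊆V N≤ with em {P = ∃[ x ] (x ∈ V × x ∉ K)}
      ... | no  none = finiteField⇒isFiniteExtension (record
        { subfield    = VF
        ; base⊆       = k⊆V
        ; basis       = basis
        ; basis∈      = All.map K⊆V basis∈
        ; independent = independent
        ; spans       = λ x∈ → spans (decidable-stable em λ x∉ → none (_ , x∈ , x∉))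
        })
        where open FiniteField KF
      ... | yes (x , x∈V , x∉K) = larger m N≤
        where
        open FiniteField KF
        open Adjunction (adjoin kF KF (V⊆ x∈V)) renaming (field′ to K′; finiteField to K′F)
        K′⊆V : K′ ⊆ V
        K′⊆V = least VF K⊆V x∈V
        span⊆K : Span k basis ⊆ K
        span⊆K = span-elim (Over.additive subfield)
          (All.map (λ v∈ c c∈ → IsSubfield.*-closed subfield (base⊆ c∈) v∈) basis∈)
        grows : length basis ℕ.< length (FiniteField.basis K′F)
        grows = steinitz (FiniteField.basis K′F) (x ∷ basis)
          ((λ x∈ → x∉K (span⊆K x∈)) , independent)
          (All.map (FiniteField.spans K′F) (member ∷ All.map extends basis∈))
        larger : ∀ m → N ℕ.≤ m ℕ.+ length basis → IsFiniteExtension k V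
        larger zero    N≤ = ⊥-elim (ℕₚ.<⇒≱ grows (ℕₚ.≤-trans (bound (K′ , K′F , K′⊆V , ≡.refl)) N≤))
        larger (suc m) N≤ = enlarge m K′F K′⊆V (ℕₚ.≤-trans N≤
          (ℕₚ.≤-trans (ℕₚ.≤-reflexive (≡.sym (ℕₚ.+-suc m (length basis)))) (ℕₚ.+-monoʳ-≤ m grows)))

    span-products : ∀ {gs} → All (λ g → All (λ h → (g * h) ∈ Span k gs) gs) gs →
                    ∀ {x y} → x ∈ Span k gs → y ∈ Span k gs → (x * y) ∈ Span k gs
    span-products {gs} gs∈ {x} {y} x∈ y∈ = resp (*-comm y x) (span-elim (preimage-additive y V)
      (All.map (λ {g} gh∈ c c∈ → resp (solve 3 (λ c g y → c :* (g :* y) := y :* (c :* g)) refl c g y)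
        (span-scale-k gs c∈ (span-elim (preimage-additive g V)
          (All.map (λ {h} gh∈ c c∈ → resp (solve 3 (λ c g h → c :* (g :* h) := g :* (c :* h)) refl c g h)
            (span-scale-k gs c∈ gh∈)) gh∈) y∈))) gs∈) x∈)
      where
      open IntegerRingSolver commutativeRing
      V = span-additive gs
      resp = λ {x y} → IsAdditive.respects V {x} {y}

    -- The span of `es` is a field of degree `length es` over k, and sieving the k-basis of E over
    -- it leaves a basis `fs`. By the tower law the products form a second k-basis of E, so n is the
    -- product of the two lengths.
    degree-divides : ∀ {E n} → HasDegree k E n → ∀ es → All E es → Independent Zero k es →
      1# ∈ Span k es → All (λ e → All (λ e′ → (e * e′) ∈ Span k es) es) es → length es ∣ n
    degree-divides {E} {n} (ext , b , isBasis) es es∈ i 1∈es es-products =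
      divides (length fs) (≡.sym (≡.trans (≡.sym (length-tensor es fs))
        (≡.trans (ℕₚ.≤-antisym
          (steinitz bs (tensor es fs) (tensor-independent kF KF k⊆K (span-members es) i fs
              (K.extract-independent Zero bs))
            (All.map E⊆bs (All-tensor (All.map (λ f∈ → All.map (λ e∈ → E.*-closed e∈ f∈) es∈) fs∈))))
          (steinitz (tensor es fs) bs bs-independent
            (All.map (span-tensor (λ x∈ → x∈) fs) (K.extract-spans Zero-additive bs))))
          (length-tabulate b))))
      where
      module E = IsSubfield (IsExtension.top ext)
      bs = tabulate b
      bs∈ = tabulate-∈ {E} (IsBasis.members isBasis)
      bs-independent = basis⇒independent b (IsBasis.independent isBasis)
      E⊆bs : E ⊆ Span k bs
      E⊆bs x∈ with IsBasis.spanning isBasis x∈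
      ... | c , c∈ , e = span-respects bs (sym e) (sum→span b c c∈)
      KF : IsSubfield (Span k es)
      KF = Base.FiniteAlgebra.finite-subfield kF es 1∈es (span-products es-products)
      k⊆K : k ⊆ Span k es
      k⊆K = Base.FiniteAlgebra.finite-base⊆ kF es 1∈es (span-products es-products)
      module K = Over KF
      fs = K.extract Zero bs
      fs∈ : All E fs
      fs∈ = K.extract-All bs∈

  range-subfield : ∀ (K : Field ℓ) {f} →
    RingHomomorphism {R = Field.commutativeRing K} {commutativeRing} f →
    IsSubfield (Range {R = Field.commutativeRing K} {commutativeRing} f)
  range-subfield K {f} hom = record
    { respects = λ x≈y (a , e) → a , trans e x≈y
    ; 0∈       = K.0# , 0#-homo
    ; 1∈       = K.1# , 1#-homo
    ; 1≉0      = 1≉0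
    ; +-closed = λ (a , e) (b , d) → a K.+ b , trans (+-homo a b) (+-cong e d)
    ; -‿closed = λ (a , e) → K.- a , trans (-‿homo a) (-‿cong e)
    ; *-closed = λ (a , e) (b , d) → a K.* b , trans (*-homo a b) (*-cong e d)
    ; inverse  = λ (a , e) x≉0 →
        let b , ab≈1 = K.inverse a λ a≈0 → x≉0 (trans (sym e) (trans (⟦⟧-cong a≈0) 0#-homo))
        in f b , (b , refl) , trans (*-congʳ (sym e)) (trans (sym (*-homo a b)) (trans (⟦⟧-cong ab≈1) 1#-homo))
    }
    where
    module K = Field K
    open IsRingHomomorphism hom

  hom-≉0 : ∀ (K : Field ℓ) {f} → RingHomomorphism {R = Field.commutativeRing K} {commutativeRing} f →
           ∀ {a} → Field._≉_ K a (Field.0# K) → f a ≉ 0#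
  hom-≉0 K {f} hom {a} a≉0 fa≈0 = 1≉0 (trans (sym 1#-homo) (trans (⟦⟧-cong (K.sym ab≈1))
    (trans (*-homo a b) (trans (*-congʳ fa≈0) (zeroˡ _)))))
    where
    module K = Field K
    open IsRingHomomorphism hom
    b = proj₁ (K.inverse a a≉0)
    ab≈1 = proj₂ (K.inverse a a≉0)

  hom-injective : ∀ (K : Field ℓ) {f} → RingHomomorphism {R = Field.commutativeRing K} {commutativeRing} f →
                  ∀ {a b} → f a ≈ f b → Field._≈_ K a b
  hom-injective K {f} hom {a} {b} fa≈fb = decidable-stable em λ a≉b →
    hom-≉0 K hom (λ a-b≈0 → a≉b (LinearAlgebra.x-y≈0⇒x≈y em K a-b≈0))
      (trans (+-homo a (K.- b)) (trans (+-cong fa≈fb (-‿homo b)) (-‿inverseʳ _)))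
    where
    module K = Field K
    open IsRingHomomorphism hom

-- The rational function field inside its algebraic closure

module ClosureOfFunctionField {ℓ : Level} (em : ExcludedMiddle ℓ) (K : Field ℓ)
  (F : RationalFunctionField K) (C : AlgebraicClosure (RationalFunctionField.k⟨t⟩ F)) where
  private
    module K = Field K
    module F = RationalFunctionField F
    module C = AlgebraicClosure C
    module embed = IsRingHomomorphism C.embed-hom
  open C using (Carrier; _≈_; _≉_; _+_; _*_; 0#; 1#; refl; sym; trans; +-cong; *-cong; +-congˡ; *-congˡ; *-comm)
  open Polynomials C.commutativeRing
  open Subfields C.commutativeRing
  open Extensions em C.closure
  open RationalFunctionFields em C.closure
  open FiniteExtensions em C.closure using (range-subfield; hom-≉0)

  constant : K.Carrier → Carrier
  constant a = C.embed (F.embed a)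

  constant-hom : RingHomomorphism {R = K.commutativeRing} {C.commutativeRing} constant
  constant-hom = isRingHomomorphism C.trans F.embed-hom C.embed-hom

  constants : Pred Carrier ℓ
  constants = Range {R = K.commutativeRing} {C.commutativeRing} constant

  tᶜ : Carrier
  tᶜ = C.embed F.t

  constants-subfield : IsSubfield constants
  constants-subfield = range-subfield K constant-hom

  baseField-subfield : IsSubfield C.baseField
  baseField-subfield = range-subfield F.k⟨t⟩ C.embed-hom

  embed-evalₜ : ∀ P → C.embed (F.evalₜ P) ≈ eval (map constant P) tᶜ
  embed-evalₜ []      = embed.0#-homo
  embed-evalₜ (a ∷ P) = trans (embed.+-homo _ _)
    (+-congˡ (trans (embed.*-homo _ _) (*-congˡ (embed-evalₜ P))))

  embed-evalₜ≉0 : ∀ P → Polynomials.NonZero K.commutativeRing P → C.embed (F.evalₜ P) ≉ 0#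
  embed-evalₜ≉0 P nz = hom-≉0 F.k⟨t⟩ C.embed-hom (F.transcendental P nz)

  constants-∈ : ∀ P → All constants (map constant P)
  constants-∈ []      = []
  constants-∈ (a ∷ P) = (a , refl) ∷ constants-∈ P

  embed-evalₜ∈ : ∀ P {n} → length P ℕ.≤ n → C.embed (F.evalₜ P) ∈ Degree< constants tᶜ n
  embed-evalₜ∈ P {n} P≤n = Over.span-respects constants-subfield (pows tᶜ n)
    (sym (embed-evalₜ P))
    (Base.evalSpan constants-subfield (constants-∈ P)
      (ℕₚ.≤-trans (ℕₚ.≤-reflexive (length-map constant P)) P≤n))

  lift-constants : ∀ {p} → All constants p → NonZero p →
         ∃[ P ] (Polynomials.NonZero K.commutativeRing P × C.embed (F.evalₜ P) ≈ eval p tᶜ)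
  lift-constants p∈ nz = let P , e , nz′ = go p∈ in P , nz′ nz , e
    where
    go : ∀ {p} → All constants p → ∃[ P ] (C.embed (F.evalₜ P) ≈ eval p tᶜ ×
           (NonZero p → Polynomials.NonZero K.commutativeRing P))
    go []               = [] , embed.0#-homo , λ ()
    go ((a , e) ∷ p∈) with go p∈
    ... | P , e′ , nz = a ∷ P ,
      trans (embed.+-homo _ _) (+-cong e (trans (embed.*-homo _ _) (*-congˡ e′))) , λ
        { (here a≉0)  → here λ a≈0 → a≉0 (trans (sym e)
            (trans (IsRingHomomorphism.⟦⟧-cong constant-hom a≈0) (IsRingHomomorphism.0#-homo constant-hom)))
        ; (there nz′) → there (nz nz′)
        }

  isRationalFunctionField : IsRationalFunctionField constants tᶜ C.baseField
  isRationalFunctionField = record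
    { constants      = constants-subfield
    ; functions      = baseField-subfield
    ; constants⊆     = λ (a , e) → F.embed a , e
    ; t∈             = F.t , refl
    ; transcendental = λ n → decidable-stable em λ ¬i →
        let p , nz , p∈ , e = Base.dependent⇒algebraic constants-subfield n ¬i
            P , nz′ , e′    = lift-constants p∈ nz
        in embed-evalₜ≉0 P nz′ (trans e′ e)
    ; fraction       = λ (x , e) →
        let P , Q , nz , xQ≈P = F.generated x
            n                 = length P ℕ.+ length Q
        in C.embed (F.evalₜ Q) , n , embed-evalₜ≉0 Q nz , embed-evalₜ∈ Q (ℕₚ.m≤n+m _ (length P)) ,
           Over.span-respects constants-subfield (pows tᶜ n)
             (trans (embed.⟦⟧-cong (F.sym xQ≈P)) (trans (embed.*-homo _ _)
               (trans (*-cong e refl) (*-comm _ _))))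
             (embed-evalₜ∈ P (ℕₚ.m≤m+n _ (length Q)))
    }

-- Łoś's theorem for spans, independence and polynomials

module Łoś {ℓ : Level} (em : ExcludedMiddle ℓ) {S : Set ℓ} (D : Ultrafilter S) (Ω : S → Field ℓ) where
  open Ultrafilter D
  module Ω s = Field (Ω s)
  module Subfieldsₛ s = Subfields (Ω.commutativeRing s)
  module IsSubfieldₛ {s} = Subfields.IsSubfield {R = Ω.commutativeRing s}
  module Polynomialsₛ s = Polynomials (Ω.commutativeRing s)
  module Extensionsₛ s = Extensions em (Ω s)

  Spanₛ : ∀ s → Pred (Ω.Carrier s) ℓ → List (Ω.Carrier s) → Pred (Ω.Carrier s) ℓ
  Spanₛ s = Extensionsₛ.Span s

  Independentₛ : ∀ s → Pred (Ω.Carrier s) ℓ → List (Ω.Carrier s) → Set ℓ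
  Independentₛ s = Extensionsₛ.Independent s (Extensionsₛ.Zero s)

  infix 4 _⊢_≈_

  _⊢_≈_ : ∀ s → Ω.Carrier s → Ω.Carrier s → Set ℓ
  _⊢_≈_ = Ω._≈_

  both : ∀ {A B C : Pred S ℓ} → A ∈ Large → B ∈ Large → (∀ s → A s → B s → C s) → C ∈ Large
  both A∈ B∈ f = upward (λ {s} (a , b) → f s a b) (∩-closed A∈ B∈)

  -- Maximality of the ultrafilter: what does not hold almost everywhere fails almost everywhere.
  -- This carries negations, and hence independence, down to the index s.
  complement : ∀ {A : Pred S ℓ} → ¬ (A ∈ Large) → (λ s → ¬ A s) ∈ Large
  complement {A} A∉ with ultra A
  ... | inj₁ A∈ = ⊥-elim (A∉ A∈)
  ... | inj₂ A∈ = A∈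

  -- Inverses are chosen componentwise. Where a component is zero the default value 0 is taken,
  -- which affects only a set outside the ultrafilter.
  ultrafield : Field ℓ
  ultrafield = record
    { commutativeRing = Ultraproduct D Ω.commutativeRing
    ; 1≉0             = proper Ω.1≉0
    ; inverse         = λ x x≉0 → (λ s → invert s (x s) em) ,
        upward (λ {s} xs≉0 → inverted s (x s) em xs≉0) (complement x≉0)
    }
    where
    invert : ∀ s x → Dec (s ⊢ x ≈ Ω.0# s) → Ω.Carrier s
    invert s x (yes _)  = Ω.0# s
    invert s x (no x≉0) = proj₁ (Ω.inverse s x x≉0)
    inverted : ∀ s x (x≈0? : Dec (s ⊢ x ≈ Ω.0# s)) → ¬ (s ⊢ x ≈ Ω.0# s) →
               s ⊢ (Ω._*_ s x (invert s x x≈0?)) ≈ Ω.1# s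
    inverted s x (yes x≈0) x≉0 = ⊥-elim (x≉0 x≈0)
    inverted s x (no x≉0)  _   = proj₂ (Ω.inverse s x x≉0)

  open Field ultrafield using (Carrier; _≈_; _≉_; _+_; _*_; 0#; 1#)
  open Extensions em ultrafield
  open Subfields (Field.commutativeRing ultrafield)
  open Polynomials (Field.commutativeRing ultrafield)

  at : ∀ s → List Carrier → List (Ω.Carrier s)
  at s = map (λ x → x s)

  internal : (∀ s → Pred (Ω.Carrier s) ℓ) → Pred Carrier ℓ
  internal = InternalSubset D Ω.commutativeRing

  module _ {A : ∀ s → Pred (Ω.Carrier s) ℓ} where

    All-at : ∀ {vs} → All (internal A) vs → ∀ᴰ[ s ] All (A s) (at s vs)
    All-at []         = whole λ s → []
    All-at (v∈ ∷ vs∈) = both v∈ (All-at vs∈) λ s → _∷_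

    span-at : ∀ {vs x} → x ∈ Span (internal A) vs → ∀ᴰ[ s ] (x s ∈ Spanₛ s (A s) (at s vs))
    span-at (base x≈0)        = upward Extensionsₛ.base x≈0
    span-at (step c c∈ y y∈ e) = both (∩-closed c∈ e) (span-at y∈) λ s (c∈ , e) y∈ →
      Extensionsₛ.step (c s) c∈ (y s) y∈ e

    -- The existential half: coefficients found at the individual s are assembled into elements of
    -- the ultraproduct. Where membership fails they are set to 0, which does not matter almost
    -- everywhere.
    span-at⁻ : ∀ vs {x} → ∀ᴰ[ s ] (x s ∈ Spanₛ s (A s) (at s vs)) → x ∈ Span (internal A) vs
    span-at⁻ []       x∈ = base (upward (λ { (Extensionsₛ.base x≈0) → x≈0 }) x∈)
    span-at⁻ (v ∷ vs) {x} x∈ = step (λ s → proj₁ (split s em))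
      (upward (λ {s} x∈ → proj₁ (split-spec s em x∈)) x∈) (λ s → proj₂ (split s em))
      (span-at⁻ vs (upward (λ {s} x∈ → proj₁ (proj₂ (split-spec s em x∈))) x∈))
      (upward (λ {s} x∈ → proj₂ (proj₂ (split-spec s em x∈))) x∈)
      where
      Member : S → Set ℓ
      Member s = x s ∈ Spanₛ s (A s) (at s (v ∷ vs))
      split : ∀ s → Dec (Member s) → Ω.Carrier s × Ω.Carrier s
      split s (yes (Extensionsₛ.step c _ y _ _)) = c , y
      split s (no  _)                = Ω.0# s , Ω.0# s
      split-spec : ∀ s (x∈? : Dec (Member s)) → Member s →
        proj₁ (split s x∈?) ∈ A s ×
        proj₂ (split s x∈?) ∈ Spanₛ s (A s) (at s vs) ×
        s ⊢ x s ≈ Ω._+_ s (Ω._*_ s (proj₁ (split s x∈?)) (v s)) (proj₂ (split s x∈?))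
      split-spec s (yes (Extensionsₛ.step c c∈ y y∈ e)) _  = c∈ , y∈ , e
      split-spec s (no  x∉)                 x∈ = ⊥-elim (x∉ x∈)

    independent-at : ∀ vs → Independent Zero (internal A) vs →
                     ∀ᴰ[ s ] Independentₛ s (A s) (at s vs)
    independent-at []       _        = whole λ s → tt
    independent-at (v ∷ vs) (v∉ , i) = 
      both (complement λ v∈ → v∉ (span-at⁻ vs v∈)) (independent-at vs i) λ s → _,_

    internal-subfield : ∀ᴰ[ s ] Subfieldsₛ.IsSubfield s (A s) → IsSubfield (internal A)
    internal-subfield AF = record
      { respects = λ x≈y x∈ → both (∩-closed AF x≈y) x∈ λ s (AF , x≈y) → IsSubfieldₛ.respects AF x≈y
      ; 0∈       = upward (λ {s} AF → IsSubfieldₛ.0∈ AF) AF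
      ; 1∈       = upward (λ {s} AF → IsSubfieldₛ.1∈ AF) AF
      ; 1≉0      = Field.1≉0 ultrafield
      ; +-closed = λ x∈ y∈ → both (∩-closed AF x∈) y∈ λ s (AF , x∈) → IsSubfieldₛ.+-closed AF x∈
      ; -‿closed = λ x∈ → both AF x∈ λ s AF → IsSubfieldₛ.-‿closed AF
      ; *-closed = λ x∈ y∈ → both (∩-closed AF x∈) y∈ λ s (AF , x∈) → IsSubfieldₛ.*-closed AF x∈
      ; inverse  = λ {x} x∈ x≉0 →
          let xs⁻¹ = both (∩-closed AF x∈) (complement x≉0) λ s (AF , x∈) → IsSubfieldₛ.inverse AF x∈
          in (λ s → pick s (x s) em) ,
             upward (λ {s} y → proj₁ (picked s (x s) em y)) xs⁻¹ ,
             upward (λ {s} y → proj₂ (picked s (x s) em y)) xs⁻¹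
      }
      where
      Invertible : ∀ s → Ω.Carrier s → Set ℓ
      Invertible s x = ∃[ y ] (y ∈ A s × s ⊢ Ω._*_ s x y ≈ Ω.1# s)
      pick : ∀ s x → Dec (Invertible s x) → Ω.Carrier s
      pick s x (yes (y , _)) = y
      pick s x (no  _)       = Ω.0# s
      picked : ∀ s x (y? : Dec (Invertible s x)) → Invertible s x →
               pick s x y? ∈ A s × s ⊢ Ω._*_ s x (pick s x y?) ≈ Ω.1# s
      picked s x (yes (y , y∈ , e)) _ = y∈ , e
      picked s x (no  none)         y = ⊥-elim (none y)

  ^-at : ∀ s x n → (x ^ n) s ≡ Extensionsₛ._^_ s (x s) n
  ^-at s x zero    = ≡.refl
  ^-at s x (suc n) = ≡.cong (Ω._*_ s (x s)) (^-at s x n)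

  pows-at : ∀ s x n → at s (pows x n) ≡ Extensionsₛ.pows s (x s) n
  pows-at s x zero    = ≡.refl
  pows-at s x (suc n) = ≡.cong₂ _∷_ (^-at s x n) (pows-at s x n)

  tensor-at : ∀ s es fs → at s (tensor es fs) ≡ Extensionsₛ.tensor s (at s es) (at s fs)
  tensor-at s es []       = ≡.refl
  tensor-at s es (f ∷ fs) = ≡.trans (map-++ (λ x → x s) (map (_* f) es) (tensor es fs))
    (≡.cong₂ _++_ (≡.trans (≡.sym (map-∘ es)) (map-∘ es)) (tensor-at s es fs))

  eval-at : ∀ s p x → eval p x s ≡ Polynomialsₛ.eval s (at s p) (x s)
  eval-at s []      x = ≡.refl
  eval-at s (a ∷ p) x = ≡.cong (λ y → Ω._+_ s (a s) (Ω._*_ s (x s) y)) (eval-at s p x)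

  +ᵖ-at : ∀ s p q → at s (p +ᵖ q) ≡ Polynomialsₛ._+ᵖ_ s (at s p) (at s q)
  +ᵖ-at s []      q       = ≡.refl
  +ᵖ-at s (a ∷ p) []      = ≡.refl
  +ᵖ-at s (a ∷ p) (b ∷ q) = ≡.cong (_ ∷_) (+ᵖ-at s p q)

  derivative-at : ∀ s p → at s (derivative p) ≡ Polynomialsₛ.derivative s (at s p)
  derivative-at s []      = ≡.refl
  derivative-at s (a ∷ p) = ≡.trans (+ᵖ-at s p (0# ∷ derivative p))
    (≡.cong (λ q → Polynomialsₛ._+ᵖ_ s (at s p) (Ω.0# s ∷ q)) (derivative-at s p))

  nonZero-at : ∀ {p} → NonZero p → ∀ᴰ[ s ] Polynomialsₛ.NonZero s (at s p)
  nonZero-at (here a≉0) = upward here (complement a≉0)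
  nonZero-at (there nz) = upward there (nonZero-at nz)

  -- Roots are chosen at each s. Algebraic closedness of the ultraproduct is what the Frobenius
  -- argument for 𝔏sep requires.
  ultrafield-closed :
    (∀ s a p → Polynomialsₛ.NonZero s p → ∃[ x ] s ⊢ Polynomialsₛ.eval s (a ∷ p) x ≈ Ω.0# s) →
    ∀ a p → NonZero p → ∃[ x ] (eval (a ∷ p) x ≈ 0#)
  ultrafield-closed closed a p nz = (λ s → root s em) ,
    upward (λ {s} nz → ≡.subst (λ y → s ⊢ y ≈ Ω.0# s) (≡.sym (eval-at s (a ∷ p) (λ s → root s em)))
      (is-root s em nz)) (nonZero-at nz)
    where
    root : ∀ s → Dec (Polynomialsₛ.NonZero s (at s p)) → Ω.Carrier s
    root s (yes nz) = proj₁ (closed s (a s) (at s p) nz)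
    root s (no  _)  = Ω.0# s
    is-root : ∀ s (nz? : Dec (Polynomialsₛ.NonZero s (at s p))) → Polynomialsₛ.NonZero s (at s p) →
              s ⊢ (Polynomialsₛ.eval s (at s (a ∷ p)) (root s nz?)) ≈ Ω.0# s
    is-root s (yes nz) _  = proj₂ (closed s (a s) (at s p) nz)
    is-root s (no ¬nz) nz = ⊥-elim (¬nz nz)

-- The field 𝔎(t) inside the ultraproduct, and linear disjointness

module AlgebraicParts {ℓ : Level} (em : ExcludedMiddle ℓ) {S : Set ℓ} (D : Ultrafilter S)
  (𝔽 : S → Field ℓ) (𝔉 : ∀ s → RationalFunctionField (𝔽 s))
  (𝔉ᵃˡᵍ : ∀ s → AlgebraicClosure (RationalFunctionField.k⟨t⟩ (𝔉 s))) where
  private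
    module 𝔽 s = Field (𝔽 s)
    module 𝔉 s = RationalFunctionField (𝔉 s)
    module 𝔉ᵃˡᵍ s = AlgebraicClosure (𝔉ᵃˡᵍ s)
    module C s = ClosureOfFunctionField em (𝔽 s) (𝔉 s) (𝔉ᵃˡᵍ s)
    module embed s = IsRingHomomorphism (𝔉ᵃˡᵍ.embed-hom s)
    module RFₛ s = RationalFunctionFields em (𝔉ᵃˡᵍ.closure s)
  open Functions D 𝔽 𝔉 𝔉ᵃˡᵍ
  open Ultrafilter D
  open Łoś em D 𝔉ᵃˡᵍ.closure
  open Field ultrafield 
    using (Carrier; _≈_; _*_; 0#; 1#; refl; sym; trans; *-congˡ; *-identityʳ)
  open Subfields 𝒰ᵃˡᵍ
  open Polynomials 𝒰ᵃˡᵍ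
  open Extensions em ultrafield
  open RationalFunctionFields em ultrafield
  open FiniteExtensions em ultrafield
  open Separability em ultrafield
  open IntegerRingSolver 𝒰ᵃˡᵍ

  𝔨 : Pred Carrier ℓ
  𝔨 = internal C.constants

  𝔱 : Carrier
  𝔱 s = C.tᶜ s

  𝔨-subfield : IsSubfield 𝔨
  𝔨-subfield = internal-subfield {C.constants} (whole C.constants-subfield)

  -- This is 𝒰(𝔽) inside the ultraproduct of the closures. It contains 𝐅, but its elements may have
  -- degrees that are unbounded in s.
  internal-base : Pred Carrier ℓ
  internal-base = internal 𝔉ᵃˡᵍ.baseField

  internal-base-subfield : IsSubfield internal-base
  internal-base-subfield = internal-subfield (whole C.baseField-subfield)

  open Degrees 𝔨-subfield 𝔱

  T⊆internal-base : ∀ n → T n ⊆ internal-base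
  T⊆internal-base n = span-elim (Over.additive internal-base-subfield)
    (All.map (λ v∈ c c∈ → *-closed (upward (λ {s} → IsRFₛ.constants⊆ s) c∈) v∈)
      (Base.All-pows internal-base-subfield *-closed 1∈ (whole λ s → IsRFₛ.t∈ s) n))
    where
    open IsSubfield internal-base-subfield
    module IsRFₛ s = RFₛ.IsRationalFunctionField s (C.isRationalFunctionField s)

  Fractions⊆internal-base : Fractions ⊆ internal-base
  Fractions⊆internal-base (g , n , g≉0 , g∈ , gx∈) =
    Over.unscale internal-base-subfield additive *-closed (T⊆internal-base n g∈) g≉0 (T⊆internal-base n gx∈)
    where open Over internal-base-subfield

  embed-polynomial : Poly 𝔎 → Carrier
  embed-polynomial P = 𝒰-embed (polynomialEmbedding P)

  embed-polynomial∈ : ∀ P {n} → length P ℕ.≤ n → embed-polynomial P ∈ T n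
  embed-polynomial∈ P {n} P≤n = span-at⁻ (pows 𝔱 n) (whole λ s →
    ≡.subst (λ vs → embed-polynomial P s ∈ Spanₛ s (C.constants s) vs) (≡.sym (pows-at s 𝔱 n))
      (C.embed-evalₜ∈ s (map (λ a → a s) P) (ℕₚ.≤-trans (ℕₚ.≤-reflexive (length-map _ P)) P≤n)))

  𝔎-nonZero-at : ∀ {Q} → Polynomials.NonZero 𝔎 Q →
                 ∀ᴰ[ s ] Polynomials.NonZero (𝔽.commutativeRing s) (map (λ a → a s) Q)
  𝔎-nonZero-at (here a≉0) = upward here (complement a≉0)
  𝔎-nonZero-at (there nz) = upward there (𝔎-nonZero-at nz)

  𝐅⊆Fractions : 𝐅 ⊆ Fractions
  𝐅⊆Fractions {x} (y , (P , Q , nz , yQ≈P) , y≈x) =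
    embed-polynomial Q , length P ℕ.+ length Q ,
    (λ Q≈0 → proper (λ s (Q≈0 , nz) → C.embed-evalₜ≉0 s (map (λ a → a s) Q) nz Q≈0)
      (∩-closed Q≈0 (𝔎-nonZero-at nz))) ,
    embed-polynomial∈ Q (ℕₚ.m≤n+m _ (length P)) ,
    T-respects (length P ℕ.+ length Q)
      (both yQ≈P y≈x λ s yQ≈P y≈x → Ω.trans s (embed.⟦⟧-cong s (𝔉.sym s yQ≈P))
        (Ω.trans s (embed.*-homo s _ _) (Ω.trans s (Ω.*-congʳ s y≈x) (Ω.*-comm s _ _))))
      (embed-polynomial∈ P (ℕₚ.m≤m+n _ (length Q)))

  choose-constant : ∀ {a} → a ∈ 𝔨 → ∃[ b ] (λ s → C.constant s (b s)) ≈ a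
  choose-constant {a} a∈ = (λ s → pick s em) , upward (λ {s} → picked s em) a∈
    where
    pick : ∀ s → Dec (a s ∈ C.constants s) → 𝔽.Carrier s
    pick s (yes (b , _)) = b
    pick s (no  _)       = 𝔽.0# s
    picked : ∀ s (b? : Dec (a s ∈ C.constants s)) → a s ∈ C.constants s →
             s ⊢ C.constant s (pick s b?) ≈ a s
    picked s (yes (b , e)) _ = e
    picked s (no  a∉)      a∈ = ⊥-elim (a∉ a∈)

  lift-polynomial : ∀ {p} → All 𝔨 p →
    ∃[ P ] (embed-polynomial P ≈ eval p 𝔱 × (NonZero p → Polynomials.NonZero 𝔎 P))
  lift-polynomial [] = [] , whole (λ s → embed.0#-homo s) , λ ()
  lift-polynomial {a ∷ p} (a∈ ∷ p∈) with choose-constant a∈ | lift-polynomial p∈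
  ... | b , b≈a | P , P≈p , nz = b ∷ P ,
    both b≈a P≈p (λ s b≈a P≈p → Ω.trans s (embed.+-homo s _ _)
      (Ω.+-cong s b≈a (Ω.trans s (embed.*-homo s _ _) (Ω.*-congˡ s P≈p)))) ,
    λ { (here a≉0)  → here λ b≈0 → a≉0 (both b≈a b≈0 λ s b≈a b≈0 → Ω.trans s (Ω.sym s b≈a)
          (Ω.trans s (IsRingHomomorphism.⟦⟧-cong (C.constant-hom s) b≈0)
            (IsRingHomomorphism.0#-homo (C.constant-hom s))))
      ; (there nz′) → there (nz nz′) }

  -- 𝐅 is defined through lists over 𝔎 evaluated at each s, whereas `Fractions` is formed from 𝔨 and
  -- 𝔱 in the ultraproduct. To pass back, preimages of the coefficients and of x itself are chosen
  -- at each s.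
  Fractions⊆𝐅 : Fractions ⊆ 𝐅
  Fractions⊆𝐅 {x} x∈@(g , n , g≉0 , g∈ , gx∈) =
    let q , q∈ , _ , g≈q = span-pows→eval 𝔱 n g∈
        p , p∈ , _ , gx≈p = span-pows→eval 𝔱 n gx∈
        Q , Q≈q , nzQ = lift-polynomial q∈
        P , P≈p , _   = lift-polynomial p∈
        nz = decidable-stable em λ ¬nz → g≉0 (trans g≈q (eval-≋[] q (All-≈0⇒≋[] (¬NonZero⇒All-≈0 q ¬nz)) 𝔱))
        xQ≈P = trans (*-congˡ (trans Q≈q (sym g≈q))) (trans (Field.*-comm ultrafield x g) (trans gx≈p (sym P≈p)))
    in (λ s → pick s em) ,
       (P , Q , nzQ nz , both (upward (λ {s} → picked s em) x∈base) xQ≈P λ s y≈x xQ≈P →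
          FiniteExtensions.hom-injective em (𝔉ᵃˡᵍ.closure s) (𝔉.k⟨t⟩ s) (𝔉ᵃˡᵍ.embed-hom s)
            (Ω.trans s (embed.*-homo s _ _) (Ω.trans s (Ω.*-congʳ s y≈x) xQ≈P))) ,
       upward (λ {s} → picked s em) x∈base
    where
    x∈base : x ∈ internal-base
    x∈base = Fractions⊆internal-base x∈
    pick : ∀ s → Dec (x s ∈ 𝔉ᵃˡᵍ.baseField s) → 𝔉.Carrier s
    pick s (yes (y , _)) = y
    pick s (no  _)       = 𝔉.0# s
    picked : ∀ s (y? : Dec (x s ∈ 𝔉ᵃˡᵍ.baseField s)) → x s ∈ 𝔉ᵃˡᵍ.baseField s →
             s ⊢ 𝔉ᵃˡᵍ.embed s (pick s y?) ≈ x s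
    picked s (yes (y , e)) _ = e
    picked s (no  x∉)      x∈ = ⊥-elim (x∉ x∈)

  𝐅⊆internal-base : 𝐅 ⊆ internal-base
  𝐅⊆internal-base x∈ = Fractions⊆internal-base (𝐅⊆Fractions x∈)

  𝐅-subfield : IsSubfield 𝐅
  𝐅-subfield = isSubfield-≐ (Fractions⊆𝐅 , 𝐅⊆Fractions) fractions-subfield

  𝐅-isRationalFunctionField : IsRationalFunctionField 𝔨 𝔱 𝐅
  𝐅-isRationalFunctionField = record
    { constants      = 𝔨-subfield
    ; functions      = 𝐅-subfield
    ; constants⊆     = λ a∈ → Fractions⊆𝐅 (T⊆Fractions 1 (span-pows-const (Over.additive 𝔨-subfield) 𝔱 0 a∈))
    ; t∈             = Fractions⊆𝐅 (T⊆Fractions 2 (T-respects 2 (*-identityʳ 𝔱) (t^∈ 1)))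
    ; transcendental = transcendental
    ; fraction       = 𝐅⊆Fractions
    }
    where
    transcendental : ∀ n → Independent Zero 𝔨 (pows 𝔱 n)
    transcendental zero    = tt
    transcendental (suc n) =
      (λ 𝔱ⁿ∈ → proper (λ s tⁿ∈ → proj₁
        (RFₛ.IsRationalFunctionField.transcendental (C.isRationalFunctionField s) (suc n))
        (≡.subst (λ vs → Extensionsₛ._^_ s (C.tᶜ s) n ∈ Spanₛ s (C.constants s) vs) (pows-at s 𝔱 n)
          (≡.subst (λ x → x ∈ Spanₛ s (C.constants s) (at s (pows 𝔱 n))) (^-at s 𝔱 n) tⁿ∈)))
        (span-at {A = C.constants} {pows 𝔱 n} 𝔱ⁿ∈)) ,
      transcendental n

  open DegreeFiltration 𝐅-isRationalFunctionField
    using (span-T-respects; span-T-scale; clear-span; common-denominator)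

  -- The number h of powers does not vary with s, so both layers of the span, vectors and powers of
  -- 𝔱, are finite lists to which Łoś applies.
  degree<-at : ∀ h {vs x} → x ∈ Span (T h) vs →
    ∀ᴰ[ s ] (x s ∈ Spanₛ s (RFₛ.Degree< s (C.constants s) (C.tᶜ s) h) (at s vs))
  degree<-at h {vs} x∈ = span-at (span-mono
    (λ {c} c∈ → upward (λ {s} → ≡.subst (λ vs → c s ∈ Spanₛ s (C.constants s) vs) (pows-at s 𝔱 h))
      (span-at c∈)) vs x∈)

  All-large : ∀ {A : Carrier → S → Set ℓ} {vs} → All (λ v → A v ∈ Large) vs →
              ∀ᴰ[ s ] All (λ v → A v s) vs
  All-large []         = whole λ s → []
  All-large (v∈ ∷ vs∈) = both v∈ (All-large vs∈) λ s → _∷_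

  -- Scaling the basis by a common denominator g of the structure constants turns
  -- g² (Σ γ e) into Σ (g γ) (g e), with coefficients in 𝔨[𝔱].

  linearly-disjoint : ∀ {K} (KF : FiniteField 𝐅 K) →
    ∀ᴰ[ s ] Independentₛ s (𝔉ᵃˡᵍ.baseField s) (at s (FiniteField.basis KF))
  linearly-disjoint {K} KF = both independentₛ productsₛ descend
    where
    open FiniteField KF
    K-* = IsSubfield.*-closed subfield
    denominator = common-denominator (span-T-respects basis) (span-T-scale basis)
      (All-tensor (All.map (λ f∈ → All.map (λ e∈ → clear-span basis (spans (K-* e∈ f∈))) basis∈) basis∈))
    g = proj₁ denominator
    h = proj₁ (proj₂ denominator)
    g≉0 = proj₁ (proj₂ (proj₂ denominator))
    cleared = proj₂ (proj₂ (proj₂ (proj₂ denominator)))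
    es = map (g *_) basis
    -- This is the `threshold` of `Disjointness`, which at every s depends only on the length of
    -- `es` and on h.
    N = suc (length es ℕ.* (h ℕ.+ 1))
    split : ∀ {P : Pred Carrier ℓ} es fs → All P (tensor es fs) → All (λ f → All (λ e → P (e * f)) es) fs
    split es []       _   = []
    split es (f ∷ fs) all =
      Allₚ.map⁻ (Allₚ.++⁻ˡ (map (_* f) es) all) ∷ split es fs (Allₚ.++⁻ʳ (map (_* f) es) all)
    products : All (λ e → All (λ e′ → (e * e′) ∈ Span (T h) es) es) es
    products = Allₚ.map⁺ (All.map (λ {e} e∈ → Allₚ.map⁺ (All.map (λ {e′} ee′∈ →
      span-T-respects es h (solve 3 (λ g e e′ → g :* (g :* (e′ :* e)) := g :* e :* (g :* e′)) refl g e e′)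
        (span-map-* g basis ee′∈)) e∈)) (split basis basis cleared))
    -- The powers of 𝔱 are independent over 𝔨 and `es` over 𝐅, so the tower law makes their products
    -- independent over 𝔨. As 𝔨 is internal, this descends.
    independentₛ = independent-at {C.constants} (tensor (pows 𝔱 N) es)
      (tensor-independent 𝔨-subfield 𝐅-subfield
        (IsRationalFunctionField.constants⊆ 𝐅-isRationalFunctionField)
        (Base.All-pows 𝐅-subfield (IsSubfield.*-closed 𝐅-subfield) (IsSubfield.1∈ 𝐅-subfield)
          (IsRationalFunctionField.t∈ 𝐅-isRationalFunctionField) N)
        (IsRationalFunctionField.transcendental 𝐅-isRationalFunctionField N)
        es (independent-map-* 𝐅-subfield g≉0 basis independent))
    productsₛ : ∀ᴰ[ s ] All (λ e → All (λ e′ → Ω._*_ s (e s) (e′ s) ∈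
      Spanₛ s (RFₛ.Degree< s (C.constants s) (C.tᶜ s) h) (at s es)) es) es
    productsₛ = All-large (All.map (λ es∈ → All-large (All.map (degree<-at h) es∈)) products)
    descend : ∀ s → Independentₛ s (C.constants s) (at s (tensor (pows 𝔱 N) es)) →
      All (λ e → All (λ e′ → Ω._*_ s (e s) (e′ s) ∈
        Spanₛ s (RFₛ.Degree< s (C.constants s) (C.tᶜ s) h) (at s es)) es) es →
      Independentₛ s (𝔉ᵃˡᵍ.baseField s) (at s basis)
    -- The factor g is removed again. In this direction a relation is merely multiplied by g at s,
    -- so nothing is asked of its value there.
    descend s i ees∈ = RFₛ.independent-map-*⁻ s (C.baseField-subfield s) (g s) (at s basis)
      (≡.subst (Independentₛ s (𝔉ᵃˡᵍ.baseField s))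
        (≡.trans (≡.sym (map-∘ basis)) (map-∘ basis))
        (RFₛ.Disjointness.independent-over-functions s (C.isRationalFunctionField s) (at s es) h
          (Allₚ.map⁺ (All.map Allₚ.map⁺ ees∈))
          (≡.subst (Independentₛ s (C.constants s))
            (≡.trans (tensor-at s (pows 𝔱 N) es) (≡.cong (λ ps → Extensionsₛ.tensor s ps (at s es))
              (≡.trans (pows-at s 𝔱 N) (≡.cong (λ n → Extensionsₛ.pows s (C.tᶜ s) (suc (n ℕ.* (h ℕ.+ 1))))
                (≡.sym (length-map (λ x → x s) es)))))) i)))

  -- The algebraic and separable parts of 𝔏

  module IntermediateFields (𝔏ₛ : ∀ s → Pred (Ω.Carrier s) ℓ)
    (algebraic : ∀ᴰ[ s ] Subfieldsₛ.IsAlgebraicExtension s (𝔉ᵃˡᵍ.baseField s) (𝔏ₛ s)) where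
    open Parts 𝔏ₛ

    𝔏-subfield : IsSubfield 𝔏
    𝔏-subfield = internal-subfield (upward (λ (ext , _) → Subfieldsₛ.IsExtension.top ext) algebraic)

    𝐅⊆𝔏 : 𝐅 ⊆ 𝔏
    𝐅⊆𝔏 x∈ = both algebraic (𝐅⊆internal-base x∈) λ s (ext , _) → Subfieldsₛ.IsExtension.base⊆top ext

    𝔏alg-subfield : IsSubfield 𝔏alg
    𝔏alg-subfield = ∩-subfield 𝔏-subfield (algebraic-subfield 𝐅-subfield)

    𝔏alg-extension : IsExtension 𝐅 𝔏alg
    𝔏alg-extension = record
      { base = 𝐅-subfield ; top = 𝔏alg-subfield
      ; base⊆top = λ x∈ → 𝐅⊆𝔏 x∈ , base⊆algebraic 𝐅-subfield x∈ }

    𝔏sep-subfield : IsSubfield 𝔏sep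
    𝔏sep-subfield = ∩-subfield 𝔏-subfield
      (separable-subfield (ultrafield-closed λ s → 𝔉ᵃˡᵍ.closed s) 𝐅-subfield)

    𝔏sep-extension : IsExtension 𝐅 𝔏sep
    𝔏sep-extension = record
      { base = 𝐅-subfield ; top = 𝔏sep-subfield
      ; base⊆top = λ x∈ → 𝐅⊆𝔏 x∈ , base⊆separable 𝐅-subfield x∈ }

    span-𝐅-at : ∀ {vs x} → x ∈ Span 𝐅 vs → ∀ᴰ[ s ] (x s ∈ Spanₛ s (𝔉ᵃˡᵍ.baseField s) (at s vs))
    span-𝐅-at {vs} x∈ = span-at (span-mono 𝐅⊆internal-base vs x∈)

    module _ (n : S → ℕ) (degree : ∀ᴰ[ s ] Subfieldsₛ.HasDegree s (𝔉ᵃˡᵍ.baseField s) (𝔏ₛ s) (n s)) where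

      -- For almost all s the basis remains independent over 𝔉ₛ, lies in 𝔏ₛ and keeps structure
      -- constants in 𝔉ₛ. It thus spans an intermediate field of the same degree.
      length∣degree : ∀ {K} (KF : FiniteField 𝐅 K) → K ⊆ 𝔏 →
                      ∀ᴰ[ s ] Lift ℓ (length (FiniteField.basis KF) ∣ n s)
      length∣degree {K} KF K⊆𝔏 =
        both (∩-closed degree (All-at (All.map K⊆𝔏 basis∈)))
          (∩-closed (linearly-disjoint KF) (∩-closed (span-𝐅-at (spans K.1∈))
            (All-large (All.map (λ e∈ → All-large (All.map (λ e′∈ →
              span-𝐅-at (spans (K.*-closed e∈ e′∈))) basis∈)) basis∈))))
          λ s (deg , es∈) (i , 1∈ , products) → lift (≡.subst (_∣ n s) (length-map (λ x → x s) basis)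
            (FiniteExtensions.degree-divides em (𝔉ᵃˡᵍ.closure s) (C.baseField-subfield s) deg (at s basis) es∈ i 1∈
              (Allₚ.map⁺ (All.map Allₚ.map⁺ products))))
        where
        open FiniteField KF
        module K = IsSubfield subfield

      -- All degrees of finite extensions inside V occur in the list `ks`, so the sum of its entries
      -- bounds them. An arbitrary V is allowed in order to treat 𝔏alg and 𝔏sep alike.
      finite : FinitelyMany (λ k → k ℕ.> 0 × ∀ᴰ[ s ] Lift ℓ (k ∣ n s)) →
               ∀ {V} → IsSubfield V → 𝐅 ⊆ V → V ⊆ 𝔏alg → IsFiniteExtension 𝐅 V
      finite (ks , complete) VF 𝐅⊆V V⊆ = bounded⇒finite 𝐅-subfield VF 𝐅⊆V (λ x∈ → proj₂ (V⊆ x∈)) (total ks)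
        λ { (K , KF , K⊆V , ≡.refl) → ∈⇒≤total (complete _
              (positive KF , length∣degree KF (λ x∈ → proj₁ (V⊆ (K⊆V x∈))))) }
        where
        positive : ∀ {K} (KF : FiniteField 𝐅 K) → length (FiniteField.basis KF) ℕ.> 0
        positive KF with FiniteField.basis KF | FiniteField.spans KF (IsSubfield.1∈ (FiniteField.subfield KF))
        ... | []     | base 1≈0 = ⊥-elim (Field.1≉0 ultrafield 1≈0)
        ... | _ ∷ _  | _        = s≤s z≤n

    𝔏alg≐𝔏sep : 𝔏alg ⊆ SeparableOver 𝐅 → IsSeparableExtension 𝐅 𝔏alg × 𝔏alg ≐ 𝔏sep
    𝔏alg≐𝔏sep sep = (𝔏alg-extension , sep) , (λ x∈ → proj₁ x∈ , sep x∈) ,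
      λ (x∈ , x-sep) → x∈ , separable⊆algebraic 𝐅-subfield x-sep

    -- By linear disjointness the minimal polynomial of x over 𝐅 remains minimal over
    -- 𝔉ₛ for almost all s.

    separable-part : ∀ᴰ[ s ] Subfieldsₛ.IsSeparableExtension s (𝔉ᵃˡᵍ.baseField s) (𝔏ₛ s) →
                     𝔏alg ⊆ SeparableOver 𝐅
    separable-part separable {x} (x∈𝔏 , x∈alg) =
      let c , i , ann = Base.minimalPolynomial 𝐅-subfield x∈alg in
      simple-root⇒separable 𝐅-subfield x∈alg ann λ p′≈0 →
        proper (λ s (((_ , 𝔏⊆sep) , x∈𝔏) , i , p∈ , p≈0 , p′≈0) →
            contradictory s c i p∈ p≈0 p′≈0 (𝔏⊆sep x∈𝔏))
          (∩-closed (∩-closed separable x∈𝔏) (∩-closed (pows-independent c i ann)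
            (∩-closed (All-at (All.map 𝐅⊆internal-base (proj₁ ann))) (∩-closed (proj₂ ann) p′≈0))))
      where
      pows-independent : ∀ c → Independent Zero 𝐅 (pows x (length c)) → Annihilates 𝐅 (c ∷ʳ 1#) x →
        ∀ᴰ[ s ] Independentₛ s (𝔉ᵃˡᵍ.baseField s) (at s (pows x (length c)))
      pows-independent c i ann = linearly-disjoint {Span 𝐅 (pows x d)} record
        { subfield    = Base.simple-subfield 𝐅-subfield d xᵈ∈
        ; base⊆       = Base.FiniteAlgebra.finite-base⊆ 𝐅-subfield (pows x d)
                          (Base.pows-1∈ 𝐅-subfield d xᵈ∈) (Base.pows-* 𝐅-subfield {x} {d} xᵈ∈)
        ; basis       = pows x d
        ; basis∈      = Over.span-members 𝐅-subfield (pows x d)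
        ; independent = i
        ; spans       = λ y∈ → y∈
        }
        where
        d = length c
        xᵈ∈ = root⇒power∈ 𝐅-subfield c ann
      -- Since the powers of x stay independent at s, the polynomial remains minimal over 𝔉ₛ and
      -- divides any f over 𝔉ₛ that kills x. If its derivative vanished at x, then so would that of
      -- f, and x could not be a simple root of f.
      contradictory : ∀ s c →
        Independentₛ s (𝔉ᵃˡᵍ.baseField s) (at s (pows x (length c))) →
        All (𝔉ᵃˡᵍ.baseField s) (at s (c ∷ʳ 1#)) →
        s ⊢ (eval (c ∷ʳ 1#) x s) ≈ Ω.0# s →
        s ⊢ (eval (derivative (c ∷ʳ 1#)) x s) ≈ Ω.0# s →
        ¬ (x s ∈ Subfieldsₛ.SeparableOver s (𝔉ᵃˡᵍ.baseField s))
      contradictory s c i p∈ p≈0 p′≈0 x-sep =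
        let f , annf , f′≉0 = Separability.separable⇒simple-root em (𝔉ᵃˡᵍ.closure s) (C.baseField-subfield s) x-sep
            u , _ , f≋up = Extensionsₛ.Base.minimalPolynomial-divides s (C.baseField-subfield s) {x s} {at s c} {f}
              (≡.subst (Independentₛ s (𝔉ᵃˡᵍ.baseField s))
                (≡.trans (pows-at s x (length c))
                  (≡.cong (Extensionsₛ.pows s (x s)) (≡.sym (length-map (λ y → y s) c)))) i)
              (≡.subst (All (𝔉ᵃˡᵍ.baseField s)) p≡ p∈ , p≈0′) annf
        in f′≉0 (Ω.trans s (Separability.eval-derivative-multiple em (𝔉ᵃˡᵍ.closure s) (C.baseField-subfield s)
             {f} u (at s c ∷ʳ Ω.1# s) (x s) f≋up p≈0′) (Ω.trans s (Ω.*-congˡ s p′≈0′) (Ω.zeroʳ s _)))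
        where
        p≡ : at s (c ∷ʳ 1#) ≡ at s c ∷ʳ Ω.1# s
        p≡ = map-++ (λ y → y s) c (1# ∷ [])
        p≈0′ : s ⊢ (Polynomialsₛ.eval s (at s c ∷ʳ Ω.1# s) (x s)) ≈ Ω.0# s
        p≈0′ = ≡.subst (λ y → s ⊢ y ≈ Ω.0# s)
          (≡.trans (eval-at s (c ∷ʳ 1#) x) (≡.cong (λ p → Polynomialsₛ.eval s p (x s)) p≡)) p≈0
        p′≈0′ : s ⊢ (Polynomialsₛ.eval s (Polynomialsₛ.derivative s (at s c ∷ʳ Ω.1# s)) (x s)) ≈ Ω.0# s
        p′≈0′ = ≡.subst (λ y → s ⊢ y ≈ Ω.0# s)
          (≡.trans (eval-at s (derivative (c ∷ʳ 1#)) x) (≡.cong (λ p → Polynomialsₛ.eval s p (x s))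
            (≡.trans (derivative-at s (c ∷ʳ 1#)) (≡.cong (Polynomialsₛ.derivative s) p≡)))) p′≈0

    characteristic-zero-part :
      ¬ (∃[ p ] (Prime p × ∀ᴰ[ s ] Polynomials.Characteristic (𝔽.commutativeRing s) p)) →
      𝔏alg ⊆ SeparableOver 𝐅
    characteristic-zero-part char0 (x∈𝔏 , x∈alg) = decidable-stable em λ x∉ →
      -- The equation p · 1 = 0 holds at almost all s in 𝔉ₛᵃˡᵍ, and the injective embedding of
      -- constants reflects it to 𝔽ₛ.
      let p , pr , p≈0 = inseparable⇒hasPrimeCharacteristic 𝐅-subfield x∈alg x∉ in
      char0 (p , pr , upward (λ {s} p≈0 → Characteristics.prime-characteristic (𝔽 s) pr
        (FiniteExtensions.hom-injective em (𝔉ᵃˡᵍ.closure s) (𝔽 s) (C.constant-hom s)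
          (Ω.trans s (multiple s p) (Ω.trans s (Ω.reflexive s (≡.sym (multiple-at s p)))
            (Ω.trans s p≈0 (Ω.sym s (IsRingHomomorphism.0#-homo (C.constant-hom s)))))))) p≈0)
      where
      open Mult (Field.semiring ultrafield) using () renaming (_×_ to _·_)
      module Multₛ s = Mult (Ω.semiring s)
      module Mult𝔽 s = Mult (𝔽.semiring s)
      multiple-at : ∀ s n → (n · 1#) s ≡ Multₛ._×_ s n (Ω.1# s)
      multiple-at s zero    = ≡.refl
      multiple-at s (suc n) = ≡.cong (Ω._+_ s (Ω.1# s)) (multiple-at s n)
      multiple : ∀ s n → s ⊢ C.constant s (Mult𝔽._×_ s n (𝔽.1# s)) ≈ Multₛ._×_ s n (Ω.1# s)
      multiple s zero    = IsRingHomomorphism.0#-homo (C.constant-hom s)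
      multiple s (suc n) = Ω.trans s (IsRingHomomorphism.+-homo (C.constant-hom s) _ _)
        (Ω.+-cong s (IsRingHomomorphism.1#-homo (C.constant-hom s)) (multiple s n))

mainTheorem7 : ∀ {ℓ : Level} → ExcludedMiddle ℓ →
  {S : Set ℓ} → Infinite S →
  (D : Ultrafilter S) → let open Ultrafilter D in NonPrincipal →
  (𝔽 : S → Field ℓ)
  (𝔉 : ∀ s → RationalFunctionField (𝔽 s))
  (𝔉ᵃˡᵍ : ∀ s → AlgebraicClosure (RationalFunctionField.k⟨t⟩ (𝔉 s)))
  (𝔏ₛ : ∀ s → Pred (AlgebraicClosure.Carrier (𝔉ᵃˡᵍ s)) ℓ) →
  let
    module Ω s = Subfields (AlgebraicClosure.commutativeRing (𝔉ᵃˡᵍ s))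
    𝔉ₛ = λ s → AlgebraicClosure.baseField (𝔉ᵃˡᵍ s)
    open Functions D 𝔽 𝔉 𝔉ᵃˡᵍ
    open Parts 𝔏ₛ
    open Subfields 𝒰ᵃˡᵍ
  in
  ∀ᴰ[ s ] Ω.IsAlgebraicExtension s (𝔉ₛ s) (𝔏ₛ s) →
  ( (n : S → ℕ) →
    ∀ᴰ[ s ] Ω.HasDegree s (𝔉ₛ s) (𝔏ₛ s) (n s) →
    FinitelyMany (λ k → k ℕ.> 0 × ∀ᴰ[ s ] Lift ℓ (k ∣ n s)) →
    IsFiniteExtension 𝐅 𝔏alg ×
    (IsFiniteExtension 𝐅 𝔏sep × IsSeparableExtension 𝐅 𝔏sep) )
  ×
  ( ∀ᴰ[ s ] Ω.IsSeparableExtension s (𝔉ₛ s) (𝔏ₛ s) →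
    IsSeparableExtension 𝐅 𝔏alg × 𝔏alg ≐ 𝔏sep )
  ×
  ( ¬ (∃[ p ] (Prime p × ∀ᴰ[ s ] Polynomials.Characteristic (Field.commutativeRing (𝔽 s)) p)) →
    IsSeparableExtension 𝐅 𝔏alg × 𝔏alg ≐ 𝔏sep )
mainTheorem7 em inf D nonPrincipal 𝔽 𝔉 𝔉ᵃˡᵍ 𝔏ₛ algebraic =
  (λ n degree ks →
    finite n degree ks 𝔏alg-subfield (IsExtension.base⊆top 𝔏alg-extension) (λ x∈ → x∈) ,
    finite n degree ks 𝔏sep-subfield (IsExtension.base⊆top 𝔏sep-extension)
      (λ (x∈ , x-sep) → x∈ , separable⊆algebraic 𝐅-subfield x-sep) ,
    𝔏sep-extension , proj₂) ,
  (λ separable → 𝔏alg≐𝔏sep (separable-part separable)) ,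
  (λ char0 → 𝔏alg≐𝔏sep (characteristic-zero-part char0))
  where
  open AlgebraicParts em D 𝔽 𝔉 𝔉ᵃˡᵍ
  open IntermediateFields 𝔏ₛ algebraic
  open Functions D 𝔽 𝔉 𝔉ᵃˡᵍ using (𝒰ᵃˡᵍ)
  open Subfields 𝒰ᵃˡᵍ using (IsExtension)
  open Separability em (Łoś.ultrafield em D (λ s → AlgebraicClosure.closure (𝔉ᵃˡᵍ s))) using (separable⊆algebraic)
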